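{- Let $W\equiv W(t)$ be the power series in $t$ defined by $W=t(2+W^3)$. Then the generating function of Kreweras' walks ending on the $x$-axis, $Q(x,0;t)=\sum_{i,n\ge 0}a_{i,0}(n)x^it^n$, is $$Q(x,0;t)= \frac 1 {tx} \left( \frac 1 {2t} - \frac 1 x - \left( \frac 1 W -\frac 1 x \right) \sqrt{1-xW^2} \right).$$ Consequently, for every $i\ge 0$, the length generating function of walks ending at $(i,0)$ is $$[x^i] Q(x,0;t) = \frac{W^{2i+1}}{2\cdot 4^i\, t}\left( C_i-\frac{C_{i+1}W^3}4\right),$$ where $C_i=\binom{2i}{i}/(i+1)$ is the $i$-th Catalan number. Moreover, for all $i,n\ge 0$, the number of such walks of length $3n+2i$ is $$a_{i,0}(3n+2i)=\frac{4 ^n (2i+1)}{(n+i+1)(2n+2i+1)} \binom{2i}{i}\binom{3n+2i}{n} .$$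
   Context: Kreweras' walks are planar lattice walks that start from $(0,0)$, consist of South steps $(0,-1)$, West steps $(-1,0)$ and North-East steps $(1,1)$, and always stay in the first quadrant $\{(i,j): i\ge 0,\ j\ge 0\}$. For $i,j,n\ge 0$, $a_{i,j}(n)$ is the number of $n$-step walks of this type ending at $(i,j)$, and $Q(x,y;t)=\sum_{i,j,n\ge 0}a_{i,j}(n)x^iy^jt^n$. All series are formal power series (or Laurent series) in $t$ whose coefficients are Laurent polynomials in $x$; $[x^i]F$ denotes the coefficient of $x^i$ in $F$; the square root $\sqrt{1-xW^2}$ is the power series in $t$ with constant term $1$. -}

module Defs where

open import Algebra.Bundles using (RawRing)
import Algebra.Definitions.RawSemiring as RawSemiringDefinitions
open import Data.Bool.Base using (if_then_else_)
open import Data.Fin.Base using (toℕ)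
open import Data.Integer.Base as ℤ using (ℤ; +_; -[1+_]; 0ℤ; 1ℤ; -1ℤ)
import Data.Integer.Properties as ℤ
open import Data.List.Base
  using (List; []; _∷_; _++_; map; foldl; foldr; filter; length; upTo; cartesianProductWith)
open import Data.List.Relation.Unary.All using (All; all?)
open import Data.List.Scans.Base using (scanl)
open import Data.Nat.Base as ℕ using (ℕ; zero; suc; _∸_)
open import Data.Nat.Combinatorics using (_C_)
open import Data.Product.Base using (_×_; _,_; proj₁; proj₂)
open import Data.Product.Properties using (≡-dec)
open import Data.Rational.Base as ℚ using (ℚ; +-*-rawRing)
open import Level using (Level)
open import Relation.Binary.PropositionalEquality.Core using (_≡_)
open import Relation.Nullary.Decidable.Core using (Dec; does; _×-dec_)

private
  variable
    a b c ℓ : Level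

data Step : Set where
  south west north-east : Step

Point : Set
Point = ℤ × ℤ

move : Point → Step → Point
move (i , j) south      = i ℤ.+ 0ℤ  , j ℤ.+ -1ℤ
move (i , j) west       = i ℤ.+ -1ℤ , j ℤ.+ 0ℤ
move (i , j) north-east = i ℤ.+ 1ℤ  , j ℤ.+ 1ℤ

origin : Point
origin = 0ℤ , 0ℤ

visited : List Step → List Point
visited = scanl move origin

endpoint : List Step → Point
endpoint = foldl move origin

InQuadrant : Point → Set
InQuadrant (i , j) = 0ℤ ℤ.≤ i × 0ℤ ℤ.≤ j

WalkTo : Point → List Step → Set
WalkTo p w = All InQuadrant (visited w) × endpoint w ≡ p

walkTo? : ∀ p w → Dec (WalkTo p w)
walkTo? p w =
  all? (λ (i , j) → (0ℤ ℤ.≤? i) ×-dec (0ℤ ℤ.≤? j)) (visited w)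
    ×-dec ≡-dec ℤ._≟_ ℤ._≟_ (endpoint w) p

stepSequences : ℕ → List (List Step)
stepSequences zero    = [] ∷ []
stepSequences (suc n) =
  cartesianProductWith _∷_ (south ∷ west ∷ north-east ∷ []) (stepSequences n)

a[_,_] : ℕ → ℕ → ℕ → ℕ
a[ i , j ] n = length (filter (walkTo? (+ i , + j)) (stepSequences n))

module RingOps (R : RawRing c ℓ) where
  open RawRing R public
  open RawSemiringDefinitions rawSemiring public using (_^_; sum)

  infixl 6 _-_

  _-_ : Carrier → Carrier → Carrier
  x - y = x + (- y)

-- Laurent polynomials in x over R: finite formal sums of terms (e , r),
-- standing for r xᵉ. Exponents may repeat, so equality is equality of
-- all coefficients.

module LaurentPolynomial (R : RawRing c ℓ) where
  private module R = RingOps R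

  Polynomial : Set c
  Polynomial = List (ℤ × R.Carrier)

  coeff : ℤ → Polynomial → R.Carrier
  coeff k = foldr (λ (e , r) s → if does (e ℤ.≟ k) then r R.+ s else s) R.0#

  monomial : ℤ → R.Carrier → Polynomial
  monomial e r = (e , r) ∷ []

  ring : RawRing c ℓ
  ring = record
    { Carrier = Polynomial
    ; _≈_     = λ p q → ∀ k → coeff k p R.≈ coeff k q
    ; _+_     = _++_
    ; _*_     = cartesianProductWith (λ (e , r) (f , s) → e ℤ.+ f , r R.* s)
    ; -_      = map (λ (e , r) → e , R.- r)
    ; 0#      = []
    ; 1#      = monomial 0ℤ R.1#
    }

module PowerSeries (R : RawRing c ℓ) where
  private module R = RingOps R

  Series : Set c
  Series = ℕ → R.Carrier

  const : R.Carrier → Series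
  const r zero    = r
  const r (suc _) = R.0#

  -- shift v f is tᵛ f.
  shift : ℕ → Series → Series
  shift zero    f n       = f n
  shift (suc v) f zero    = R.0#
  shift (suc v) f (suc n) = shift v f n

  t : Series
  t = shift 1 (const R.1#)

  ring : RawRing c ℓ
  ring = record
    { Carrier = Series
    ; _≈_     = λ f g → ∀ n → f n R.≈ g n
    ; _+_     = λ f g n → f n R.+ g n
    ; _*_     = λ f g n → R.sum {suc n} (λ k → f (toℕ k) R.* g (n ∸ toℕ k))
    ; -_      = λ f n → R.- f n
    ; 0#      = const R.0#
    ; 1#      = const R.1#
    }

-- Formal Laurent series in t: t^- v ∙ f stands for t⁻ᵛ f with f a power
-- series. The representation is not unique, so equality is equality of
-- all coefficients.

record Laurent (A : Set a) : Set a where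
  constructor t^-_∙_
  field
    pole   : ℕ
    series : ℕ → A

mapCoeffs : {A : Set a} {B : Set b} → (A → B) → Laurent A → Laurent B
mapCoeffs h (t^- v ∙ f) = t^- v ∙ (λ n → h (f n))

module LaurentSeries (R : RawRing c ℓ) where
  private
    module R = RingOps R
    module PS = PowerSeries R
    module P = RingOps PS.ring

  -- The coefficient of tᵏ in t⁻ᵛ f is that of tᵏ⁺ᵛ in f.
  coeff : ℤ → Laurent R.Carrier → R.Carrier
  coeff k (t^- v ∙ f) with k ℤ.+ (+ v)
  ... | + n      = f n
  ... | -[1+ _ ] = R.0#

  fromPowerSeries : PS.Series → Laurent R.Carrier
  fromPowerSeries f = t^- 0 ∙ f

  const : R.Carrier → Laurent R.Carrier
  const r = fromPowerSeries (PS.const r)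

  t⁻¹ : Laurent R.Carrier
  t⁻¹ = t^- 1 ∙ P.1#

  ring : RawRing c ℓ
  ring = record
    { Carrier = Laurent R.Carrier
    ; _≈_     = λ F G → ∀ k → coeff k F R.≈ coeff k G
    ; _+_     = λ (t^- v ∙ f) (t^- w ∙ g) →
                  t^- (v ℕ.+ w) ∙ (PS.shift w f P.+ PS.shift v g)
    ; _*_     = λ (t^- v ∙ f) (t^- w ∙ g) → t^- (v ℕ.+ w) ∙ (f P.* g)
    ; -_      = λ (t^- v ∙ f) → t^- v ∙ (P.- f)
    ; 0#      = fromPowerSeries P.0#
    ; 1#      = fromPowerSeries P.1#
    }

module ℚ[x,x⁻¹] where
  open LaurentPolynomial +-*-rawRing public
  open RingOps ring public

  x x⁻¹ : Carrier
  x   = monomial 1ℤ ℚ.1ℚ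
  x⁻¹ = monomial -1ℤ ℚ.1ℚ

  const : ℚ → Carrier
  const = monomial 0ℤ

module ℚ⟦t⟧ where
  open PowerSeries +-*-rawRing public
  open RingOps ring public

module ℚ⦅t⦆ where
  open LaurentSeries +-*-rawRing public
  open RingOps ring public

module ℚ[x,x⁻¹]⟦t⟧ where
  open PowerSeries ℚ[x,x⁻¹].ring public
  open RingOps ring public

  x : Carrier
  x = const ℚ[x,x⁻¹].x

  fromℚ⟦t⟧ : ℚ⟦t⟧.Carrier → Carrier
  fromℚ⟦t⟧ f n = ℚ[x,x⁻¹].const (f n)

module ℚ[x,x⁻¹]⦅t⦆ where
  open LaurentSeries ℚ[x,x⁻¹].ring public
  open RingOps ring public

  x⁻¹ : Carrier
  x⁻¹ = const ℚ[x,x⁻¹].x⁻¹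

  fromℚ : ℚ → Carrier
  fromℚ q = const (ℚ[x,x⁻¹].const q)

  fromℚ⦅t⦆ : ℚ⦅t⦆.Carrier → Carrier
  fromℚ⦅t⦆ = mapCoeffs ℚ[x,x⁻¹].const

  [x^_] : ℕ → Carrier → ℚ⦅t⦆.Carrier
  [x^ i ] = mapCoeffs (ℚ[x,x⁻¹].coeff (+ i))

fromℕ : ℕ → ℚ
fromℕ n = (+ n) ℚ./ 1

-- Q(x,0;t). An n-step walk cannot reach abscissa i > n, so the inner sum
-- over i stops at n.
Q[x,0] : ℚ[x,x⁻¹]⟦t⟧.Carrier
Q[x,0] n = map (λ i → + i , fromℕ (a[ i , 0 ] n)) (upTo (suc n))

catalan : ℕ → ℚ
catalan i = (+ ((2 ℕ.* i) C i)) ℚ./ suc i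

IsW : ℚ⟦t⟧.Carrier → Set
IsW W = W ≈ t * (const (fromℕ 2) + W ^ 3)
  where open ℚ⟦t⟧

IsReciprocal : ℚ⦅t⦆.Carrier → ℚ⦅t⦆.Carrier → Set
IsReciprocal F V = F * V ≈ 1#
  where open ℚ⦅t⦆

-- The constant term selects √ F among the two square roots ± S.
IsSqrt : ℚ[x,x⁻¹]⟦t⟧.Carrier → ℚ[x,x⁻¹]⟦t⟧.Carrier → Set
IsSqrt F S = S 0 ℚ[x,x⁻¹].≈ ℚ[x,x⁻¹].1# × S * S ≈ F
  where open ℚ[x,x⁻¹]⟦t⟧

1-xW² : ℚ⟦t⟧.Carrier → ℚ[x,x⁻¹]⟦t⟧.Carrier
1-xW² W = 1# - x * fromℚ⟦t⟧ W ^ 2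
  where open ℚ[x,x⁻¹]⟦t⟧

{-# OPTIONS --safe #-}
-- Write p = Q(x,0;t) and p₀ = Q(0,0;t). With c the Catalan series of x W² / 4 and d = (c - 1) / x, put
-- p = ½ (2 + W³) (c - W d); it satisfies p = 1 + t² x p² + 2 t (p - p₀) / x. Let
-- H(x,y) = (x p(x) - y p(y)) / (x - y). This equation for p makes V = H / (1 - t x y H) a solution of the
-- functional equation x y V = x y + t (x + y + x² y²) V - t x p(x) - t y p(y) of Kreweras' walks, so V is their
-- generating function and p = V(x,0) that of the walks ending on the axis. The formula with the square root holds
-- because both of its sides, suitably cleared of denominators, have equal squares and equal leading terms in t.
-- The coefficients of the powers of W follow from Wᵏ⁺¹ = t (2 Wᵏ + Wᵏ⁺³).
module Submission where

open import Algebra.Bundles using (CommutativeRing)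
open import Algebra.Morphism.Structures using (IsRingHomomorphism)
import Algebra.Properties.AbelianGroup as AbelianGroupProperties
import Algebra.Properties.CommutativeSemiring.Exp as CommutativeSemiringExp
import Algebra.Properties.Monoid.Mult.TCOptimised as Mult
import Algebra.Properties.Ring as RingProperties
import Algebra.Properties.Semiring.Exp as SemiringExp
import Algebra.Properties.Semiring.Mult.TCOptimised as SemiringMult
import Algebra.Solver.Ring as RingSolver
open import Algebra.Solver.Ring.AlmostCommutativeRing
  using (fromCommutativeRing; _-Raw-AlmostCommutative⟶_)
open import Data.Bool.Base using (Bool; true; false; _∧_; if_then_else_)
open import Data.Integer.Base as ℤ using (ℤ; +_; -[1+_]; 0ℤ; 1ℤ; -1ℤ)
import Data.Integer.Properties as ℤ
open import Data.Integer.Solver using () renaming (module +-*-Solver to ℤ-Solver)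
open import Data.List.Base using (List; []; _∷_; _++_; map; foldl; filter; length; upTo; applyUpTo)
open import Data.List.Properties using (length-++; filter-++)
open import Data.List.Relation.Unary.All using (All; all?)
open import Data.List.Scans.Base using (scanl)
open import Data.Maybe.Base using (just; nothing)
open import Data.Nat.Base as ℕ using (ℕ; zero; suc; s≤s; z≤n; NonZero)
open import Data.Nat.Combinatorics using (_C_; nCk+nC[k+1]≡[n+1]C[k+1]; k>n⇒nCk≡0; nC1≡n)
import Data.Nat.Properties as ℕ
open import Data.Nat.Solver using (module +-*-Solver)
open import Data.Product.Base using (_×_; _,_; proj₁; proj₂)
open import Data.Product.Properties using (≡-dec; ×-≡,≡→≡)
open import Data.Rational.Base as ℚ using (ℚ; 0ℚ; 1ℚ; ½; _/_)
import Data.Rational.Properties as ℚ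
open import Data.Rational.Unnormalised.Base as ℚᵘ using (mkℚᵘ; *≡*)
import Data.Rational.Unnormalised.Properties as ℚᵘ
import Data.Sign.Base as Sign
open import Function.Base using (_∘_; id)
open import Level using (Level)
open import Relation.Binary.Definitions using (WeaklyDecidable)
open import Relation.Binary.PropositionalEquality as ≡ using (_≡_; cong)
import Relation.Binary.Reasoning.Setoid as SetoidReasoning
open import Relation.Nullary.Decidable.Core using (Dec; yes; no; does; _×-dec_)
open import Relation.Nullary.Negation.Core using (contradiction)
open import Relation.Unary using (Pred; Decidable)
open import Defs

-- The formula for p is the claimed one rewritten: c = 1 + (x W² / 4) c² gives √(1 - x W²) = 1 - x
-- W² c / 2, and 1/t = (2 + W³) / W then turns the right side into ½ (2 + W³) (c - W d), where no
-- negative power is left. The walks are never solved for: V is checked against a recurrence on the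
-- length, which has only one solution, and p is its value at y = 0. The obstacle is that c is a
-- power series in x, while the statement is about series in t over Laurent polynomials in x, and
-- neither ring contains the other. So p is identified with the walk counts as a power series in x
-- over ℚ⟦t⟧. It is then polynomial in x at each power of t, hence has a meaning in the other ring,
-- and only its quadratic equation is carried there. The square root and 1/W are arbitrary series
-- with the defining properties, so equalities about them come from cancelling non-zero-divisors.

private
  variable
    c ℓ c′ ℓ′ : Level

-- Polynomial identities with integer coefficients in a commutative ring

module IntegerCoefficients (R : CommutativeRing c ℓ) where
  open CommutativeRing R
  open RingProperties ring using (-‿distribˡ-*; -‿distribʳ-*; -0#≈0#)
  open AbelianGroupProperties +-abelianGroup
    using (⁻¹-∙-comm; ⁻¹-involutive; xyx⁻¹≈y)
  open Mult +-monoid using (×-homo-+; 1+×) renaming (_×_ to infixl 8 _·_)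
  open SemiringMult semiring using (×1-homo-*)
  open SetoidReasoning setoid

  -- Equality in the series rings is not decidable, so the solver normalises with coefficients in ℤ,
  -- and this canonical map interprets them.
  fromℤ : ℤ → Carrier
  fromℤ (+ n)    = n · 1#
  fromℤ -[1+ n ] = - (suc n · 1#)

  fromℤ-⊖ : ∀ m n → fromℤ (m ℤ.⊖ n) ≈ m · 1# - n · 1#
  fromℤ-⊖ zero zero = sym (-‿inverseʳ 0#)
  fromℤ-⊖ zero (suc n) = sym (+-identityˡ _)
  fromℤ-⊖ (suc m) zero = sym (trans (+-congˡ -0#≈0#) (+-identityʳ _))
  fromℤ-⊖ (suc m) (suc n) = begin
    fromℤ (suc m ℤ.⊖ suc n)                ≡⟨ ≡.cong fromℤ (ℤ.[1+m]⊖[1+n]≡m⊖n m n) ⟩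
    fromℤ (m ℤ.⊖ n)                        ≈⟨ fromℤ-⊖ m n ⟩
    m · 1# - n · 1#                        ≈⟨ +-congʳ (xyx⁻¹≈y 1# (m · 1#)) ⟨
    (1# + m · 1# - 1#) - n · 1#            ≈⟨ +-assoc _ _ _ ⟩
    (1# + m · 1#) + (- 1# - n · 1#)        ≈⟨ +-congˡ (⁻¹-∙-comm 1# (n · 1#)) ⟩
    (1# + m · 1#) - (1# + n · 1#)          ≈⟨ +-cong (1+× m 1#) (-‿cong (1+× n 1#)) ⟨
    suc m · 1# - suc n · 1#                ∎

  fromℤ-neg : ∀ i → fromℤ (ℤ.- i) ≈ - fromℤ i
  fromℤ-neg (+ zero)  = sym -0#≈0#
  fromℤ-neg (+ suc n) = refl
  fromℤ-neg -[1+ n ]  = sym (⁻¹-involutive _)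

  fromℤ-+ : ∀ i j → fromℤ (i ℤ.+ j) ≈ fromℤ i + fromℤ j
  fromℤ-+ (+ m) (+ n)       = ×-homo-+ 1# m n
  fromℤ-+ (+ m) -[1+ n ]    = fromℤ-⊖ m (suc n)
  fromℤ-+ -[1+ m ] (+ n)    = trans (fromℤ-⊖ n (suc m)) (+-comm _ _)
  fromℤ-+ -[1+ m ] -[1+ n ] = begin
    - (suc (suc (m ℕ.+ n)) · 1#)     ≡⟨ ≡.cong (λ k → - (suc k · 1#)) (ℕ.+-suc m n) ⟨
    - ((suc m ℕ.+ suc n) · 1#)       ≈⟨ -‿cong (×-homo-+ 1# (suc m) (suc n)) ⟩
    - (suc m · 1# + suc n · 1#)      ≈⟨ ⁻¹-∙-comm _ _ ⟨
    - (suc m · 1#) - suc n · 1#      ∎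

  fromℤ-+◃ : ∀ n → fromℤ (Sign.+ ℤ.◃ n) ≈ n · 1#
  fromℤ-+◃ zero    = refl
  fromℤ-+◃ (suc n) = refl

  fromℤ--◃ : ∀ n → fromℤ (Sign.- ℤ.◃ n) ≈ - (n · 1#)
  fromℤ--◃ zero    = sym -0#≈0#
  fromℤ--◃ (suc n) = refl

  fromℤ-* : ∀ i j → fromℤ (i ℤ.* j) ≈ fromℤ i * fromℤ j
  fromℤ-* (+ m) (+ n) = trans (fromℤ-+◃ (m ℕ.* n)) (×1-homo-* m n)
  fromℤ-* (+ m) -[1+ n ] = begin
    fromℤ (Sign.- ℤ.◃ m ℕ.* suc n)  ≈⟨ fromℤ--◃ (m ℕ.* suc n) ⟩
    - ((m ℕ.* suc n) · 1#)          ≈⟨ -‿cong (×1-homo-* m (suc n)) ⟩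
    - (m · 1# * suc n · 1#)         ≈⟨ -‿distribʳ-* _ _ ⟩
    m · 1# * - (suc n · 1#)         ∎
  fromℤ-* -[1+ m ] (+ n) = begin
    fromℤ (Sign.- ℤ.◃ suc m ℕ.* n)  ≈⟨ fromℤ--◃ (suc m ℕ.* n) ⟩
    - ((suc m ℕ.* n) · 1#)          ≈⟨ -‿cong (×1-homo-* (suc m) n) ⟩
    - (suc m · 1# * n · 1#)         ≈⟨ -‿distribˡ-* _ _ ⟩
    - (suc m · 1#) * n · 1#         ∎
  fromℤ-* -[1+ m ] -[1+ n ] = begin
    (suc m ℕ.* suc n) · 1#               ≈⟨ ×1-homo-* (suc m) (suc n) ⟩
    suc m · 1# * suc n · 1#              ≈⟨ ⁻¹-involutive _ ⟨
    - - (suc m · 1# * suc n · 1#)        ≈⟨ -‿cong (-‿distribʳ-* _ _) ⟩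
    - (suc m · 1# * - (suc n · 1#))      ≈⟨ -‿distribˡ-* _ _ ⟩
    - (suc m · 1#) * - (suc n · 1#)      ∎

  morphism : ℤ.+-*-rawRing -Raw-AlmostCommutative⟶ fromCommutativeRing R
  morphism = record
    { ⟦_⟧    = fromℤ
    ; +-homo = fromℤ-+
    ; *-homo = fromℤ-*
    ; -‿homo = fromℤ-neg
    ; 0-homo = refl
    ; 1-homo = refl
    }

  _≟′_ : WeaklyDecidable (λ i j → fromℤ i ≈ fromℤ j)
  i ≟′ j with i ℤ.≟ j
  ... | yes i≡j = just (reflexive (≡.cong fromℤ i≡j))
  ... | no _    = nothing

  open RingSolver ℤ.+-*-rawRing (fromCommutativeRing R) morphism _≟′_ public
    using (solve; con; _:=_; _:+_; _:*_; _:-_; :-_)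

-- A non-zero-divisor. Factors such as x - y are cancelled through this property, as the series
-- rings have no division.
Regular : (R : CommutativeRing c ℓ) → CommutativeRing.Carrier R → Set _
Regular R r = ∀ {s} → r * s ≈ 0# → s ≈ 0#
  where open CommutativeRing R

module RingLemmas (R : CommutativeRing c ℓ) where
  open CommutativeRing R
  open IntegerCoefficients R
  open SetoidReasoning setoid

  -- Discards one hypothesis l ≈ r, with its multiplier a, from a linear combination.
  +-vanishing : ∀ {l r} u a → l ≈ r → u + a * (l - r) ≈ u
  +-vanishing {l} {r} u a l≈r = begin
    u + a * (l - r)  ≈⟨ +-congˡ (*-congˡ (+-congʳ l≈r)) ⟩
    u + a * (r - r)  ≈⟨ solve 3 (λ u a r → u :+ a :* (r :- r) := u) refl u a r ⟩
    u                ∎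

  x-y≈0⇒x≈y : ∀ {x y} → x - y ≈ 0# → x ≈ y
  x-y≈0⇒x≈y {x} {y} eq = begin
    x            ≈⟨ solve 2 (λ x y → x := (x :- y) :+ y) refl x y ⟩
    x - y + y    ≈⟨ +-congʳ eq ⟩
    0# + y       ≈⟨ +-identityˡ y ⟩
    y            ∎

  ≈*-respˡ : ∀ {a b b′ c} → a ≈ b * c → b ≈ b′ → a ≈ b′ * c
  ≈*-respˡ a≈ b≈ = trans a≈ (*-congʳ b≈)

  ≈*-respʳ : ∀ {a b c c′} → a ≈ b * c → c ≈ c′ → a ≈ b * c′
  ≈*-respʳ a≈ c≈ = trans a≈ (*-congˡ c≈)

-- Formal power series as a commutative ring

module PowerSeriesRing (R : CommutativeRing c ℓ) where
  private module R = CommutativeRing R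
  open PowerSeries R.rawRing public using (Series; const; shift)
  open RingOps (PowerSeries.ring R.rawRing) public using (_≈_; _+_; _*_; -_; 0#; 1#; _-_; _^_)
  open IntegerCoefficients R
  open SetoidReasoning R.setoid

  tail : Series → Series
  tail f n = f (suc n)

  -- The tail of `const r` vanishes at every index without being `0#` by computation, hence the
  -- pointwise hypothesis.
  pointwise-zero-* : ∀ {z} → (∀ n → z n R.≈ R.0#) → ∀ f n → (z * f) n R.≈ R.0#
  pointwise-zero-* z≈0 f zero    = R.trans (R.+-identityʳ _) (R.trans (R.*-congʳ (z≈0 0)) (R.zeroˡ _))
  pointwise-zero-* {z} z≈0 f (suc n) = begin
    z 0 R.* f (suc n) R.+ (tail z * f) n  ≈⟨ R.+-cong (R.*-congʳ (z≈0 0)) (pointwise-zero-* (λ k → z≈0 (suc k)) f n) ⟩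
    R.0# R.* f (suc n) R.+ R.0#           ≈⟨ R.+-identityʳ _ ⟩
    R.0# R.* f (suc n)                    ≈⟨ R.zeroˡ _ ⟩
    R.0#                                  ∎

  const-* : ∀ r f n → (const r * f) n R.≈ r R.* f n
  const-* r f zero    = R.+-identityʳ _
  const-* r f (suc n) =
    R.trans (R.+-congˡ (pointwise-zero-* (λ _ → R.refl) f n)) (R.+-identityʳ _)

  *-cong : ∀ {f f′ g g′} → f ≈ f′ → g ≈ g′ → f * g ≈ f′ * g′
  *-cong f≈ g≈ zero    = R.+-congʳ (R.*-cong (f≈ 0) (g≈ 0))
  *-cong f≈ g≈ (suc n) =
    R.+-cong (R.*-cong (f≈ 0) (g≈ (suc n))) (*-cong (λ k → f≈ (suc k)) g≈ n)

  distribʳ : ∀ h f g n → ((f + g) * h) n R.≈ (f * h) n R.+ (g * h) n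
  distribʳ h f g zero = solve 3 (λ f g h →
    (f :+ g) :* h :+ con 0ℤ := (f :* h :+ con 0ℤ) :+ (g :* h :+ con 0ℤ)) R.refl (f 0) (g 0) (h 0)
  distribʳ h f g (suc n) = begin
    (f 0 R.+ g 0) R.* h (suc n) R.+ ((tail f + tail g) * h) n
      ≈⟨ R.+-congˡ (distribʳ h (tail f) (tail g) n) ⟩
    (f 0 R.+ g 0) R.* h (suc n) R.+ ((tail f * h) n R.+ (tail g * h) n)
      ≈⟨ solve 5 (λ f g h a b → (f :+ g) :* h :+ (a :+ b) := (f :* h :+ a) :+ (g :* h :+ b))
           R.refl (f 0) (g 0) (h (suc n)) ((tail f * h) n) ((tail g * h) n) ⟩
    (f 0 R.* h (suc n) R.+ (tail f * h) n) R.+ (g 0 R.* h (suc n) R.+ (tail g * h) n) ∎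

  -- The product unfolds from the first coefficient of the left factor; commutativity needs the
  -- mirror image, which splits off the last one.
  *-suc′ : ∀ f g n → (f * g) (suc n) R.≈ (f * tail g) n R.+ f (suc n) R.* g 0
  *-suc′ f g zero = solve 4 (λ a b c d → a :* b :+ (c :* d :+ con 0ℤ) := (a :* b :+ con 0ℤ) :+ c :* d)
    R.refl (f 0) (g 1) (f 1) (g 0)
  *-suc′ f g (suc n) = R.trans (R.+-congˡ (*-suc′ (tail f) g n)) (R.sym (R.+-assoc _ _ _))

  *-comm : ∀ f g → f * g ≈ g * f
  *-comm f g zero    = R.+-congʳ (R.*-comm (f 0) (g 0))
  *-comm f g (suc n) = begin
    f 0 R.* g (suc n) R.+ (tail f * g) n  ≈⟨ R.+-cong (R.*-comm _ _) (*-comm (tail f) g n) ⟩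
    g (suc n) R.* f 0 R.+ (g * tail f) n  ≈⟨ R.+-comm _ _ ⟩
    (g * tail f) n R.+ g (suc n) R.* f 0  ≈⟨ *-suc′ g f n ⟨
    (g * f) (suc n)                       ∎

  scale-* : ∀ r f g n → ((λ k → r R.* f k) * g) n R.≈ r R.* (f * g) n
  scale-* r f g zero    = solve 3 (λ r a b → (r :* a) :* b :+ con 0ℤ := r :* (a :* b :+ con 0ℤ))
    R.refl r (f 0) (g 0)
  scale-* r f g (suc n) = begin
    r R.* f 0 R.* g (suc n) R.+ ((λ k → r R.* tail f k) * g) n
      ≈⟨ R.+-congˡ (scale-* r (tail f) g n) ⟩
    r R.* f 0 R.* g (suc n) R.+ r R.* (tail f * g) n
      ≈⟨ solve 4 (λ r a b c → r :* a :* b :+ r :* c := r :* (a :* b :+ c))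
           R.refl r (f 0) (g (suc n)) ((tail f * g) n) ⟩
    r R.* (f 0 R.* g (suc n) R.+ (tail f * g) n) ∎

  -- By unfolding, the tail of `f * g` is `f 0` times `tail g` plus `tail f * g`, so the induction
  -- can pass to `tail f`.
  *-assoc : ∀ f g h → (f * g) * h ≈ f * (g * h)
  *-assoc f g h zero    = solve 3 (λ a b c → (a :* b :+ con 0ℤ) :* c :+ con 0ℤ := a :* (b :* c :+ con 0ℤ) :+ con 0ℤ)
    R.refl (f 0) (g 0) (h 0)
  *-assoc f g h (suc n) = begin
    (f * g) 0 R.* h (suc n) R.+ ((λ k → f 0 R.* tail g k R.+ (tail f * g) k) * h) n
      ≈⟨ R.+-congˡ (distribʳ h (λ k → f 0 R.* tail g k) (tail f * g) n) ⟩
    (f * g) 0 R.* h (suc n) R.+ (((λ k → f 0 R.* tail g k) * h) n R.+ ((tail f * g) * h) n)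
      ≈⟨ R.+-congˡ (R.+-cong (scale-* (f 0) (tail g) h n) (*-assoc (tail f) g h n)) ⟩
    (f 0 R.* g 0 R.+ R.0#) R.* h (suc n) R.+ (f 0 R.* (tail g * h) n R.+ (tail f * (g * h)) n)
      ≈⟨ solve 5 (λ a b c d e → (a :* b :+ con 0ℤ) :* c :+ (a :* d :+ e) := a :* (b :* c :+ d) :+ e)
           R.refl (f 0) (g 0) (h (suc n)) ((tail g * h) n) ((tail f * (g * h)) n) ⟩
    f 0 R.* (g 0 R.* h (suc n) R.+ (tail g * h) n) R.+ (tail f * (g * h)) n ∎

  const-0 : ∀ n → 0# n R.≈ R.0#
  const-0 zero    = R.refl
  const-0 (suc n) = R.refl

  commutativeRing : CommutativeRing c ℓ
  commutativeRing = record
    { Carrier = Series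
    ; _≈_ = _≈_
    ; _+_ = _+_
    ; _*_ = _*_
    ; -_  = -_
    ; 0#  = 0#
    ; 1#  = 1#
    ; isCommutativeRing = record
      { isRing = record
        { +-isAbelianGroup = record
          { isGroup = record
            { isMonoid = record
              { isSemigroup = record
                { isMagma = record
                  { isEquivalence = record
                    { refl  = λ _ → R.refl
                    ; sym   = λ f≈g n → R.sym (f≈g n)
                    ; trans = λ f≈g g≈h n → R.trans (f≈g n) (g≈h n)
                    }
                  ; ∙-cong = λ f≈ g≈ n → R.+-cong (f≈ n) (g≈ n)
                  }
                ; assoc = λ f g h n → R.+-assoc (f n) (g n) (h n)
                }
              ; identity = (λ f n → R.trans (R.+-congʳ (const-0 n)) (R.+-identityˡ (f n)))
                         , (λ f n → R.trans (R.+-congˡ (const-0 n)) (R.+-identityʳ (f n)))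
              }
            ; inverse = (λ f n → R.trans (R.-‿inverseˡ (f n)) (R.sym (const-0 n)))
                      , (λ f n → R.trans (R.-‿inverseʳ (f n)) (R.sym (const-0 n)))
            ; ⁻¹-cong = λ f≈ n → R.-‿cong (f≈ n)
            }
          ; comm = λ f g n → R.+-comm (f n) (g n)
          }
        ; *-cong     = *-cong
        ; *-assoc    = *-assoc
        ; *-identity = *-identityˡ , (λ f n → R.trans (*-comm f 1# n) (*-identityˡ f n))
        ; distrib    = (λ h f g n → R.trans (*-comm h (f + g) n)
                          (R.trans (distribʳ h f g n) (R.+-cong (*-comm f h n) (*-comm g h n))))
                     , distribʳ
        }
      ; *-comm = *-comm
      }
    }
    where
    *-identityˡ : ∀ f → 1# * f ≈ f
    *-identityˡ f n = R.trans (const-* R.1# f n) (R.*-identityˡ (f n))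

  private module S = CommutativeRing commutativeRing

  var : Series
  var = shift 1 (const R.1#)

  var-*-zero : ∀ f → (var * f) 0 R.≈ R.0#
  var-*-zero f = R.trans (R.+-identityʳ _) (R.zeroˡ (f 0))

  var-*-suc : ∀ f n → (var * f) (suc n) R.≈ f n
  var-*-suc f n = begin
    R.0# R.* f (suc n) R.+ (1# * f) n  ≈⟨ R.+-cong (R.zeroˡ _) (S.*-identityˡ f n) ⟩
    R.0# R.+ f n                       ≈⟨ R.+-identityˡ (f n) ⟩
    f n                                ∎

  var-regular : Regular commutativeRing var
  var-regular {f} eq n = R.trans (R.sym (var-*-suc f n)) (R.trans (eq (suc n)) (R.sym (const-0 n)))

  -- If `g * f` vanishes, the lowest coefficient gives `f 0 = 0`; then `g * tail f` vanishes too,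
  -- and the argument repeats.
  regular : ∀ {g} → Regular R (g 0) → Regular commutativeRing g
  regular {g} reg {f} eq n = R.trans (vanishes (suc n) eq′ ℕ.≤-refl) (R.sym (const-0 n))
    where
    eq′ : ∀ k → (g * f) k R.≈ R.0#
    eq′ k = R.trans (eq k) (const-0 k)
    vanishes : ∀ m {f} → (∀ k → (g * f) k R.≈ R.0#) → ∀ {n} → n ℕ.< m → f n R.≈ R.0#
    vanishes (suc m) {f} gf≈0 {zero}  _ = reg (R.trans (R.sym (R.+-identityʳ _)) (gf≈0 0))
    vanishes (suc m) {f} gf≈0 {suc n} (ℕ.s≤s n<m) = vanishes m g*tail≈0 n<m
      where
      f₀≈0 = vanishes (suc m) gf≈0 {zero} (ℕ.s≤s ℕ.z≤n)
      g*tail≈0 : ∀ k → (g * tail f) k R.≈ R.0#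
      g*tail≈0 k = begin
        (g * tail f) k                         ≈⟨ R.+-identityʳ _ ⟨
        (g * tail f) k R.+ R.0#                ≈⟨ R.+-congˡ (R.zeroʳ (g (suc k))) ⟨
        (g * tail f) k R.+ g (suc k) R.* R.0#  ≈⟨ R.+-congˡ (R.*-congˡ f₀≈0) ⟨
        (g * tail f) k R.+ g (suc k) R.* f 0   ≈⟨ *-suc′ g f k ⟨
        (g * f) (suc k)                        ≈⟨ gf≈0 (suc k) ⟩
        R.0#                                   ∎

  -- h / (1 - var u): if h = h₀ + var h′, the quotient is h₀ + var (h′ + h₀ u) / (1 - var u).
  quotient : Series → Series → Series
  quotient u h zero    = h 0
  quotient u h (suc n) = quotient u (λ k → h (suc k) R.+ h 0 R.* u k) n

  quotient-unfold : ∀ u h → quotient u h ≈ h + var * (u * quotient u h)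
  quotient-unfold u h zero    =
    R.sym (R.trans (R.+-congˡ (var-*-zero (u * quotient u h))) (R.+-identityʳ (h 0)))
  quotient-unfold u h (suc n) = begin
    quotient u h′ n                                                     ≈⟨ quotient-unfold u h′ n ⟩
    (h (suc n) R.+ h 0 R.* u n) R.+ (var * (u * quotient u h′)) n       ≈⟨ R.+-assoc _ _ _ ⟩
    h (suc n) R.+ (h 0 R.* u n R.+ (var * (u * quotient u h′)) n)       ≈⟨ R.+-congˡ (step n) ⟩
    h (suc n) R.+ (u * quotient u h) n                                  ≈⟨ R.+-congˡ (var-*-suc (u * quotient u h) n) ⟨
    h (suc n) R.+ (var * (u * quotient u h)) (suc n)                    ∎
    where
    h′ : Series
    h′ k = h (suc k) R.+ h 0 R.* u k
    -- This is the equation q = h₀ + var q′ multiplied by `u`, for q = `quotient u h` and q′ =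
    -- `quotient u h′`.
    step : ∀ k → h 0 R.* u k R.+ (var * (u * quotient u h′)) k R.≈ (u * quotient u h) k
    step zero = begin
      h 0 R.* u 0 R.+ (var * (u * quotient u h′)) 0  ≈⟨ R.+-cong (R.*-comm _ _) (var-*-zero (u * quotient u h′)) ⟩
      u 0 R.* h 0 R.+ R.0#                           ∎
    step (suc k) = begin
      h 0 R.* u (suc k) R.+ (var * (u * quotient u h′)) (suc k)  ≈⟨ R.+-cong (R.*-comm _ _) (var-*-suc (u * quotient u h′) k) ⟩
      u (suc k) R.* h 0 R.+ (u * quotient u h′) k                ≈⟨ R.+-comm _ _ ⟩
      (u * quotient u h′) k R.+ u (suc k) R.* h 0                ≈⟨ *-suc′ u (quotient u h) k ⟨
      (u * quotient u h) (suc k)                                 ∎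

-- Laurent polynomials as a commutative ring

module LaurentPolynomialRing (R : CommutativeRing c ℓ) where
  open CommutativeRing R
    using (Carrier; setoid; refl; sym; trans; +-cong; +-congˡ; +-congʳ; +-identityˡ; +-identityʳ;
           +-assoc; +-comm; *-congˡ; *-congʳ; *-comm; *-identityʳ; *-identityˡ; zeroˡ; zeroʳ; -‿inverseˡ; -‿cong)
    renaming (_≈_ to _≈R_; _+_ to _+R_; _*_ to _*R_; -_ to -R_; 0# to 0R; 1# to 1R)
  open LaurentPolynomial (CommutativeRing.rawRing R) public using (Polynomial; coeff; monomial)
  open RingOps (LaurentPolynomial.ring (CommutativeRing.rawRing R)) public
    using (_≈_; _+_; _*_; -_; 0#; 1#)
  open IntegerCoefficients R
  open SetoidReasoning setoid

  -- The linear extension of φ : xᵉ ↦ φ e to Laurent polynomials.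
  eval : (ℤ → Carrier) → Polynomial → Carrier
  eval φ []            = 0R
  eval φ ((e , r) ∷ p) = r *R φ e +R eval φ p

  -- `eval (δ k)` extracts the coefficient of xᵏ. Equal polynomials can be different lists, so the
  -- laws of multiplication are checked through this linear functional.
  δ : ℤ → ℤ → Carrier
  δ k e = if does (e ℤ.≟ k) then 1R else 0R

  coeff-eval : ∀ k p → coeff k p ≈R eval (δ k) p
  coeff-eval k [] = refl
  coeff-eval k ((e , r) ∷ p) with e ℤ.≟ k
  ... | yes _ = +-cong (sym (*-identityʳ r)) (coeff-eval k p)
  ... | no _  = trans (coeff-eval k p) (sym (trans (+-congʳ (zeroʳ r)) (+-identityˡ _)))

  eval-cong : ∀ {φ ψ} p → (∀ e → φ e ≈R ψ e) → eval φ p ≈R eval ψ p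
  eval-cong []            eq = refl
  eval-cong ((e , r) ∷ p) eq = +-cong (*-congˡ (eq e)) (eval-cong p eq)

  eval-++ : ∀ φ p q → eval φ (p ++ q) ≈R eval φ p +R eval φ q
  eval-++ φ [] q            = sym (+-identityˡ _)
  eval-++ φ ((e , r) ∷ p) q = trans (+-congˡ (eval-++ φ p q)) (sym (+-assoc _ _ _))

  eval-+ : ∀ φ ψ p → eval (λ e → φ e +R ψ e) p ≈R eval φ p +R eval ψ p
  eval-+ φ ψ []            = sym (+-identityˡ _)
  eval-+ φ ψ ((e , r) ∷ p) = trans (+-congˡ (eval-+ φ ψ p))
    (solve 5 (λ r a b c d → r :* (a :+ b) :+ (c :+ d) := (r :* a :+ c) :+ (r :* b :+ d))
      refl r (φ e) (ψ e) (eval φ p) (eval ψ p))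

  eval-scale : ∀ s φ p → eval (λ e → s *R φ e) p ≈R s *R eval φ p
  eval-scale s φ []            = sym (zeroʳ s)
  eval-scale s φ ((e , r) ∷ p) = trans (+-congˡ (eval-scale s φ p))
    (solve 4 (λ s r a c → r :* (s :* a) :+ s :* c := s :* (r :* a :+ c)) refl s r (φ e) (eval φ p))

  eval-zero : ∀ p → eval (λ _ → 0R) p ≈R 0R
  eval-zero []            = refl
  eval-zero ((e , r) ∷ p) = trans (+-cong (zeroʳ r) (eval-zero p)) (+-identityˡ _)

  -- Interchange of two finite sums, from which the commutativity of the product follows.
  eval-swap : ∀ (φ : ℤ → ℤ → Carrier) p q →
    eval (λ e → eval (φ e) q) p ≈R eval (λ f → eval (λ e → φ e f) p) q
  eval-swap φ [] q            = sym (eval-zero q)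
  eval-swap φ ((e , r) ∷ p) q = begin
    r *R eval (φ e) q +R eval (λ e → eval (φ e) q) p
      ≈⟨ +-cong (sym (eval-scale r (φ e) q)) (eval-swap φ p q) ⟩
    eval (λ f → r *R φ e f) q +R eval (λ f → eval (λ e → φ e f) p) q
      ≈⟨ eval-+ _ _ q ⟨
    eval (λ f → r *R φ e f +R eval (λ e → φ e f) p) q ∎

  eval-* : ∀ φ p q → eval φ (p * q) ≈R eval (λ e → eval (λ f → φ (e ℤ.+ f)) q) p
  eval-* φ [] q            = refl
  eval-* φ ((e , r) ∷ p) q =
    trans (eval-++ φ (map (λ (f , s) → e ℤ.+ f , r *R s) q) (p * q)) (+-cong (eval-term q) (eval-* φ p q))
    where
    eval-term : ∀ q → eval φ (map (λ (f , s) → e ℤ.+ f , r *R s) q) ≈R r *R eval (λ f → φ (e ℤ.+ f)) q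
    eval-term []            = sym (zeroʳ r)
    eval-term ((f , s) ∷ q) = trans (+-congˡ (eval-term q))
      (solve 4 (λ r s a c → r :* s :* a :+ r :* c := r :* (s :* a :+ c))
        refl r s (φ (e ℤ.+ f)) (eval (λ f → φ (e ℤ.+ f)) q))

  -- Moves the exponent of the left factor into the index, so that the inner sum of a product
  -- becomes a coefficient of the right factor.
  δ-+ : ∀ k e f → δ k (e ℤ.+ f) ≡ δ (k ℤ.- e) f
  δ-+ k e f with e ℤ.+ f ℤ.≟ k | f ℤ.≟ k ℤ.- e
  ... | yes _     | yes _  = ≡.refl
  ... | no _      | no _   = ≡.refl
  ... | yes ≡.refl | no f≢ = contradiction
    (≡.sym (≡.trans (≡.cong (λ g → g ℤ.+ ℤ.- e) (ℤ.+-comm e f)) (≡.trans (ℤ.+-assoc f e (ℤ.- e))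
      (≡.trans (≡.cong (λ g → f ℤ.+ g) (ℤ.+-inverseʳ e)) (ℤ.+-identityʳ f))))) f≢
  ... | no e+f≢k  | yes ≡.refl = contradiction
    (≡.trans (ℤ.+-comm e (k ℤ.- e)) (≡.trans (ℤ.+-assoc k (ℤ.- e) e)
      (≡.trans (≡.cong (λ g → k ℤ.+ g) (ℤ.+-inverseˡ e)) (ℤ.+-identityʳ k)))) e+f≢k

  coeff-* : ∀ k p q → coeff k (p * q) ≈R eval (λ e → coeff (k ℤ.- e) q) p
  coeff-* k p q = begin
    coeff k (p * q)                              ≈⟨ coeff-eval k (p * q) ⟩
    eval (δ k) (p * q)                           ≈⟨ eval-* (δ k) p q ⟩
    eval (λ e → eval (λ f → δ k (e ℤ.+ f)) q) p
      ≈⟨ eval-cong p (λ e → eval-cong q (λ f → CommutativeRing.reflexive R (δ-+ k e f))) ⟩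
    eval (λ e → eval (δ (k ℤ.- e)) q) p          ≈⟨ eval-cong p (λ e → coeff-eval (k ℤ.- e) q) ⟨
    eval (λ e → coeff (k ℤ.- e) q) p             ∎

  coeff-+ : ∀ k p q → coeff k (p + q) ≈R coeff k p +R coeff k q
  coeff-+ k p q = begin
    coeff k (p + q)                      ≈⟨ coeff-eval k (p ++ q) ⟩
    eval (δ k) (p ++ q)                  ≈⟨ eval-++ (δ k) p q ⟩
    eval (δ k) p +R eval (δ k) q         ≈⟨ +-cong (coeff-eval k p) (coeff-eval k q) ⟨
    coeff k p +R coeff k q               ∎

  coeff-neg : ∀ k p → coeff k (- p) ≈R -R coeff k p
  coeff-neg k []            = solve 0 (con 0ℤ := :- con 0ℤ) refl
  coeff-neg k ((e , r) ∷ p) with e ℤ.≟ k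
  ... | yes _ = trans (+-congˡ (coeff-neg k p)) (solve 2 (λ r s → :- r :- s := :- (r :+ s)) refl r (coeff k p))
  ... | no _  = coeff-neg k p

  -- Commutativity comes before congruence: coeff-* gives congruence in the right factor only, equal
  -- polynomials being represented by different lists.
  *-comm′ : ∀ p q → p * q ≈ q * p
  *-comm′ p q k = begin
    coeff k (p * q)                                 ≈⟨ coeff-eval k (p * q) ⟩
    eval (δ k) (p * q)                              ≈⟨ eval-* (δ k) p q ⟩
    eval (λ e → eval (λ f → δ k (e ℤ.+ f)) q) p     ≈⟨ eval-swap _ p q ⟩
    eval (λ f → eval (λ e → δ k (e ℤ.+ f)) p) q
      ≈⟨ eval-cong q (λ f → eval-cong p (λ e → CommutativeRing.reflexive R (≡.cong (δ k) (ℤ.+-comm e f)))) ⟩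
    eval (λ f → eval (λ e → δ k (f ℤ.+ e)) p) q     ≈⟨ eval-* (δ k) q p ⟨
    eval (δ k) (q * p)                              ≈⟨ coeff-eval k (q * p) ⟨
    coeff k (q * p)                                 ∎

  *-congʳ′ : ∀ p {q q′} → q ≈ q′ → p * q ≈ p * q′
  *-congʳ′ p {q} {q′} q≈q′ k = trans (coeff-* k p q)
    (trans (eval-cong p (λ e → q≈q′ (k ℤ.- e))) (sym (coeff-* k p q′)))

  *-cong′ : ∀ {p p′ q q′} → p ≈ p′ → q ≈ q′ → p * q ≈ p′ * q′
  *-cong′ {p} {p′} {q} {q′} p≈ q≈ k = begin
    coeff k (p * q)    ≈⟨ *-congʳ′ p {q} {q′} q≈ k ⟩
    coeff k (p * q′)   ≈⟨ *-comm′ p q′ k ⟩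
    coeff k (q′ * p)   ≈⟨ *-congʳ′ q′ {p} {p′} p≈ k ⟩
    coeff k (q′ * p′)  ≈⟨ *-comm′ q′ p′ k ⟩
    coeff k (p′ * q′)  ∎

  *-assoc′ : ∀ p q m → (p * q) * m ≈ p * (q * m)
  *-assoc′ p q m k = begin
    coeff k ((p * q) * m)     ≈⟨ coeff-eval k ((p * q) * m) ⟩
    eval (δ k) ((p * q) * m)  ≈⟨ eval-* (δ k) (p * q) m ⟩
    eval (λ e → eval (λ f → δ k (e ℤ.+ f)) m) (p * q)
      ≈⟨ eval-* _ p q ⟩
    eval (λ e → eval (λ f → eval (λ g → δ k (e ℤ.+ f ℤ.+ g)) m) q) p
      ≈⟨ eval-cong p (λ e → eval-cong q (λ f → eval-cong m (λ g →
           CommutativeRing.reflexive R (≡.cong (δ k) (ℤ.+-assoc e f g))))) ⟩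
    eval (λ e → eval (λ f → eval (λ g → δ k (e ℤ.+ (f ℤ.+ g))) m) q) p
      ≈⟨ eval-cong p (λ e → eval-* (λ f → δ k (e ℤ.+ f)) q m) ⟨
    eval (λ e → eval (λ f → δ k (e ℤ.+ f)) (q * m)) p
      ≈⟨ eval-* (δ k) p (q * m) ⟨
    eval (δ k) (p * (q * m))  ≈⟨ coeff-eval k (p * (q * m)) ⟨
    coeff k (p * (q * m))     ∎

  coeff-monomial-* : ∀ k e r p → coeff k (monomial e r * p) ≈R r *R coeff (k ℤ.- e) p
  coeff-monomial-* k e r p = trans (coeff-* k (monomial e r) p) (+-identityʳ _)

  *-identityˡ′ : ∀ p → 1# * p ≈ p
  *-identityˡ′ p k = begin
    coeff k (1# * p)            ≈⟨ coeff-monomial-* k 0ℤ 1R p ⟩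
    1R *R coeff (k ℤ.+ 0ℤ) p    ≈⟨ *-identityˡ _ ⟩
    coeff (k ℤ.+ 0ℤ) p          ≡⟨ ≡.cong (λ k → coeff k p) (ℤ.+-identityʳ k) ⟩
    coeff k p                   ∎

  distribʳ′ : ∀ m p q → (p + q) * m ≈ p * m + q * m
  distribʳ′ m p q k = begin
    coeff k ((p + q) * m)      ≈⟨ coeff-* k (p + q) m ⟩
    eval (λ e → coeff (k ℤ.- e) m) (p ++ q)  ≈⟨ eval-++ _ p q ⟩
    eval (λ e → coeff (k ℤ.- e) m) p +R eval (λ e → coeff (k ℤ.- e) m) q
      ≈⟨ +-cong (coeff-* k p m) (coeff-* k q m) ⟨
    coeff k (p * m) +R coeff k (q * m) ≈⟨ coeff-+ k (p * m) (q * m) ⟨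
    coeff k (p * m + q * m) ∎

  commutativeRing : CommutativeRing c ℓ
  commutativeRing = record
    { Carrier = Polynomial
    ; _≈_ = _≈_
    ; _+_ = _+_
    ; _*_ = _*_
    ; -_  = -_
    ; 0#  = 0#
    ; 1#  = 1#
    ; isCommutativeRing = record
      { isRing = record
        { +-isAbelianGroup = record
          { isGroup = record
            { isMonoid = record
              { isSemigroup = record
                { isMagma = record
                  { isEquivalence = record
                    { refl  = λ {p} k → refl {coeff k p}
                    ; sym   = λ p≈q k → sym (p≈q k)
                    ; trans = λ p≈q q≈m k → trans (p≈q k) (q≈m k)
                    }
                  ; ∙-cong = λ {p} {p′} {q} {q′} p≈ q≈ → +-cong′ {p} {p′} {q} {q′} p≈ q≈
                  }
                ; assoc = +-assoc′
                }
              ; identity = (λ p k → refl) , (λ p k → trans (coeff-+ k p []) (+-identityʳ _))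
              }
            ; inverse = inverseˡ , (λ p k → trans (+-comm′ p (- p) k) (inverseˡ p k))
            ; ⁻¹-cong = λ {p} {q} p≈q k → trans (coeff-neg k p) (trans (-‿cong (p≈q k)) (sym (coeff-neg k q)))
            }
          ; comm = +-comm′
          }
        ; *-cong     = λ {p} {p′} {q} {q′} → *-cong′ {p} {p′} {q} {q′}
        ; *-assoc    = *-assoc′
        ; *-identity = *-identityˡ′ , (λ p k → trans (*-comm′ p 1# k) (*-identityˡ′ p k))
        ; distrib    = distribˡ′ , distribʳ′
        }
      ; *-comm = *-comm′
      }
    }
    where
    +-cong′ : ∀ {p p′ q q′} → p ≈ p′ → q ≈ q′ → p + q ≈ p′ + q′
    +-cong′ {p} {p′} {q} {q′} p≈ q≈ k =
      trans (coeff-+ k p q) (trans (+-cong (p≈ k) (q≈ k)) (sym (coeff-+ k p′ q′)))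
    +-comm′ : ∀ p q → p + q ≈ q + p
    +-comm′ p q k = trans (coeff-+ k p q) (trans (+-comm _ _) (sym (coeff-+ k q p)))
    inverseˡ : ∀ p → - p + p ≈ 0#
    inverseˡ p k = trans (coeff-+ k (- p) p) (trans (+-congʳ (coeff-neg k p)) (-‿inverseˡ _))
    +-assoc′ : ∀ p q m → (p + q) + m ≈ p + (q + m)
    +-assoc′ p q m k = begin
      coeff k ((p + q) + m)                     ≈⟨ coeff-+ k (p + q) m ⟩
      coeff k (p + q) +R coeff k m              ≈⟨ +-congʳ (coeff-+ k p q) ⟩
      (coeff k p +R coeff k q) +R coeff k m     ≈⟨ +-assoc _ _ _ ⟩
      coeff k p +R (coeff k q +R coeff k m)     ≈⟨ +-congˡ (coeff-+ k q m) ⟨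
      coeff k p +R coeff k (q + m)              ≈⟨ coeff-+ k p (q + m) ⟨
      coeff k (p + (q + m))                     ∎
    distribˡ′ : ∀ m p q → m * (p + q) ≈ m * p + m * q
    distribˡ′ m p q k = begin
      coeff k (m * (p + q))                ≈⟨ *-comm′ m (p + q) k ⟩
      coeff k ((p + q) * m)                ≈⟨ distribʳ′ m p q k ⟩
      coeff k (p * m + q * m)              ≈⟨ +-cong′ {p * m} {m * p} {q * m} {m * q} (*-comm′ p m) (*-comm′ q m) k ⟩
      coeff k (m * p + m * q)              ∎

-- The algebraic identities behind the theorem

module KrewerasAlgebra (R : CommutativeRing c ℓ) where
  open CommutativeRing R
  open IntegerCoefficients R
  open RingLemmas R
  open SetoidReasoning setoid
  open RingOps rawRing using (_^_)
  open SemiringExp semiring using (^-congˡ; ^-homo-*; ^-assocʳ)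
  open CommutativeSemiringExp commutativeSemiring using (^-distrib-*)

  2# 4# 8# : Carrier
  2# = fromℤ (+ 2)
  4# = fromℤ (+ 4)
  8# = fromℤ (+ 8)

  -- For p = Q(x,0;t) and p₀ = Q(0,0;t) this is p = 1 + t² x p² + 2 t (p - p₀) / x.
  Catalytic : (t x p p₀ : Carrier) → Set ℓ
  Catalytic t x p p₀ = x * p + (t * p₀ + t * p₀) ≈ x + t * (t * (x * (x * (p * p)))) + (t * p + t * p)

  -- Here `h` is 1/2, `g` is 2 + W³, `c` is the Catalan series of x W² / 4 and `d₀` is the value of
  -- `d` at x = 0. In p and p₀ the variable t always meets a factor `g`, so W = t g removes it. What
  -- is left is a polynomial in x, W, g and c that is a combination of the equations of `c` and `g`.
  catalytic : ∀ {t x W g h c d d₀} →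
    2# * h ≈ 1# → W ≈ t * g → g ≈ 2# + W * (W * W) → c ≈ 1# + x * d →
    4# * d ≈ W * W * (c * c) → 4# * d₀ ≈ W * W →
    Catalytic t x (h * (g * (c - W * d))) (h * (g * (1# - W * d₀)))
  catalytic {t} {x} {W} {g} {h} {c} {d} {d₀} 2h≈1 W≈ g≈ c≈ d≈ d₀≈ = x-y≈0⇒x≈y (begin
    lhs - rhs
      ≈⟨ solve 8 (λ t x W g h c d d₀ →
           let p = h :* (g :* (c :- W :* d)); p₀ = h :* (g :* (con 1ℤ :- W :* d₀))
               L = x :* p :+ (t :* p₀ :+ t :* p₀)
               R′ = x :+ t :* (t :* (x :* (x :* (p :* p)))) :+ (t :* p :+ t :* p)
               q = g :* (c :- W :* d); q₀ = g :* (con 1ℤ :- W :* d₀)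
               M = con (+ 2) :* x :* q :+ con (+ 4) :* (t :* q₀) :- con (+ 4) :* x
                   :- t :* t :* x :* x :* q :* q :- con (+ 4) :* (t :* q)
           in L :- R′ := h :* h :* M
                :+ (x :- h :* (x :* q :+ t :* q₀ :+ t :* q₀ :- t :* q :- t :* q) :+ con (+ 2) :* x :* h)
                     :* (con (+ 2) :* h :- con 1ℤ))
           refl t x W g h c d d₀ ⟩
    h * h * M + _ * (2# * h - 1#)  ≈⟨ +-vanishing (h * h * M) _ 2h≈1 ⟩
    h * h * M                      ≈⟨ *-congˡ M≈0 ⟩
    h * h * 0#                     ≈⟨ zeroʳ _ ⟩
    0#                             ∎)
    where
    p p₀ q q₀ lhs rhs M xq : Carrier
    p   = h * (g * (c - W * d))
    p₀  = h * (g * (1# - W * d₀))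
    q   = g * (c - W * d)
    q₀  = g * (1# - W * d₀)
    lhs = x * p + (t * p₀ + t * p₀)
    rhs = x + t * (t * (x * (x * (p * p)))) + (t * p + t * p)
    -- Four times the difference of the two sides, written in q = 2 p and q₀ = 2 p₀, so that the
    -- halves disappear.
    M   = 2# * x * q + 4# * (t * q₀) - 4# * x - t * t * x * x * q * q - 4# * (t * q)
    xq  = x * c - W * (c - 1#)

    4tq₀ : 4# * (t * q₀) ≈ 4# * W - W * W * (W * W)
    4tq₀ = begin
      4# * (t * q₀)
        ≈⟨ solve 4 (λ t g W d → con (+ 4) :* (t :* (g :* (con 1ℤ :- W :* d)))
             := t :* g :* (con (+ 4) :- W :* (con (+ 4) :* d))) refl t g W d₀ ⟩
      t * g * (4# - W * (4# * d₀))  ≈⟨ *-cong W≈ (+-congˡ (-‿cong (*-congˡ (sym d₀≈)))) ⟨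
      W * (4# - W * (W * W))
        ≈⟨ solve 1 (λ W → W :* (con (+ 4) :- W :* (W :* W)) := con (+ 4) :* W :- W :* W :* (W :* W)) refl W ⟩
      4# * W - W * W * (W * W) ∎

    4tq : 4# * (t * q) ≈ 4# * W * c - W * W * (W * W) * (c * c)
    4tq = begin
      4# * (t * q)
        ≈⟨ solve 5 (λ t g W c d → con (+ 4) :* (t :* (g :* (c :- W :* d)))
             := t :* g :* (con (+ 4) :* c :- W :* (con (+ 4) :* d))) refl t g W c d ⟩
      t * g * (4# * c - W * (4# * d))  ≈⟨ *-cong W≈ (+-congˡ (-‿cong (*-congˡ (sym d≈)))) ⟨
      W * (4# * c - W * (W * W * (c * c)))
        ≈⟨ solve 2 (λ W c → W :* (con (+ 4) :* c :- W :* (W :* W :* (c :* c)))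
             := con (+ 4) :* W :* c :- W :* W :* (W :* W) :* (c :* c)) refl W c ⟩
      4# * W * c - W * W * (W * W) * (c * c) ∎

    x*q : x * q ≈ g * xq
    x*q = begin
      x * q  ≈⟨ solve 5 (λ x g c W d → x :* (g :* (c :- W :* d))
                  := g :* (x :* c :- W :* (c :- con 1ℤ)) :+ g :* W :* (c :- (con 1ℤ :+ x :* d)))
                  refl x g c W d ⟩
      g * xq + g * W * (c - (1# + x * d))  ≈⟨ +-vanishing (g * xq) (g * W) c≈ ⟩
      g * xq                               ∎

    txq : t * t * x * x * q * q ≈ W * xq * (W * xq)
    txq = begin
      t * t * x * x * q * q        ≈⟨ solve 3 (λ t x q → t :* t :* x :* x :* q :* q := t :* (x :* q) :* (t :* (x :* q))) refl t x q ⟩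
      t * (x * q) * (t * (x * q))  ≈⟨ *-cong t*xq t*xq ⟩
      W * xq * (W * xq)            ∎
      where
      t*xq : t * (x * q) ≈ W * xq
      t*xq = trans (*-congˡ x*q) (trans (sym (*-assoc t g xq)) (*-congʳ (sym W≈)))

    xc² : x * (W * W * (c * c)) ≈ 4# * (c - 1#)
    xc² = begin
      x * (W * W * (c * c))  ≈⟨ *-congˡ d≈ ⟨
      x * (4# * d)           ≈⟨ solve 3 (λ x c d → x :* (con (+ 4) :* d)
                                  := con (+ 4) :* (c :- con 1ℤ) :+ :- con (+ 4) :* (c :- (con 1ℤ :+ x :* d))) refl x c d ⟩
      4# * (c - 1#) + - 4# * (c - (1# + x * d)) ≈⟨ +-vanishing _ _ c≈ ⟩
      4# * (c - 1#)          ∎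

    M≈0 : M ≈ 0#
    M≈0 = begin
      M ≈⟨ +-cong (+-cong (+-congʳ (+-cong (trans (*-assoc 2# x q) (*-congˡ x*q)) 4tq₀)) (-‿cong txq)) (-‿cong 4tq) ⟩
      2# * (g * xq) + (4# * W - W * W * (W * W)) - 4# * x - W * xq * (W * xq)
        - (4# * W * c - W * W * (W * W) * (c * c))
        ≈⟨ solve 4 (λ x W g c → let xq = x :* c :- W :* (c :- con 1ℤ) in
             con (+ 2) :* (g :* xq) :+ (con (+ 4) :* W :- W :* W :* (W :* W)) :- con (+ 4) :* x :- W :* xq :* (W :* xq)
               :- (con (+ 4) :* W :* c :- W :* W :* (W :* W) :* (c :* c))
             := con 0ℤ :+ (con (+ 2) :* W :- x) :* (x :* (W :* W :* (c :* c)) :- con (+ 4) :* (c :- con 1ℤ))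
                  :+ con (+ 2) :* xq :* (g :- (con (+ 2) :+ W :* (W :* W)))) refl x W g c ⟩
      0# + (2# * W - x) * (x * (W * W * (c * c)) - 4# * (c - 1#)) + 2# * xq * (g - (2# + W * (W * W)))
        ≈⟨ +-vanishing _ _ g≈ ⟩
      0# + (2# * W - x) * (x * (W * W * (c * c)) - 4# * (c - 1#))  ≈⟨ +-vanishing _ _ xc² ⟩
      0#  ∎

  -- V = H / (1 - t x y H) solves the functional equation of Q(x,y;t).
  kernel-equation : ∀ {t x y p q p₀ H V} →
    Catalytic t x p p₀ → Catalytic t y q p₀ → x * H + y * q ≈ y * H + x * p →
    V ≈ H + y * (t * (x * H) * V) →
    Regular R (x - y) → Regular R (1# - y * (t * (x * H))) →
    x * (y * V) + (t * (x * p) + t * (y * q)) ≈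
      x * y + t * (x * V + (y * V + x * (y * (x * (y * V)))))
  kernel-equation {t} {x} {y} {p} {q} {p₀} {H} {V} Ex Ey H≈ V≈ reg₁ reg₂ = x-y≈0⇒x≈y (reg₂ (begin
    -- The functional equation reads K V = N, with the kernel `K`. Multiplied by 1 - t x y H it
    -- becomes K H = N (1 - t x y H), which is the vanishing of `X`.
    (1# - y * (t * (x * H))) * (lhs - rhs)
      ≈⟨ solve 7 (λ t x y p q H V →
           let K = x :* y :- t :* (x :+ y :+ x :* x :* y :* y)
               N = x :* y :- t :* x :* p :- t :* y :* q
               u = y :* (t :* (x :* H))
           in (con 1ℤ :- u) :* (x :* (y :* V) :+ (t :* (x :* p) :+ t :* (y :* q))
                :- (x :* y :+ t :* (x :* V :+ (y :* V :+ x :* (y :* (x :* (y :* V)))))))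
              := K :* H :- N :* (con 1ℤ :- u) :+ K :* (V :- (H :+ y :* (t :* (x :* H) :* V))))
           refl t x y p q H V ⟩
    X + K * (V - (H + y * (t * (x * H) * V)))  ≈⟨ +-vanishing X K V≈ ⟩
    X                                          ≈⟨ reg₁ [x-y]X ⟩
    0#                                         ∎))
    where
    lhs rhs K N X : Carrier
    lhs = x * (y * V) + (t * (x * p) + t * (y * q))
    rhs = x * y + t * (x * V + (y * V + x * (y * (x * (y * V)))))
    K   = x * y - t * (x + y + x * x * y * y)
    N   = x * y - t * x * p - t * y * q
    X   = K * H - N * (1# - y * (t * (x * H)))
    -- Since (x - y) H = x p - y q, multiplication by x - y eliminates H. The result separates: it
    -- is x y times the equation of p at x minus the equation of q at y, and the terms with p₀,
    -- being equal, cancel.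
    [x-y]X : (x - y) * X ≈ 0#
    [x-y]X = begin
      (x - y) * X
        ≈⟨ solve 7 (λ t x y p q p₀ H →
           let K = x :* y :- t :* (x :+ y :+ x :* x :* y :* y)
               N = x :* y :- t :* x :* p :- t :* y :* q
               L = λ x p → x :* p :+ (t :* p₀ :+ t :* p₀)
               R′ = λ x p → x :+ t :* (t :* (x :* (x :* (p :* p)))) :+ (t :* p :+ t :* p)
           in (x :- y) :* (K :* H :- N :* (con 1ℤ :- y :* (t :* (x :* H))))
              := con 0ℤ :+ (K :+ N :* t :* x :* y) :* ((x :* H :+ y :* q) :- (y :* H :+ x :* p))
                 :+ x :* y :* (L x p :- R′ x p) :+ :- (x :* y) :* (L y q :- R′ y q))
           refl t x y p q p₀ H ⟩
      0# + (K + N * t * x * y) * ((x * H + y * q) - (y * H + x * p))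
         + x * y * _ + - (x * y) * _  ≈⟨ +-vanishing _ _ Ey ⟩
      0# + (K + N * t * x * y) * ((x * H + y * q) - (y * H + x * p))
         + x * y * _   ≈⟨ +-vanishing _ _ Ex ⟩
      0# + (K + N * t * x * y) * ((x * H + y * q) - (y * H + x * p)) ≈⟨ +-vanishing _ _ H≈ ⟩
      0# ∎

  -- Let A and B be the two sides. Because W = t (2 + W³), the regular factor M satisfies t M = A +
  -- B, so A² = B² gives t M (A - B) = 0. Cancelling M is the place where the sign of the root is
  -- decided.
  square-root-equation : ∀ {t x W P p₀ S} →
    W ≈ t * (2# + W * (W * W)) → 8# * (t * p₀) ≈ 4# * W - W * W * (W * W) →
    Catalytic t x P p₀ → S * S ≈ 1# - x * (W * W) →
    Regular R t → Regular R (2# * ((x - W) * S) + (2# + W * (W * W)) * (x - 2# * (t * (1# + t * (x * (x * P)))))) →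
    2# * (t * ((x - W) * S)) ≈ x * W - 2# * (t * W) - 2# * (t * (t * (x * (x * (W * P)))))
  square-root-equation {t} {x} {W} {P} {p₀} {S} W≈ p₀≈ E S² reg-t reg-M = x-y≈0⇒x≈y (reg-M (reg-t (begin
    t * (M * (A - B))
      ≈⟨ solve 5 (λ t x W P S →
           let A = con (+ 2) :* (t :* ((x :- W) :* S))
               F = x :- con (+ 2) :* (t :* (con 1ℤ :+ t :* (x :* (x :* P))))
               W′ = con (+ 2) :+ W :* (W :* W)
               B = x :* W :- con (+ 2) :* (t :* W) :- con (+ 2) :* (t :* (t :* (x :* (x :* (W :* P)))))
               M = con (+ 2) :* ((x :- W) :* S) :+ W′ :* F
           in t :* (M :* (A :- B))
              := A :* A :- B :* B :+ :- (F :* (A :- B)) :* (W :- t :* W′)) refl t x W P S ⟩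
    A * A - B * B + - (F * (A - B)) * (W - t * (2# + W * (W * W)))  ≈⟨ +-vanishing _ _ W≈ ⟩
    A * A - B * B
      -- B is linear in P and the equation of P is quadratic, so 4 t² x² W² times that equation
      -- removes P. The values of S² and t p₀ remove S and p₀, and the rest is a multiple of W - t
      -- (2 + W³).
      ≈⟨ solve 6 (λ t x W P p₀ S →
           let A = con (+ 2) :* (t :* ((x :- W) :* S))
               F = x :- con (+ 2) :* (t :* (con 1ℤ :+ t :* (x :* (x :* P))))
               W′ = con (+ 2) :+ W :* (W :* W)
               B = x :* W :- con (+ 2) :* (t :* W) :- con (+ 2) :* (t :* (t :* (x :* (x :* (W :* P)))))
           in A :* A :- B :* B
              := con 0ℤ
                 :+ (con (+ 4) :* (t :* x :* W) :- x :* x :* (W :+ t :* W′)) :* (W :- t :* W′)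
                 :+ :- (W :* W :* t :* t :* x :* x) :* (con (+ 8) :* (t :* p₀) :- (con (+ 4) :* W :- W :* W :* (W :* W)))
                 :+ con (+ 4) :* (t :* t :* x :* x :* W :* W) :* (x :* P :+ (t :* p₀ :+ t :* p₀)
                      :- (x :+ t :* (t :* (x :* (x :* (P :* P)))) :+ (t :* P :+ t :* P)))
                 :+ con (+ 4) :* (t :* t :* (x :- W) :* (x :- W)) :* (S :* S :- (con 1ℤ :- x :* (W :* W))))
           refl t x W P p₀ S ⟩
    0# + _ * _ + _ * _ + _ * _ + _ * _  ≈⟨ +-vanishing _ _ S² ⟩
    0# + _ * _ + _ * _ + _ * _          ≈⟨ +-vanishing _ _ E ⟩
    0# + _ * _ + _ * _                  ≈⟨ +-vanishing _ _ p₀≈ ⟩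
    0# + _ * _                          ≈⟨ +-vanishing _ _ W≈ ⟩
    0#                                  ∎)))
    where
    A B F M : Carrier
    A = 2# * (t * ((x - W) * S))
    B = x * W - 2# * (t * W) - 2# * (t * (t * (x * (x * (W * P)))))
    F = x - 2# * (t * (1# + t * (x * (x * P))))
    M = 2# * ((x - W) * S) + (2# + W * (W * W)) * F

  square-form : ∀ {x W S} → S * S ≈ 1# - x * W ^ 2 → S * S ≈ 1# - x * (W * W)
  square-form {x} {W} eq = trans eq (+-congˡ (-‿cong (*-congˡ (*-congˡ (*-identityʳ W)))))

  -- This is the claimed formula multiplied by tᵛ⁺². `τ` stands for tᵛ, and `W⁻¹` is only the
  -- numerator of the reciprocal, which is t⁻ᵛ times it.
  clear-denominators : ∀ {t x x⁻¹ W W⁻¹ τ h P S} →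
    2# * h ≈ 1# → x⁻¹ * x ≈ 1# → W⁻¹ * W ≈ τ →
    2# * (t * ((x - W) * S)) ≈ x * W - 2# * (t * W) - 2# * (t * (t * (x * (x * (W * P))))) →
    τ * (t * (t * P)) ≈ x⁻¹ * (τ * (h - t * x⁻¹) - t * ((W⁻¹ - τ * x⁻¹) * S))
  clear-denominators {t} {x} {z} {W} {f} {τ} {h} {P} {S} 2h≈1 zx≈1 fW≈τ eq = x-y≈0⇒x≈y (begin
    τ * (t * (t * P)) - z * (τ * (h - t * z) - t * ((f - τ * z) * S))
      ≈⟨ solve 8 (λ t z W f τ h P S →
           let T = con (+ 2) :* t :* z :* S :- con (+ 2) :* t :* z :* z :* W :* S :- z :* W
                     :+ con (+ 2) :* t :* z :* z :* W :+ con (+ 2) :* t :* t :* W :* P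
           in τ :* (t :* (t :* P)) :- z :* (τ :* (h :- t :* z) :- t :* ((f :- τ :* z) :* S))
              := h :* f :* T
                 :+ :- (t :* z :* f :* S :- t :* z :* z :* τ :* S :+ t :* z :* z :* τ :+ t :* t :* τ :* P)
                      :* (con (+ 2) :* h :- con 1ℤ)
                 :+ h :* (con (+ 2) :* t :* z :* z :* S :+ z :- con (+ 2) :* t :* z :* z :- con (+ 2) :* t :* t :* P)
                      :* (f :* W :- τ))
           refl t z W f τ h P S ⟩
    h * f * T + _ * _ + _ * _  ≈⟨ +-vanishing _ _ fW≈τ ⟩
    h * f * T + _ * _          ≈⟨ +-vanishing _ _ 2h≈1 ⟩
    h * f * T                  ≈⟨ *-congˡ T≈0 ⟩
    h * f * 0#                 ≈⟨ zeroʳ _ ⟩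
    0#                         ∎)
    where
    T : Carrier
    -- Modulo x⁻¹ x = 1 this is x⁻² times the difference of the two sides of the square-root
    -- equation.
    T = 2# * t * z * S - 2# * t * z * z * W * S - z * W + 2# * t * z * z * W + 2# * t * t * W * P
    T≈0 : T ≈ 0#
    T≈0 = begin
      T ≈⟨ solve 6 (λ t x z W P S →
             con (+ 2) :* t :* z :* S :- con (+ 2) :* t :* z :* z :* W :* S :- z :* W
               :+ con (+ 2) :* t :* z :* z :* W :+ con (+ 2) :* t :* t :* W :* P
             := con 0ℤ :+ z :* z :* (con (+ 2) :* (t :* ((x :- W) :* S))
                  :- (x :* W :- con (+ 2) :* (t :* W) :- con (+ 2) :* (t :* (t :* (x :* (x :* (W :* P)))))))
                :+ :- (con (+ 2) :* t :* z :* S :- z :* W :+ con (+ 2) :* t :* t :* W :* P :* (z :* x :+ con 1ℤ))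
                     :* (z :* x :- con 1ℤ))
             refl t x z W P S ⟩
      0# + _ * _ + _ * _  ≈⟨ +-vanishing _ _ zx≈1 ⟩
      0# + _ * _          ≈⟨ +-vanishing _ _ eq ⟩
      0#                  ∎

  -- With e = W² / 4 the hypothesis is p₀ = g (1 - W³ / 4) / 2, and t g = W.
  axis₀-value : ∀ {t W g h e p₀} → 2# * h ≈ 1# → W ≈ t * g → 4# * e ≈ W * W →
    p₀ ≈ h * (g * (1# - W * e)) → 8# * (t * p₀) ≈ 4# * W - W * W * (W * W)
  axis₀-value {t} {W} {g} {h} {e} {p₀} 2h≈1 W≈ 4e≈ p₀≈ = begin
    8# * (t * p₀)
      ≈⟨ solve 6 (λ t W g h e p₀ → con (+ 8) :* (t :* p₀) :=
           con (+ 4) :* W :- W :* W :* (W :* W)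
             :+ con (+ 8) :* t :* (p₀ :- h :* (g :* (con 1ℤ :- W :* e)))
             :+ con (+ 4) :* t :* g :* (con 1ℤ :- W :* e) :* (con (+ 2) :* h :- con 1ℤ)
             :+ :- (con (+ 4) :* (con 1ℤ :- W :* e)) :* (W :- t :* g)
             :+ :- (W :* W) :* (con (+ 4) :* e :- W :* W))
           refl t W g h e p₀ ⟩
    4# * W - W * W * (W * W) + _ * _ + _ * _ + _ * _ + _ * _  ≈⟨ +-vanishing _ _ 4e≈ ⟩
    4# * W - W * W * (W * W) + _ * _ + _ * _ + _ * _          ≈⟨ +-vanishing _ _ W≈ ⟩
    4# * W - W * W * (W * W) + _ * _ + _ * _                  ≈⟨ +-vanishing _ _ 2h≈1 ⟩
    4# * W - W * W * (W * W) + _ * _                          ≈⟨ +-vanishing _ _ p₀≈ ⟩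
    4# * W - W * W * (W * W)                                  ∎

  private
    W^[2i+1] : ∀ W i → W ^ (2 ℕ.* i ℕ.+ 1) ≈ W * (W * W) ^ i
    W^[2i+1] W i = begin
      W ^ (2 ℕ.* i ℕ.+ 1)        ≈⟨ ^-homo-* W (2 ℕ.* i) 1 ⟩
      W ^ (2 ℕ.* i) * (W * 1#)   ≈⟨ *-cong (sym (^-assocʳ W 2 i)) (*-identityʳ W) ⟩
      (W * (W * 1#)) ^ i * W     ≈⟨ *-comm _ _ ⟩
      W * (W * (W * 1#)) ^ i     ≈⟨ *-congˡ (^-congˡ i (*-congˡ (*-identityʳ W))) ⟩
      W * (W * W) ^ i            ∎

  -- The factor t is absorbed by t g = W. The factor `1#` on the right is the numerator of `t⁻¹`,
  -- kept so that the product is the one computed for the Laurent series of the theorem.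
  axis-form : ∀ {t W g h u e} i γ γ′ → W ≈ t * g → e ≈ u * (W * W) →
    t * (h * (g * (γ * e ^ i - W * (γ′ * (e * e ^ i))))) ≈
      W ^ (2 ℕ.* i ℕ.+ 1) * (h * u ^ i * 1#) * (γ - γ′ * W ^ 3 * u)
  axis-form {t} {W} {g} {h} {u} {e} i γ γ′ W≈ e≈ = begin
    t * (h * (g * (γ * e ^ i - W * (γ′ * (e * e ^ i)))))
      ≈⟨ solve 8 (λ t W g h e E γ γ′ → t :* (h :* (g :* (γ :* E :- W :* (γ′ :* (e :* E)))))
           := h :* (t :* g) :* E :* (γ :- W :* γ′ :* e)) refl t W g h e (e ^ i) γ γ′ ⟩
    h * (t * g) * e ^ i * (γ - W * γ′ * e)
      ≈⟨ *-cong (*-cong (*-congˡ (sym W≈)) (trans (^-congˡ i e≈) (^-distrib-* u (W * W) i)))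
           (+-congˡ (-‿cong (*-congˡ e≈))) ⟩
    h * W * (u ^ i * (W * W) ^ i) * (γ - W * γ′ * (u * (W * W)))
      ≈⟨ solve 7 (λ W h u U V γ γ′ → h :* W :* (U :* V) :* (γ :- W :* γ′ :* (u :* (W :* W)))
           := W :* V :* (h :* U :* con 1ℤ) :* (γ :- γ′ :* (W :* (W :* (W :* con 1ℤ))) :* u))
           refl W h u (u ^ i) ((W * W) ^ i) γ γ′ ⟩
    W * (W * W) ^ i * (h * u ^ i * 1#) * (γ - γ′ * W ^ 3 * u)
      ≈⟨ *-congʳ (*-congʳ (W^[2i+1] W i)) ⟨
    W ^ (2 ℕ.* i ℕ.+ 1) * (h * u ^ i * 1#) * (γ - γ′ * W ^ 3 * u) ∎

  axis-expansion : ∀ {W h u} i γ γ′ →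
    W ^ (2 ℕ.* i ℕ.+ 1) * (h * u ^ i * 1#) * (γ - γ′ * W ^ 3 * u) ≈
      h * u ^ i * γ * W ^ (2 ℕ.* i ℕ.+ 1) - h * u ^ i * (γ′ * u) * W ^ (2 ℕ.* i ℕ.+ 1 ℕ.+ 3)
  axis-expansion {W} {h} {u} i γ γ′ = begin
    W ^ (2 ℕ.* i ℕ.+ 1) * (h * u ^ i * 1#) * (γ - γ′ * W ^ 3 * u)
      ≈⟨ solve 7 (λ V W³ h U u γ γ′ → V :* (h :* U :* con 1ℤ) :* (γ :- γ′ :* W³ :* u)
           := h :* U :* γ :* V :- h :* U :* (γ′ :* u) :* (V :* W³))
           refl (W ^ (2 ℕ.* i ℕ.+ 1)) (W ^ 3) h (u ^ i) u γ γ′ ⟩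
    h * u ^ i * γ * W ^ (2 ℕ.* i ℕ.+ 1) - h * u ^ i * (γ′ * u) * (W ^ (2 ℕ.* i ℕ.+ 1) * W ^ 3)
      ≈⟨ +-congˡ (-‿cong (*-congˡ (^-homo-* W (2 ℕ.* i ℕ.+ 1) 3))) ⟨
    h * u ^ i * γ * W ^ (2 ℕ.* i ℕ.+ 1) - h * u ^ i * (γ′ * u) * W ^ (2 ℕ.* i ℕ.+ 1 ℕ.+ 3) ∎

  -- `F`, `G` and `q` stand for 4ⁱ, 4ⁿ and 4⁻ⁱ; `w₁` and `w₂` for the coefficients of tᵐ in W²ⁱ⁺¹
  -- and W²ⁱ⁺⁴, with m = 3n + 2i + 1; `b` and `b′` for the binomial coefficients of m and m - 1 over
  -- n. The bracket collapses to (2i + 1) γ times (n + i + 1) - n, and (i + 1) γ is the central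
  -- binomial coefficient `B`.
  axis-count : ∀ {h u q F G i n m γ γ′ B w₁ w₂ b b′ : Carrier} →
    2# * h ≈ 1# → 4# * u ≈ 1# → q * F ≈ 1# →
    (i + 1#) * γ ≈ B → (i + 2#) * γ′ ≈ (4# * i + 2#) * γ →
    m * w₁ ≈ (2# * i + 1#) * (b * (2# * (F * G))) →
    (n + i + 1#) * (m * w₂) ≈ (i + 2#) * (n * (b * (4# * (F * G)))) →
    (2# * n + 2# * i + 1#) * b ≈ m * b′ →
    m * ((n + i + 1#) * (2# * n + 2# * i + 1#) * (h * q * γ * w₁ - h * q * (γ′ * u) * w₂)) ≈
      m * (G * (2# * i + 1#) * B * b′)
  axis-count {h} {u} {q} {F} {G} {i} {n} {m} {γ} {γ′} {B} {w₁} {w₂} {b} {b′} 2h≈1 4u≈1 qF≈1 γ≈ γ′≈ w₁≈ w₂≈ b≈ = begin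
    m * (D₁ * D₂ * (h * q * γ * w₁ - h * q * (γ′ * u) * w₂))
      ≈⟨ solve 10 (λ h u q m D₁ D₂ γ γ′ w₁ w₂ →
           m :* (D₁ :* D₂ :* (h :* q :* γ :* w₁ :- h :* q :* (γ′ :* u) :* w₂))
           := D₂ :* (h :* q) :* (D₁ :* γ :* (m :* w₁) :- γ′ :* u :* (D₁ :* (m :* w₂))))
           refl h u q m D₁ D₂ γ γ′ w₁ w₂ ⟩
    D₂ * (h * q) * (D₁ * γ * (m * w₁) - γ′ * u * (D₁ * (m * w₂)))
      ≈⟨ *-congˡ (+-cong (*-congˡ w₁≈) (-‿cong (*-congˡ w₂≈))) ⟩
    D₂ * (h * q) * (D₁ * γ * (j * (b * (2# * (F * G)))) - γ′ * u * ((i + 2#) * (n * (b * (4# * (F * G))))))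
      ≈⟨ solve 13 (λ h u q F G D₁ D₂ j i n b γ γ′ →
           D₂ :* (h :* q) :* (D₁ :* γ :* (j :* (b :* (con (+ 2) :* (F :* G)))) :- γ′ :* u :* ((i :+ con (+ 2)) :* (n :* (b :* (con (+ 4) :* (F :* G))))))
           := (q :* F) :* G :* (D₂ :* b) :* (con (+ 2) :* h :* (D₁ :* γ :* j) :- h :* ((i :+ con (+ 2)) :* γ′) :* (con (+ 4) :* u) :* n))
           refl h u q F G D₁ D₂ j i n b γ γ′ ⟩
    (q * F) * G * (D₂ * b) * (2# * h * (D₁ * γ * j) - h * ((i + 2#) * γ′) * (4# * u) * n)
      ≈⟨ *-cong (*-cong (*-congʳ qF≈1) b≈) (+-cong (*-congʳ 2h≈1) (-‿cong (*-congʳ (*-cong (*-congˡ γ′≈) 4u≈1)))) ⟩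
    1# * G * (m * b′) * (1# * (D₁ * γ * j) - h * ((4# * i + 2#) * γ) * 1# * n)
      ≈⟨ solve 7 (λ h G i n m γ b′ →
           con 1ℤ :* G :* (m :* b′) :* (con 1ℤ :* ((n :+ i :+ con 1ℤ) :* γ :* (con (+ 2) :* i :+ con 1ℤ))
              :- h :* ((con (+ 4) :* i :+ con (+ 2)) :* γ) :* con 1ℤ :* n)
           := m :* (G :* (con (+ 2) :* i :+ con 1ℤ) :* ((i :+ con 1ℤ) :* γ) :* b′)
              :+ :- (m :* b′ :* G :* (con (+ 2) :* i :+ con 1ℤ) :* γ :* n) :* (con (+ 2) :* h :- con 1ℤ))
           refl h G i n m γ b′ ⟩
    m * (G * j * ((i + 1#) * γ) * b′) + _ * _  ≈⟨ +-vanishing _ _ 2h≈1 ⟩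
    m * (G * j * ((i + 1#) * γ) * b′)          ≈⟨ *-congˡ (*-congʳ (*-congˡ γ≈)) ⟩
    m * (G * j * B * b′)                       ∎
    where
    D₁ D₂ j : Carrier
    D₁ = n + i + 1#
    D₂ = 2# * n + 2# * i + 1#
    j  = 2# * i + 1#

-- Transport along ring homomorphisms

IsHom : (R : CommutativeRing c ℓ) (S : CommutativeRing c′ ℓ′) →
  (CommutativeRing.Carrier R → CommutativeRing.Carrier S) → Set _
IsHom R S = IsRingHomomorphism (CommutativeRing.rawRing R) (CommutativeRing.rawRing S)

module _ (R : CommutativeRing c ℓ) (S : CommutativeRing c′ ℓ′) where
  private
    module R = CommutativeRing R
    module S = CommutativeRing S

  isHom : ∀ {φ : R.Carrier → S.Carrier} → (∀ {x y} → x R.≈ y → φ x S.≈ φ y) →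
    (∀ x y → φ (x R.+ y) S.≈ φ x S.+ φ y) → (∀ x y → φ (x R.* y) S.≈ φ x S.* φ y) →
    (∀ x → φ (R.- x) S.≈ S.- φ x) → φ R.0# S.≈ S.0# → φ R.1# S.≈ S.1# → IsHom R S φ
  isHom φ-cong φ-+ φ-* φ-neg φ-0 φ-1 = record
    { isSemiringHomomorphism = record
      { isNearSemiringHomomorphism = record
        { +-isMonoidHomomorphism = record
          { isMagmaHomomorphism = record
            { isRelHomomorphism = record { cong = φ-cong }
            ; homo = φ-+
            }
          ; ε-homo = φ-0
          }
        ; *-homo = φ-*
        }
      ; 1#-homo = φ-1
      }
    ; -‿homo = φ-neg
    }

module _ (R : CommutativeRing c ℓ) where
  open CommutativeRing R hiding (zero)
  open PowerSeriesRing R using (const; const-*)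

  const-isHom : IsHom R (PowerSeriesRing.commutativeRing R) const
  const-isHom = isHom R (PowerSeriesRing.commutativeRing R)
    (λ { r≈s zero → r≈s ; r≈s (suc n) → refl })
    (λ { r s zero → refl ; r s (suc n) → sym (+-identityˡ 0#) })
    (λ { r s zero → sym (const-* r (const s) zero)
       ; r s (suc n) → sym (trans (const-* r (const s) (suc n)) (zeroʳ r)) })
    (λ { r zero → refl ; r (suc n) → sym (trans (sym (+-identityˡ _)) (-‿inverseʳ 0#)) })
    (λ { zero → refl ; (suc n) → refl })
    (λ { zero → refl ; (suc n) → refl })

  Regular-1 : Regular R 1#
  Regular-1 {s} eq = trans (sym (*-identityˡ s)) eq

  Regular-resp-≈ : ∀ {r s} → r ≈ s → Regular R r → Regular R s
  Regular-resp-≈ r≈s reg eq = reg (trans (*-congʳ r≈s) eq)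

module Homomorphism (R : CommutativeRing c ℓ) (S : CommutativeRing c′ ℓ′) {φ} (φ-isHom : IsHom R S φ) where
  private
    module R = CommutativeRing R
    module S = CommutativeRing S
    module R⟦⟧ = PowerSeriesRing R
    module S⟦⟧ = PowerSeriesRing S
    module φ = IsRingHomomorphism φ-isHom
    module KR = KrewerasAlgebra R
    module KS = KrewerasAlgebra S
  open SetoidReasoning S.setoid

  2-homo : φ KR.2# S.≈ KS.2#
  2-homo = S.trans (φ.+-homo _ _) (S.+-cong φ.1#-homo φ.1#-homo)

  4-homo : φ KR.4# S.≈ KS.4#
  4-homo = S.trans (φ.+-homo _ _) (S.+-cong (S.trans (φ.+-homo _ _) (S.+-cong 2-homo φ.1#-homo)) φ.1#-homo)

  half-hom : ∀ {h} → KR.2# R.* h R.≈ R.1# → KS.2# S.* φ h S.≈ S.1#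
  half-hom {h} eq = begin
    KS.2# S.* φ h    ≈⟨ S.*-congʳ 2-homo ⟨
    φ KR.2# S.* φ h  ≈⟨ φ.*-homo KR.2# h ⟨
    φ (KR.2# R.* h)  ≈⟨ φ.⟦⟧-cong eq ⟩
    φ R.1#           ≈⟨ φ.1#-homo ⟩
    S.1#             ∎

  product-hom : ∀ {a b c} → a R.≈ b R.* c → φ a S.≈ φ b S.* φ c
  product-hom eq = S.trans (φ.⟦⟧-cong eq) (φ.*-homo _ _)

  2+W³-hom : ∀ {g W} → g R.≈ KR.2# R.+ W R.* (W R.* W) → φ g S.≈ KS.2# S.+ φ W S.* (φ W S.* φ W)
  2+W³-hom {g} {W} eq = begin
    φ g                                  ≈⟨ φ.⟦⟧-cong eq ⟩
    φ (KR.2# R.+ W R.* (W R.* W))        ≈⟨ φ.+-homo _ _ ⟩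
    φ KR.2# S.+ φ (W R.* (W R.* W))      ≈⟨ S.+-cong 2-homo (S.trans (φ.*-homo _ _) (S.*-congˡ (φ.*-homo _ _))) ⟩
    KS.2# S.+ φ W S.* (φ W S.* φ W)      ∎

  4e≈W²-hom : ∀ {e W} → KR.4# R.* e R.≈ W R.* W → KS.4# S.* φ e S.≈ φ W S.* φ W
  4e≈W²-hom {e} {W} eq = begin
    KS.4# S.* φ e    ≈⟨ S.*-congʳ 4-homo ⟨
    φ KR.4# S.* φ e  ≈⟨ φ.*-homo KR.4# e ⟨
    φ (KR.4# R.* e)  ≈⟨ φ.⟦⟧-cong eq ⟩
    φ (W R.* W)      ≈⟨ φ.*-homo W W ⟩
    φ W S.* φ W      ∎

  axis₀-hom : ∀ h g W e → φ (h R.* (g R.* (R.1# R.- W R.* e))) S.≈ φ h S.* (φ g S.* (S.1# S.- φ W S.* φ e))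
  axis₀-hom h g W e = S.trans (φ.*-homo _ _) (S.*-congˡ (S.trans (φ.*-homo _ _) (S.*-congˡ
    (S.trans (φ.+-homo _ _) (S.+-cong φ.1#-homo (S.trans (φ.-‿homo _) (S.-‿cong (φ.*-homo W e))))))))

  map-* : ∀ f g n → φ ((f R⟦⟧.* g) n) S.≈ ((λ k → φ (f k)) S⟦⟧.* (λ k → φ (g k))) n
  map-* f g zero    = S.trans (φ.+-homo _ _) (S.+-cong (φ.*-homo _ _) φ.0#-homo)
  map-* f g (suc n) = S.trans (φ.+-homo _ _) (S.+-cong (φ.*-homo _ _) (map-* (R⟦⟧.tail f) g n))

  map-isHom : IsHom R⟦⟧.commutativeRing S⟦⟧.commutativeRing (λ f n → φ (f n))
  map-isHom = isHom R⟦⟧.commutativeRing S⟦⟧.commutativeRing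
    (λ f≈g n → φ.⟦⟧-cong (f≈g n)) (λ f g n → φ.+-homo (f n) (g n)) map-* (λ f n → φ.-‿homo (f n))
    (λ { zero → φ.0#-homo ; (suc n) → φ.0#-homo })
    (λ { zero → φ.1#-homo ; (suc n) → φ.0#-homo })

  Catalytic-hom : ∀ {t x p p₀} → KrewerasAlgebra.Catalytic R t x p p₀ →
    KrewerasAlgebra.Catalytic S (φ t) (φ x) (φ p) (φ p₀)
  Catalytic-hom {t} {x} {p} {p₀} eq = begin
    φ x S.* φ p S.+ (φ t S.* φ p₀ S.+ φ t S.* φ p₀)
      ≈⟨ S.+-cong (φ.*-homo x p) (S.+-cong (φ.*-homo t p₀) (φ.*-homo t p₀)) ⟨
    φ (x R.* p) S.+ (φ (t R.* p₀) S.+ φ (t R.* p₀))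
      ≈⟨ S.trans (φ.+-homo _ _) (S.+-congˡ (φ.+-homo _ _)) ⟨
    φ (x R.* p R.+ (t R.* p₀ R.+ t R.* p₀))
      ≈⟨ φ.⟦⟧-cong eq ⟩
    φ (x R.+ t R.* (t R.* (x R.* (x R.* (p R.* p)))) R.+ (t R.* p R.+ t R.* p))
      ≈⟨ S.trans (φ.+-homo _ _) (S.+-cong (φ.+-homo _ _) (φ.+-homo _ _)) ⟩
    φ x S.+ φ (t R.* (t R.* (x R.* (x R.* (p R.* p))))) S.+ (φ (t R.* p) S.+ φ (t R.* p))
      ≈⟨ S.+-cong (S.+-congˡ t²x²p²) (S.+-cong (φ.*-homo t p) (φ.*-homo t p)) ⟩
    φ x S.+ φ t S.* (φ t S.* (φ x S.* (φ x S.* (φ p S.* φ p)))) S.+ (φ t S.* φ p S.+ φ t S.* φ p) ∎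
    where
    *-homo-congˡ : ∀ {y z} r → φ y S.≈ z → φ (r R.* y) S.≈ φ r S.* z
    *-homo-congˡ r eq = S.trans (φ.*-homo r _) (S.*-congˡ eq)
    t²x²p² : φ (t R.* (t R.* (x R.* (x R.* (p R.* p))))) S.≈ φ t S.* (φ t S.* (φ x S.* (φ x S.* (φ p S.* φ p))))
    t²x²p² = *-homo-congˡ t (*-homo-congˡ t (*-homo-congˡ x (*-homo-congˡ x (φ.*-homo p p))))

Catalytic-cong : (R : CommutativeRing c ℓ) → let open CommutativeRing R; open KrewerasAlgebra R in
  ∀ {t t′ x x′ p p′ p₀ p₀′} → t ≈ t′ → x ≈ x′ → p ≈ p′ → p₀ ≈ p₀′ → Catalytic t x p p₀ → Catalytic t′ x′ p′ p₀′
Catalytic-cong R t≈ x≈ p≈ p₀≈ eq = trans (sym (+-cong (*-cong x≈ p≈) (+-cong (*-cong t≈ p₀≈) (*-cong t≈ p₀≈))))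
  (trans eq (+-cong (+-cong x≈ (*-cong t≈ (*-cong t≈ (*-cong x≈ (*-cong x≈ (*-cong p≈ p≈))))))
    (+-cong (*-cong t≈ p≈) (*-cong t≈ p≈))))
  where open CommutativeRing R

-- The series that solves the functional equation

module Geometric (R : CommutativeRing c ℓ) where
  private module R = CommutativeRing R
  open PowerSeriesRing R
  open IntegerCoefficients R
  open RingOps R.rawRing using () renaming (_^_ to _^R_)
  open SetoidReasoning R.setoid

  -- The substitution x ↦ e x, which `scaled-*` shows to be multiplicative.
  scaled : R.Carrier → Series → Series
  scaled e f i = f i R.* e ^R i

  scaled-* : ∀ e f g → scaled e f * scaled e g ≈ scaled e (f * g)
  scaled-* e f g zero    = solve 2 (λ a b → a :* con 1ℤ :* (b :* con 1ℤ) :+ con 0ℤ := (a :* b :+ con 0ℤ) :* con 1ℤ)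
    R.refl (f 0) (g 0)
  scaled-* e f g (suc i) = begin
    f 0 R.* R.1# R.* (g (suc i) R.* (e R.* e ^R i)) R.+ (tail (scaled e f) * scaled e g) i
      ≈⟨ R.+-congˡ (*-cong {g = scaled e g}
           (λ k → solve 3 (λ a e b → a :* (e :* b) := e :* a :* b) R.refl (f (suc k)) e (e ^R k)) (λ _ → R.refl) i) ⟩
    f 0 R.* R.1# R.* (g (suc i) R.* (e R.* e ^R i)) R.+ (scaled e (λ k → e R.* tail f k) * scaled e g) i
      ≈⟨ R.+-congˡ (scaled-* e (λ k → e R.* tail f k) g i) ⟩
    f 0 R.* R.1# R.* (g (suc i) R.* (e R.* e ^R i)) R.+ ((λ k → e R.* tail f k) * g) i R.* e ^R i
      ≈⟨ R.+-congˡ (R.*-congʳ (scale-* e (tail f) g i)) ⟩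
    f 0 R.* R.1# R.* (g (suc i) R.* (e R.* e ^R i)) R.+ e R.* (tail f * g) i R.* e ^R i
      ≈⟨ solve 5 (λ a b e x y → a :* con 1ℤ :* (b :* (e :* x)) :+ e :* y :* x := (a :* b :+ y) :* (e :* x))
           R.refl (f 0) (g (suc i)) e (e ^R i) ((tail f * g) i) ⟩
    (f 0 R.* g (suc i) R.+ (tail f * g) i) R.* (e R.* e ^R i) ∎

module Tower (R : CommutativeRing c ℓ) where
  private
    module R = CommutativeRing R
    module K = KrewerasAlgebra R
    module S = PowerSeriesRing R
    module S′ = CommutativeRing S.commutativeRing
    module KS = KrewerasAlgebra S.commutativeRing
    module T = PowerSeriesRing S.commutativeRing
    module T′ = CommutativeRing T.commutativeRing
  open RingProperties R.ring using (-0#≈0#)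

  -- `S` is R⟦x⟧ and `T` is R⟦x⟧⟦y⟧, so `F j i` is the coefficient of yʲ xⁱ. R will be ℚ⟦t⟧, but t
  -- is just an element here: only the listed equations are used. `γ` is the sequence of Catalan
  -- numbers, through its convolution recurrence.
  module Solution {t W g h e : R.Carrier} {γ : S.Series}
    (2h≈1 : K.2# R.* h R.≈ R.1#) (W≈ : W R.≈ t R.* g) (g≈ : g R.≈ K.2# R.+ W R.* (W R.* W))
    (4e≈ : K.4# R.* e R.≈ W R.* W) (γ₀ : γ 0 R.≈ R.1#) (γ₁ : γ 1 R.≈ R.1#) (γ² : ∀ i → (γ S.* γ) i R.≈ γ (suc i)) where

    -- In the overview `κ` is c and its tail is d; as e = W² / 4, it is the Catalan series with x W²
    -- / 4 substituted.
    κ : S.Series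
    κ = Geometric.scaled R e γ

    axis : S.Series
    axis i = h R.* (g R.* (κ i R.- W R.* κ (suc i)))

    axis₀ : R.Carrier
    axis₀ = h R.* (g R.* (R.1# R.- W R.* e))

    axis-catalytic : KS.Catalytic (S.const t) S.var axis (S.const axis₀)
    axis-catalytic = Catalytic-cong S.commutativeRing
      {S.const t} {S.const t} {S.var} {S.var} {S.const h S.* (S.const g S.* (κ S.- S.const W S.* S.tail κ))} {axis}
      {S.const h S.* (S.const g S.* (S.1# S.- S.const W S.* S.const e))} {S.const axis₀}
      (λ _ → R.refl) (λ _ → R.refl) axis≈ (S′.sym {S.const axis₀} (const-hom.axis₀-hom h g W e))
      (KS.catalytic {S.const t} {S.var} {S.const W} {S.const g} {S.const h} {κ} {S.tail κ} {S.const e}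
        (const-hom.half-hom 2h≈1) (const-hom.product-hom W≈) (const-hom.2+W³-hom g≈) κ≈ 4κ′≈ (const-hom.4e≈W²-hom 4e≈))
      where
      module const-hom = Homomorphism R S.commutativeRing (const-isHom R)
      axis≈ : S.const h S.* (S.const g S.* (κ S.- S.const W S.* S.tail κ)) S.≈ axis
      axis≈ i = R.trans (S.const-* h (S.const g S.* (κ S.- S.const W S.* S.tail κ)) i)
        (R.*-congˡ (R.trans (S.const-* g (κ S.- S.const W S.* S.tail κ) i)
          (R.*-congˡ (R.+-congˡ (R.-‿cong (S.const-* W (S.tail κ) i))))))
      κ≈ : κ S.≈ S.1# S.+ S.var S.* S.tail κ
      κ≈ zero    = R.trans (R.trans (R.*-identityʳ _) γ₀) (R.sym (R.trans (R.+-congˡ (S.var-*-zero (S.tail κ))) (R.+-identityʳ _)))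
      κ≈ (suc i) = R.sym (R.trans (R.+-congˡ (S.var-*-suc (S.tail κ) i)) (R.+-identityˡ _))
      -- This is γ² = `tail γ` after x ↦ e x, the extra factor e in the tail giving 4 e = W².
      4κ′≈ : KS.4# S.* S.tail κ S.≈ S.const W S.* S.const W S.* (κ S.* κ)
      4κ′≈ i = begin
        (KS.4# S.* S.tail κ) i                   ≈⟨ S.*-cong {S.const K.4#} {KS.4#} {S.tail κ} const-hom.4-homo (λ _ → R.refl) i ⟨
        (S.const K.4# S.* S.tail κ) i            ≈⟨ S.const-* K.4# (S.tail κ) i ⟩
        K.4# R.* (γ (suc i) R.* (e R.* eⁱ))
          ≈⟨ solve 4 (λ f a e b → f :* (a :* (e :* b)) := f :* e :* (a :* b)) R.refl K.4# (γ (suc i)) e eⁱ ⟩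
        K.4# R.* e R.* (γ (suc i) R.* eⁱ)        ≈⟨ R.*-cong 4e≈ (R.*-congʳ (R.sym (γ² i))) ⟩
        W R.* W R.* ((γ S.* γ) i R.* eⁱ)         ≈⟨ R.*-congˡ (Geometric.scaled-* R e γ γ i) ⟨
        W R.* W R.* (κ S.* κ) i                  ≈⟨ S.const-* (W R.* W) (κ S.* κ) i ⟨
        (S.const (W R.* W) S.* (κ S.* κ)) i      ≈⟨ S.*-cong {S.const (W R.* W)} {S.const W S.* S.const W} {κ S.* κ} (*-homo W W) (λ _ → R.refl) i ⟩
        (S.const W S.* S.const W S.* (κ S.* κ)) i ∎
        where
        open SetoidReasoning R.setoid
        open IntegerCoefficients R
        open IsRingHomomorphism (const-isHom R) using (*-homo)
        eⁱ = RingOps._^_ R.rawRing e i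

    private
      x̂ t̂ p̂ q̂ H : T.Series
      x̂ = T.const S.var
      t̂ = T.const (S.const t)
      p̂ = T.const axis
      q̂ j = S.const (axis j)
      -- (xⁿ⁺¹ - yⁿ⁺¹) / (x - y) is the sum of the xⁱ yʲ with i + j = n, so the divided difference
      -- of x p(x) can be written down without dividing.
      H j i = axis (j ℕ.+ i)

    quadrant : T.Series
    quadrant = T.quotient (t̂ T.* (x̂ T.* H)) H

    x̂-*-zero : ∀ F j → (x̂ T.* F) j 0 R.≈ R.0#
    x̂-*-zero F j = R.trans (T.const-* S.var F j 0) (S.var-*-zero (F j))

    x̂-*-suc : ∀ F j i → (x̂ T.* F) j (suc i) R.≈ F j i
    x̂-*-suc F j i = R.trans (T.const-* S.var F j (suc i)) (S.var-*-suc (F j) i)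

    t̂-* : ∀ F j i → (t̂ T.* F) j i R.≈ t R.* F j i
    t̂-* F j i = R.trans (T.const-* (S.const t) F j i) (S.const-* t (F j) i)

    quadrant-kernel : x̂ T.* (T.var T.* quadrant) T.+ (t̂ T.* (x̂ T.* p̂) T.+ t̂ T.* (T.var T.* q̂)) T.≈
      x̂ T.* T.var T.+ t̂ T.* (x̂ T.* quadrant T.+ (T.var T.* quadrant T.+ x̂ T.* (T.var T.* (x̂ T.* (T.var T.* quadrant)))))
    quadrant-kernel = KrewerasAlgebra.kernel-equation T.commutativeRing
      {t̂} {x̂} {T.var} {p̂} {q̂} {T.const (S.const axis₀)} {H} {quadrant}
      (Homomorphism.Catalytic-hom S.commutativeRing T.commutativeRing (const-isHom S.commutativeRing)
        {S.const t} {S.var} {axis} {S.const axis₀} axis-catalytic)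
      -- The equation of p(y): applying `const` to each coefficient turns a series in x into the
      -- same series in y, and carries the variable x to y.
      (Catalytic-cong T.commutativeRing
        {λ j → S.const (S.const t j)} {t̂} {λ j → S.const (S.var j)} {T.var} {q̂} {q̂} {λ j → S.const (S.const axis₀ j)} {T.const (S.const axis₀)}
        (const-const t) var≈′ (λ _ _ → R.refl) (const-const axis₀)
        (Homomorphism.Catalytic-hom S.commutativeRing T.commutativeRing
          (Homomorphism.map-isHom R S.commutativeRing (const-isHom R)) {S.const t} {S.var} {axis} {S.const axis₀} axis-catalytic))
      H≈
      (T.quotient-unfold (t̂ T.* (x̂ T.* H)) H)
      -- As series in y, x - y has constant term x and 1 - t x y H has constant term 1, and both of
      -- these are regular.
      (T.regular {x̂ T.- T.var} (Regular-resp-≈ S.commutativeRing {S.var} {(x̂ T.- T.var) 0} var≈ S.var-regular))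
      (T.regular {T.1# T.- T.var T.* (t̂ T.* (x̂ T.* H))} (Regular-resp-≈ S.commutativeRing {S.1#} {(T.1# T.- T.var T.* (t̂ T.* (x̂ T.* H))) 0} 1≈ (Regular-1 S.commutativeRing)))
      where
      var≈ : S.var S.≈ (x̂ T.- T.var) 0
      var≈ i = R.sym (R.trans (R.+-congˡ (R.trans (R.-‿cong (S.const-0 i)) -0#≈0#)) (R.+-identityʳ (S.var i)))
      1≈ : S.1# S.≈ (T.1# T.- T.var T.* (t̂ T.* (x̂ T.* H))) 0
      1≈ i = R.sym (R.trans (R.+-congˡ (R.trans (R.-‿cong (R.trans (T.var-*-zero (t̂ T.* (x̂ T.* H)) i) (S.const-0 i))) -0#≈0#))
        (R.+-identityʳ (S.1# i)))
      const-const : ∀ r → (λ j → S.const (S.const r j)) T.≈ T.const (S.const r)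
      const-const r zero    i = R.refl
      const-const r (suc j) i = R.refl
      var≈′ : (λ j → S.const (S.var j)) T.≈ T.var
      var≈′ zero          i = R.refl
      var≈′ (suc zero)    i = R.refl
      var≈′ (suc (suc j)) i = R.refl
      H≈ : x̂ T.* H T.+ T.var T.* q̂ T.≈ T.var T.* H T.+ x̂ T.* p̂
      H≈ zero i = R.trans (R.+-cong (T.const-* S.var H 0 i) (T.var-*-zero q̂ i))
        (R.trans (R.+-comm _ _) (R.sym (R.+-cong (T.var-*-zero H i) (T.const-* S.var p̂ 0 i))))
      H≈ (suc j) i = R.trans (R.+-congˡ (T.var-*-suc q̂ j i)) (R.trans (shifted i) (R.sym (R.+-congʳ (T.var-*-suc H j i))))
        where
        shifted : ∀ i → (x̂ T.* H) (suc j) i R.+ S.const (axis j) i R.≈ axis (j ℕ.+ i) R.+ (x̂ T.* p̂) (suc j) i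
        shifted zero = R.trans (R.+-congʳ (x̂-*-zero H (suc j))) (R.trans (R.+-comm _ _)
          (R.+-cong (R.reflexive (cong axis (≡.sym (ℕ.+-identityʳ j)))) (R.sym (x̂-*-zero p̂ (suc j)))))
        shifted (suc i) = R.+-cong (R.trans (x̂-*-suc H (suc j) i) (R.reflexive (cong axis (≡.sym (ℕ.+-suc j i)))))
          (R.sym (R.trans (x̂-*-suc p̂ (suc j) i) (S.const-0 i)))

    diagonalShift : T.Series → T.Series
    diagonalShift F (suc j) (suc i) = F j i
    diagonalShift F _       _       = R.0#

    -- The coefficient of xⁱ⁺¹ yʲ⁺¹ in the functional equation, to which t x p(x) and t y p(y)
    -- contribute nothing. The three terms multiplied by t correspond to a last step south, west and
    -- north-east.
    quadrant-recurrence : ∀ j i → quadrant j i R.≈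
      T.1# j i R.+ t R.* (quadrant (suc j) i R.+ (quadrant j (suc i) R.+ diagonalShift quadrant j i))
    quadrant-recurrence j i = begin
      quadrant j i                     ≈⟨ T.var-*-suc quadrant j i ⟨
      (T.var T.* quadrant) (suc j) i   ≈⟨ x̂-*-suc (T.var T.* quadrant) (suc j) i ⟨
      (x̂ T.* (T.var T.* quadrant)) (suc j) (suc i)
        ≈⟨ R.trans (R.+-congˡ boundary) (R.+-identityʳ _) ⟨
      (x̂ T.* (T.var T.* quadrant) T.+ (t̂ T.* (x̂ T.* p̂) T.+ t̂ T.* (T.var T.* q̂))) (suc j) (suc i)
        ≈⟨ quadrant-kernel (suc j) (suc i) ⟩
      (x̂ T.* T.var) (suc j) (suc i) R.+ (t̂ T.* G) (suc j) (suc i)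
        ≈⟨ R.+-cong (x̂-*-suc T.var (suc j) i) (R.trans (t̂-* G (suc j) (suc i)) (R.*-congˡ
             (R.+-cong (x̂-*-suc quadrant (suc j) i) (R.+-cong (T.var-*-suc quadrant j (suc i)) diag)))) ⟩
      T.1# j i R.+ t R.* (quadrant (suc j) i R.+ (quadrant j (suc i) R.+ diagonalShift quadrant j i)) ∎
      where
      open SetoidReasoning R.setoid
      yV = T.var T.* quadrant
      G = x̂ T.* quadrant T.+ (yV T.+ x̂ T.* (T.var T.* (x̂ T.* yV)))
      boundary : (t̂ T.* (x̂ T.* p̂)) (suc j) (suc i) R.+ (t̂ T.* (T.var T.* q̂)) (suc j) (suc i) R.≈ R.0#
      boundary = R.trans (R.+-cong
          (R.trans (t̂-* (x̂ T.* p̂) (suc j) (suc i)) (R.trans (R.*-congˡ (R.trans (x̂-*-suc p̂ (suc j) i) (S.const-0 i))) (R.zeroʳ t)))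
          (R.trans (t̂-* (T.var T.* q̂) (suc j) (suc i)) (R.trans (R.*-congˡ (T.var-*-suc q̂ j (suc i))) (R.zeroʳ t))))
        (R.+-identityˡ R.0#)
      diag′ : ∀ j i → (x̂ T.* yV) j i R.≈ diagonalShift quadrant j i
      diag′ zero    zero    = x̂-*-zero yV 0
      diag′ (suc j) zero    = x̂-*-zero yV (suc j)
      diag′ zero    (suc i) = R.trans (x̂-*-suc yV 0 i) (R.trans (T.var-*-zero quadrant i) (S.const-0 i))
      diag′ (suc j) (suc i) = R.trans (x̂-*-suc yV (suc j) i) (T.var-*-suc quadrant j i)
      diag : (x̂ T.* (T.var T.* (x̂ T.* yV))) (suc j) (suc i) R.≈ diagonalShift quadrant j i
      diag = R.trans (x̂-*-suc (T.var T.* (x̂ T.* yV)) (suc j) i) (R.trans (T.var-*-suc (x̂ T.* yV) j i) (diag′ j i))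

-- Laurent series in t and the clearing of their poles

module _ (R : CommutativeRing c ℓ) where
  private
    module R = CommutativeRing R
    module S = PowerSeriesRing R
    module S′ = CommutativeRing S.commutativeRing
    module L = LaurentSeries R.rawRing
  open SetoidReasoning R.setoid

  -- With coefficients indexed by all of ℤ, multiplication by a power of t is a translation of the
  -- index.
  extend : S.Series → ℤ → R.Carrier
  extend f (+ n)    = f n
  extend f -[1+ _ ] = R.0#

  extend-cong : ∀ {f g} → f S.≈ g → ∀ k → extend f k R.≈ extend g k
  extend-cong f≈g (+ n)    = f≈g n
  extend-cong f≈g -[1+ n ] = R.refl

  extend-shift-suc : ∀ v f k → extend (S.shift (suc v) f) (ℤ.suc k) ≡ extend (S.shift v f) k
  extend-shift-suc v f (+ n)        = ≡.refl
  extend-shift-suc v f -[1+ zero ]  = ≡.refl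
  extend-shift-suc v f -[1+ suc n ] = ≡.refl

  extend-shift : ∀ v f k → extend (S.shift v f) (k ℤ.+ + v) ≡ extend f k
  extend-shift zero    f k = ≡.trans (cong (extend (S.shift 0 f)) (ℤ.+-identityʳ k)) (shift-zero k)
    where
    shift-zero : ∀ k → extend (S.shift 0 f) k ≡ extend f k
    shift-zero (+ n)    = ≡.refl
    shift-zero -[1+ n ] = ≡.refl
  extend-shift (suc v) f k = ≡.trans (cong (extend (S.shift (suc v) f)) k+[1+v])
    (≡.trans (extend-shift-suc v f (k ℤ.+ + v)) (extend-shift v f k))
    where
    k+[1+v] : k ℤ.+ + suc v ≡ ℤ.suc (k ℤ.+ + v)
    k+[1+v] = ≡.trans (≡.sym (ℤ.+-assoc k 1ℤ (+ v))) (≡.trans (cong (λ m → m ℤ.+ + v) (ℤ.+-comm k 1ℤ)) (ℤ.+-assoc 1ℤ k (+ v)))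

  coeff-extend : ∀ k v f → L.coeff k (t^- v ∙ f) ≡ extend f (k ℤ.+ + v)
  coeff-extend k v f with k ℤ.+ + v
  ... | + n      = ≡.refl
  ... | -[1+ n ] = ≡.refl

  -- Multiplication by tᵛ⁺ʷ clears both poles and reduces the equality to one of power series.
  shift≈⇒laurent≈ : ∀ {v w f g} → S.shift w f S.≈ S.shift v g →
    ∀ k → L.coeff k (t^- v ∙ f) R.≈ L.coeff k (t^- w ∙ g)
  shift≈⇒laurent≈ {v} {w} {f} {g} eq k = begin
    L.coeff k (t^- v ∙ f)                        ≡⟨ coeff-extend k v f ⟩
    extend f (k ℤ.+ + v)                         ≡⟨ extend-shift w f (k ℤ.+ + v) ⟨
    extend (S.shift w f) (k ℤ.+ + v ℤ.+ + w)     ≈⟨ extend-cong eq (k ℤ.+ + v ℤ.+ + w) ⟩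
    extend (S.shift v g) (k ℤ.+ + v ℤ.+ + w)     ≡⟨ cong (extend (S.shift v g)) k+v+w ⟩
    extend (S.shift v g) (k ℤ.+ + w ℤ.+ + v)     ≡⟨ extend-shift v g (k ℤ.+ + w) ⟩
    extend g (k ℤ.+ + w)                         ≡⟨ coeff-extend k w g ⟨
    L.coeff k (t^- w ∙ g)                        ∎
    where
    k+v+w : k ℤ.+ + v ℤ.+ + w ≡ k ℤ.+ + w ℤ.+ + v
    k+v+w = ≡.trans (ℤ.+-assoc k (+ v) (+ w)) (≡.trans (cong (λ m → k ℤ.+ m) (ℤ.+-comm (+ v) (+ w))) (≡.sym (ℤ.+-assoc k (+ w) (+ v))))

  laurent≈⇒shift≈ : ∀ {v f g} → (∀ k → L.coeff k (t^- v ∙ f) R.≈ L.coeff k (t^- 0 ∙ g)) → f S.≈ S.shift v g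
  laurent≈⇒shift≈ {v} {f} {g} eq n = begin
    extend f (+ n)                         ≡⟨ cong (extend f) n-v+v ⟨
    extend f (k ℤ.+ + v)                   ≡⟨ coeff-extend k v f ⟨
    L.coeff k (t^- v ∙ f)                  ≈⟨ eq k ⟩
    L.coeff k (t^- 0 ∙ g)                  ≡⟨ coeff-extend k 0 g ⟩
    extend g (k ℤ.+ 0ℤ)                    ≡⟨ cong (extend g) (ℤ.+-identityʳ k) ⟩
    extend g k                             ≡⟨ extend-shift v g k ⟨
    extend (S.shift v g) (k ℤ.+ + v)       ≡⟨ cong (extend (S.shift v g)) n-v+v ⟩
    extend (S.shift v g) (+ n)             ∎
    where
    k = + n ℤ.- + v
    n-v+v : k ℤ.+ + v ≡ + n
    n-v+v = ≡.trans (ℤ.+-assoc (+ n) (ℤ.- + v) (+ v)) (≡.trans (cong (λ m → + n ℤ.+ m) (ℤ.+-inverseˡ (+ v))) (ℤ.+-identityʳ (+ n)))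

  shift-cong : ∀ v {f g} → f S.≈ g → S.shift v f S.≈ S.shift v g
  shift-cong zero    f≈g n       = f≈g n
  shift-cong (suc v) f≈g zero    = R.refl
  shift-cong (suc v) f≈g (suc n) = shift-cong v f≈g n

  shift≈* : ∀ v f → S.shift v f S.≈ S.shift v S.1# S.* f
  shift≈* zero    f n       = R.sym (R.trans (S.*-cong {S.shift 0 S.1#} {S.1#} {f} (λ _ → R.refl) (λ _ → R.refl) n) (S′.*-identityˡ f n))
  shift≈* (suc v) f zero    = R.sym (R.trans (R.+-identityʳ _) (R.zeroˡ (f 0)))
  shift≈* (suc v) f (suc n) = begin
    S.shift v f n                                              ≈⟨ shift≈* v f n ⟩
    (S.shift v S.1# S.* f) n                                   ≈⟨ R.+-identityˡ _ ⟨
    R.0# R.+ (S.shift v S.1# S.* f) n                          ≈⟨ R.+-congʳ (R.zeroˡ (f (suc n))) ⟨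
    R.0# R.* f (suc n) R.+ (S.shift v S.1# S.* f) n            ∎

  shift-1 : ∀ f → S.shift 1 f S.≈ S.var S.* f
  shift-1 f zero    = R.sym (S.var-*-zero f)
  shift-1 f (suc n) = R.sym (S.var-*-suc f n)

  -- The conclusion has the numerators exactly as the Laurent operations compute them, with shifts
  -- and units; the hypothesis is the same identity in plain ring notation, the form given by
  -- `clear-denominators`.
  laurent-normal-form : ∀ v {x⁻¹ h f P Q} → let τ = S.shift v S.1#; t = S.var in
    τ S.* (t S.* (t S.* P)) S.≈ x⁻¹ S.* (τ S.* (h S.- t S.* x⁻¹) S.- t S.* ((f S.- τ S.* x⁻¹) S.* Q)) →
    S.shift (suc (suc v)) P S.≈ S.1# S.* x⁻¹ S.*
      (S.shift v (S.shift 0 (h S.* S.1#) S.+ S.shift 1 (S.- x⁻¹)) S.+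
       S.shift 1 (S.- ((S.shift 0 f S.+ S.shift v (S.- x⁻¹)) S.* Q)))
  laurent-normal-form v {z} {h} {f} {P} {Q} eq = S′.trans lhs (S′.trans eq rhs)
    where
    open RingProperties S′.ring using (-‿distribʳ-*)
    τ = S.shift v S.1#
    t = S.var
    lhs : S.shift (suc (suc v)) P S.≈ τ S.* (t S.* (t S.* P))
    lhs = S′.trans (shift≈* (suc (suc v)) P) (S′.trans (S′.*-congʳ {P} {S.shift (2 ℕ.+ v) S.1#} {t S.* (t S.* τ)} tt)
      (S′.trans (S′.*-assoc t (t S.* τ) P) (S′.trans (S′.*-congˡ {t} (S′.*-assoc t τ P))
        (S′.trans (S′.*-congˡ {t} (swap t P)) (swap t (t S.* P))))))
      where
      swap : ∀ a b → a S.* (τ S.* b) S.≈ τ S.* (a S.* b)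
      swap a b = S′.trans (S′.sym (S′.*-assoc a τ b)) (S′.trans (S′.*-congʳ {b} (S′.*-comm a τ)) (S′.*-assoc τ a b))
      tt : S.shift (2 ℕ.+ v) S.1# S.≈ t S.* (t S.* τ)
      tt zero          = R.sym (S.var-*-zero (t S.* τ))
      tt (suc zero)    = R.sym (R.trans (S.var-*-suc (t S.* τ) 0) (S.var-*-zero τ))
      tt (suc (suc n)) = R.sym (R.trans (S.var-*-suc (t S.* τ) (suc n)) (S.var-*-suc τ n))
    first : S.shift 0 (h S.* S.1#) S.+ S.shift 1 (S.- z) S.≈ h S.- t S.* z
    first n = R.+-cong (S′.*-identityʳ h n) (S′.trans (shift-1 (S.- z)) (S′.sym (-‿distribʳ-* t z)) n)
    second : S.shift 0 f S.+ S.shift v (S.- z) S.≈ f S.- τ S.* z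
    second n = R.+-congˡ (S′.trans (shift≈* v (S.- z)) (S′.sym (-‿distribʳ-* τ z)) n)
    rhs : z S.* (τ S.* (h S.- t S.* z) S.- t S.* ((f S.- τ S.* z) S.* Q)) S.≈ S.1# S.* z S.*
      (S.shift v (S.shift 0 (h S.* S.1#) S.+ S.shift 1 (S.- z)) S.+
       S.shift 1 (S.- ((S.shift 0 f S.+ S.shift v (S.- z)) S.* Q)))
    rhs = S′.sym (S.*-cong {S.1# S.* z} {z} (S′.*-identityˡ z) (S′.+-cong
      {S.shift v (S.shift 0 (h S.* S.1#) S.+ S.shift 1 (S.- z))} {τ S.* (h S.- t S.* z)}
      (S′.trans (shift-cong v first) (shift≈* v (h S.- t S.* z)))
      (S′.trans (shift-1 (S.- ((S.shift 0 f S.+ S.shift v (S.- z)) S.* Q)))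
        (S′.trans (S′.sym (-‿distribʳ-* t ((S.shift 0 f S.+ S.shift v (S.- z)) S.* Q)))
          (S′.-‿cong (S′.*-congˡ {t} (S.*-cong {S.shift 0 f S.+ S.shift v (S.- z)} {f S.- τ S.* z} {Q} second (λ _ → R.refl))))))))

  unit⇒Regular : ∀ {u r} → u R.* r R.≈ R.1# → Regular R r
  unit⇒Regular {u} {r} ur≈1 {s} rs≈0 = begin
    s                ≈⟨ R.*-identityˡ s ⟨
    R.1# R.* s       ≈⟨ R.*-congʳ ur≈1 ⟨
    u R.* r R.* s    ≈⟨ R.*-assoc u r s ⟩
    u R.* (r R.* s)  ≈⟨ R.*-congˡ rs≈0 ⟩
    u R.* R.0#       ≈⟨ R.zeroʳ u ⟩
    R.0#             ∎

  private
    module KR = KrewerasAlgebra R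
    module KS = KrewerasAlgebra S.commutativeRing

  -- At t = 0 the series W is 0 and the root is 1, so the constant term is 2x + 2x = 4x, a unit
  -- among Laurent polynomials with inverse h h x⁻¹. For a root with constant term -1 it would be 0.
  square-root-regular : ∀ {x x⁻¹ h W Q F} → KR.2# R.* h R.≈ R.1# → x⁻¹ R.* x R.≈ R.1# →
    W 0 R.≈ R.0# → Q 0 R.≈ R.1# →
    Regular S.commutativeRing (KS.2# S.* ((S.const x S.- W) S.* Q) S.+ (KS.2# S.+ W S.* (W S.* W)) S.* (S.const x S.- KS.2# S.* (S.var S.* F)))
  square-root-regular {x} {z} {h} {W} {Q} {F} 2h≈1 zx≈1 W₀ Q₀ =
    S.regular {KS.2# S.* ((S.const x S.- W) S.* Q) S.+ (KS.2# S.+ W S.* (W S.* W)) S.* (S.const x S.- KS.2# S.* (S.var S.* F))}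
      (unit⇒Regular {h R.* h R.* z} (begin
        h R.* h R.* z R.* (_ R.+ _)
          ≈⟨ solve 7 (λ h z x w q y w′ →
               h :* h :* z :* ((con (+ 2) :* ((x :- w) :* q :+ con 0ℤ) :+ con 0ℤ) :+
                 ((con (+ 2) :+ (w :* w′ :+ con 0ℤ)) :* (x :- (con (+ 2) :* (con 0ℤ :* y :+ con 0ℤ) :+ con 0ℤ)) :+ con 0ℤ))
               := con 1ℤ :+ h :* h :* z :* con (+ 2) :* (x :- w) :* (q :- con 1ℤ)
                 :+ (h :* h :* z :* x :* w′ :- h :* h :* z :* con (+ 2)) :* (w :- con 0ℤ)
                 :+ (con (+ 2) :* h :* z :* x :+ z :* x) :* (con (+ 2) :* h :- con 1ℤ)
                 :+ con 1ℤ :* (z :* x :- con 1ℤ))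
               R.refl h z x (W 0) (Q 0) (F 0) ((W S.* W) 0) ⟩
        R.1# R.+ _ R.* _ R.+ _ R.* _ R.+ _ R.* _ R.+ _ R.* _  ≈⟨ +-vanishing _ _ zx≈1 ⟩
        R.1# R.+ _ R.* _ R.+ _ R.* _ R.+ _ R.* _              ≈⟨ +-vanishing _ _ 2h≈1 ⟩
        R.1# R.+ _ R.* _ R.+ _ R.* _                          ≈⟨ +-vanishing _ _ W₀ ⟩
        R.1# R.+ _ R.* _                                      ≈⟨ +-vanishing _ _ Q₀ ⟩
        R.1#                                                  ∎))
    where
    open IntegerCoefficients R
    open RingLemmas R

-- Comparison of R[x,x⁻¹]⟦t⟧ with R⟦t⟧⟦x⟧

module Bivariate (R : CommutativeRing c ℓ) where
  private
    module R = CommutativeRing R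
    module X = LaurentPolynomialRing R
    module S = PowerSeriesRing R
    module S′ = CommutativeRing S.commutativeRing
    module T = PowerSeriesRing S.commutativeRing
    module L = PowerSeriesRing X.commutativeRing
  open SetoidReasoning R.setoid

  sumBelow : ℕ → (ℕ → R.Carrier) → R.Carrier
  sumBelow zero    f = R.0#
  sumBelow (suc n) f = f 0 R.+ sumBelow n (f ∘ suc)

  polynomial : ℕ → S.Series → X.Polynomial
  polynomial n f = map (λ i → + i , f i) (upTo n)

  eval-polynomial : ∀ φ f n → X.eval φ (polynomial n f) R.≈ sumBelow n (λ i → f i R.* φ (+ i))
  eval-polynomial φ f n = eval-applyUpTo n id
    where
    eval-applyUpTo : ∀ n g → X.eval φ (map (λ i → + i , f i) (applyUpTo g n)) R.≈ sumBelow n (λ i → f (g i) R.* φ (+ g i))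
    eval-applyUpTo zero    g = R.refl
    eval-applyUpTo (suc n) g = R.+-congˡ (eval-applyUpTo n (g ∘ suc))

  sumBelow-cong : ∀ n {f g : ℕ → R.Carrier} → (∀ i → f i R.≈ g i) → sumBelow n f R.≈ sumBelow n g
  sumBelow-cong zero    eq = R.refl
  sumBelow-cong (suc n) eq = R.+-cong (eq 0) (sumBelow-cong n (λ i → eq (suc i)))

  -- The terms from `n` on vanish with `f`, so the truncated sum is the whole convolution; for
  -- negative `k` every index k - i is negative and `extend` gives 0.
  sumBelow-extend : ∀ n f g k → (∀ {i} → n ℕ.≤ i → f i R.≈ R.0#) →
    sumBelow n (λ i → f i R.* extend R g (k ℤ.- + i)) R.≈ extend R (f S.* g) k
  sumBelow-extend zero f g k f≈0 = R.sym (vanishing k)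
    where
    vanishing : ∀ k → extend R (f S.* g) k R.≈ R.0#
    vanishing (+ n)    = S.pointwise-zero-* {f} (λ i → f≈0 {i} ℕ.z≤n) g n
    vanishing -[1+ n ] = R.refl
  sumBelow-extend (suc n) f g k f≈0 = begin
    f 0 R.* extend R g (k ℤ.+ 0ℤ) R.+ sumBelow n (λ i → f (suc i) R.* extend R g (k ℤ.- + suc i))
      ≈⟨ R.+-cong (R.*-congˡ (R.reflexive (cong (extend R g) (ℤ.+-identityʳ k))))
           (sumBelow-cong n (λ i → R.*-congˡ (R.reflexive (cong (extend R g) (k-[1+i] i))))) ⟩
    f 0 R.* extend R g k R.+ sumBelow n (λ i → f (suc i) R.* extend R g (k ℤ.- 1ℤ ℤ.- + i))
      ≈⟨ R.+-congˡ (sumBelow-extend n (S.tail f) g (k ℤ.- 1ℤ) (λ n≤i → f≈0 (s≤s n≤i))) ⟩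
    f 0 R.* extend R g k R.+ extend R (S.tail f S.* g) (k ℤ.- 1ℤ)
      ≈⟨ step k ⟩
    extend R (f S.* g) k ∎
    where
    k-[1+i] : ∀ i → k ℤ.- + suc i ≡ k ℤ.- 1ℤ ℤ.- + i
    k-[1+i] i = ≡.trans (cong (λ m → k ℤ.+ m) (ℤ.neg-distrib-+ 1ℤ (+ i))) (≡.sym (ℤ.+-assoc k -1ℤ (ℤ.- + i)))
    step : ∀ k → f 0 R.* extend R g k R.+ extend R (S.tail f S.* g) (k ℤ.- 1ℤ) R.≈ extend R (f S.* g) k
    step (+ zero)  = R.refl
    step (+ suc n) = R.refl
    step -[1+ n ]  = R.trans (R.+-identityʳ _) (R.zeroʳ (f 0))

  infix 4 _∼_ _≃_

  _≃_ : X.Polynomial → S.Series → Set ℓ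
  p ≃ f = ∀ k → X.coeff k p R.≈ extend R f k

  -- F and f are the same bivariate series, as elements of R[x,x⁻¹]⟦t⟧ and R⟦t⟧⟦x⟧.
  _∼_ : L.Series → T.Series → Set ℓ
  F ∼ f = ∀ n → F n ≃ (λ i → f i n)

  ≃-resp-≈ : ∀ {p f g} → f S.≈ g → p ≃ f → p ≃ g
  ≃-resp-≈ f≈g p≃f k = R.trans (p≃f k) (extend-cong R f≈g k)

  0-≃ : ∀ {f} → f S.≈ S.0# → [] ≃ f
  0-≃ f≈0 (+ n)    = R.sym (R.trans (f≈0 n) (S.const-0 n))
  0-≃ f≈0 -[1+ n ] = R.refl

  +-≃ : ∀ {p q f g} → p ≃ f → q ≃ g → (p X.+ q) ≃ (f S.+ g)
  +-≃ {p} {q} p≃f q≃g (+ n)    = R.trans (X.coeff-+ (+ n) p q) (R.+-cong (p≃f (+ n)) (q≃g (+ n)))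
  +-≃ {p} {q} p≃f q≃g -[1+ n ] = R.trans (X.coeff-+ -[1+ n ] p q)
    (R.trans (R.+-cong (p≃f -[1+ n ]) (q≃g -[1+ n ])) (R.+-identityˡ _))

  polynomial-*-≃ : ∀ n {f q g} → (∀ {i} → n ℕ.≤ i → f i R.≈ R.0#) → q ≃ g → (polynomial n f X.* q) ≃ (f S.* g)
  polynomial-*-≃ n {f} {q} {g} f≈0 q≃g k = begin
    X.coeff k (polynomial n f X.* q)                            ≈⟨ X.coeff-* k (polynomial n f) q ⟩
    X.eval (λ e → X.coeff (k ℤ.- e) q) (polynomial n f)         ≈⟨ eval-polynomial (λ e → X.coeff (k ℤ.- e) q) f n ⟩
    sumBelow n (λ i → f i R.* X.coeff (k ℤ.- + i) q)            ≈⟨ sumBelow-cong n (λ i → R.*-congˡ (q≃g (k ℤ.- + i))) ⟩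
    sumBelow n (λ i → f i R.* extend R g (k ℤ.- + i))           ≈⟨ sumBelow-extend n f g k f≈0 ⟩
    extend R (f S.* g) k                                        ∎

  const-≃ : ∀ r → X.monomial 0ℤ r ≃ S.const r
  const-≃ r (+ zero)  = R.+-identityʳ r
  const-≃ r (+ suc n) = R.refl
  const-≃ r -[1+ n ]  = R.refl

  x-≃ : X.monomial 1ℤ R.1# ≃ S.var
  x-≃ (+ 0)             = R.refl
  x-≃ (+ 1)             = R.+-identityʳ R.1#
  x-≃ (+ suc (suc n))   = R.refl
  x-≃ -[1+ n ]          = R.refl

  polynomial-≃ : ∀ n {f} → (∀ {i} → n ℕ.≤ i → f i R.≈ R.0#) → polynomial n f ≃ f
  polynomial-≃ n {f} f≈0 k = begin
    X.coeff k (polynomial n f)          ≈⟨ CommutativeRing.*-identityʳ X.commutativeRing (polynomial n f) k ⟨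
    X.coeff k (polynomial n f X.* X.1#) ≈⟨ polynomial-*-≃ n {f} {X.1#} {S.1#} f≈0 (const-≃ R.1#) k ⟩
    extend R (f S.* S.1#) k             ≈⟨ extend-cong R (S′.*-identityʳ f) k ⟩
    extend R f k                        ∎

  x-*-≃ : ∀ {p f} → p ≃ f → (X.monomial 1ℤ R.1# X.* p) ≃ (S.var S.* f)
  x-*-≃ {p} {f} p≃f k = begin
    X.coeff k (X.monomial 1ℤ R.1# X.* p)  ≈⟨ X.coeff-monomial-* k 1ℤ R.1# p ⟩
    R.1# R.* X.coeff (k ℤ.- 1ℤ) p         ≈⟨ R.*-identityˡ _ ⟩
    X.coeff (k ℤ.- 1ℤ) p                  ≈⟨ p≃f (k ℤ.- 1ℤ) ⟩
    extend R f (k ℤ.- 1ℤ)                 ≈⟨ shifted k ⟩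
    extend R (S.var S.* f) k              ∎
    where
    shifted : ∀ k → extend R f (k ℤ.- 1ℤ) R.≈ extend R (S.var S.* f) k
    shifted (+ zero)  = R.sym (S.var-*-zero f)
    shifted (+ suc n) = R.sym (S.var-*-suc f n)
    shifted -[1+ n ]  = R.refl

  -- An identity travels between the rings by relating each of its sides to its counterpart.
  ∼⇒≈ : ∀ {F G f g} → F ∼ f → G ∼ g → f T.≈ g → F L.≈ G
  ∼⇒≈ F∼f G∼g f≈g n k = R.trans (F∼f n k) (R.trans (extend-cong R (λ i → f≈g i n) k) (R.sym (G∼g n k)))

  +-∼ : ∀ {F G f g} → F ∼ f → G ∼ g → (F L.+ G) ∼ (f T.+ g)
  +-∼ {F} {G} F∼f G∼g n = +-≃ {F n} {G n} (F∼f n) (G∼g n)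

  x̂ : L.Series
  x̂ = L.const (X.monomial 1ℤ R.1#)

  x-*-∼ : ∀ {F f} → F ∼ f → (x̂ L.* F) ∼ (T.var T.* f)
  x-*-∼ {F} {f} F∼f n k = begin
    X.coeff k ((x̂ L.* F) n)                        ≈⟨ L.const-* (X.monomial 1ℤ R.1#) F n k ⟩
    X.coeff k (X.monomial 1ℤ R.1# X.* F n)         ≈⟨ x-*-≃ {F n} (F∼f n) k ⟩
    extend R (S.var S.* (λ i → f i n)) k           ≈⟨ extend-cong R var-* k ⟩
    extend R (λ i → (T.var T.* f) i n) k           ∎
    where
    var-* : S.var S.* (λ i → f i n) S.≈ (λ i → (T.var T.* f) i n)
    var-* zero    = R.trans (S.var-*-zero (λ i → f i n)) (R.sym (R.trans (T.var-*-zero f n) (S.const-0 n)))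
    var-* (suc i) = R.trans (S.var-*-suc (λ i → f i n) i) (R.sym (T.var-*-suc f i n))

  t-*-∼ : ∀ {F f} → F ∼ f → (L.var L.* F) ∼ (T.const S.var T.* f)
  t-*-∼ {F} {f} F∼f zero k = R.trans (L.var-*-zero F k)
    (0-≃ {λ i → (T.const S.var T.* f) i 0}
      (λ i → R.trans (T.const-* S.var f i 0) (R.trans (S.var-*-zero (f i)) (R.sym (S.const-0 i)))) k)
  t-*-∼ {F} {f} F∼f (suc n) k = R.trans (L.var-*-suc F n k)
    (≃-resp-≈ {F n} (λ i → R.sym (R.trans (T.const-* S.var f i (suc n)) (S.var-*-suc (f i) n))) (F∼f n) k)

  x-∼ : x̂ ∼ T.var
  x-∼ zero    = ≃-resp-≈ {X.monomial 1ℤ R.1#} (λ { 0 → R.refl ; 1 → R.refl ; (suc (suc i)) → R.refl }) x-≃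
  x-∼ (suc n) = 0-≃ {λ i → T.var i (suc n)} (λ { 0 → R.refl ; 1 → R.refl ; (suc (suc i)) → R.refl })

  const-∼ : ∀ f → (λ n → X.monomial 0ℤ (f n)) ∼ T.const f
  const-∼ f n = ≃-resp-≈ {X.monomial 0ℤ (f n)} (λ { zero → R.refl ; (suc i) → R.sym (S.const-0 n) }) (const-≃ (f n))

  *-coeff-zero : ∀ f g i → (f T.* g) i 0 R.≈ ((λ j → f j 0) S.* (λ j → g j 0)) i
  *-coeff-zero f g zero    = R.+-congʳ (R.+-identityʳ _)
  *-coeff-zero f g (suc i) = R.+-cong (R.+-identityʳ _) (*-coeff-zero (T.tail f) g i)

  -- The product in R⟦t⟧⟦x⟧ unfolds along x. This regroups it along the power of t in the left
  -- factor, the order in which the product in R[x,x⁻¹]⟦t⟧ unfolds.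
  *-coeff-suc : ∀ f g n i → (f T.* g) i (suc n) R.≈
    ((λ j → f j 0) S.* (λ j → g j (suc n))) i R.+ ((λ j → S.tail (f j)) T.* g) i n
  *-coeff-suc f g n zero = begin
    f 0 0 R.* g 0 (suc n) R.+ (S.tail (f 0) S.* g 0) n R.+ R.0#
      ≈⟨ solve 2 (λ a b → a :+ b :+ con 0ℤ := (a :+ con 0ℤ) :+ (b :+ con 0ℤ)) R.refl (f 0 0 R.* g 0 (suc n)) ((S.tail (f 0) S.* g 0) n) ⟩
    (f 0 0 R.* g 0 (suc n) R.+ R.0#) R.+ ((S.tail (f 0) S.* g 0) n R.+ R.0#)
      ≈⟨ R.+-congˡ (R.+-congˡ (S.const-0 n)) ⟨
    (f 0 0 R.* g 0 (suc n) R.+ R.0#) R.+ ((S.tail (f 0) S.* g 0) n R.+ S.0# n) ∎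
    where open IntegerCoefficients R
  *-coeff-suc f g n (suc i) = begin
    (f 0 0 R.* g (suc i) (suc n) R.+ (S.tail (f 0) S.* g (suc i)) n) R.+ (T.tail f T.* g) i (suc n)
      ≈⟨ R.+-congˡ (*-coeff-suc (T.tail f) g n i) ⟩
    (f 0 0 R.* g (suc i) (suc n) R.+ (S.tail (f 0) S.* g (suc i)) n) R.+ (A R.+ B)
      ≈⟨ solve 4 (λ a b x y → a :+ b :+ (x :+ y) := (a :+ x) :+ (b :+ y)) R.refl
           (f 0 0 R.* g (suc i) (suc n)) ((S.tail (f 0) S.* g (suc i)) n) A B ⟩
    (f 0 0 R.* g (suc i) (suc n) R.+ A) R.+ ((S.tail (f 0) S.* g (suc i)) n R.+ B) ∎
    where
    open IntegerCoefficients R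
    A = ((λ j → f (suc j) 0) S.* (λ j → g j (suc n))) i
    B = ((λ j → S.tail (f (suc j))) T.* g) i n

  -- The left factor is an explicit list because `coeff-*` sums over its entries; the number `N n`
  -- of entries may depend on the power of t.
  polynomial-*-∼ : ∀ N {f G g} → (∀ n {i} → N n ℕ.≤ i → f i n R.≈ R.0#) → G ∼ g →
    ((λ n → polynomial (N n) (λ i → f i n)) L.* G) ∼ (f T.* g)
  polynomial-*-∼ N {f} {G} {g} f≈0 G∼g zero k = begin
    X.coeff k (polynomial (N 0) (λ i → f i 0) X.* G 0 X.+ X.0#)
      ≈⟨ CommutativeRing.+-identityʳ X.commutativeRing (polynomial (N 0) (λ i → f i 0) X.* G 0) k ⟩
    X.coeff k (polynomial (N 0) (λ i → f i 0) X.* G 0)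
      ≈⟨ polynomial-*-≃ (N 0) {λ i → f i 0} {G 0} {λ i → g i 0} (f≈0 0) (G∼g 0) k ⟩
    extend R ((λ i → f i 0) S.* (λ i → g i 0)) k
      ≈⟨ extend-cong R (λ i → R.sym (*-coeff-zero f g i)) k ⟩
    extend R (λ i → (f T.* g) i 0) k ∎
  polynomial-*-∼ N {f} {G} {g} f≈0 G∼g (suc n) =
    ≃-resp-≈ {P₀ X.* G (suc n) X.+ (P′ L.* G) n} {λ i → ((λ j → f j 0) S.* (λ j → g j (suc n))) i R.+ ((λ j → S.tail (f j)) T.* g) i n}
      (λ i → R.sym (*-coeff-suc f g n i))
      (+-≃ {P₀ X.* G (suc n)} {(P′ L.* G) n} {(λ j → f j 0) S.* (λ j → g j (suc n))} {λ i → ((λ j → S.tail (f j)) T.* g) i n}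
        (polynomial-*-≃ (N 0) {λ i → f i 0} {G (suc n)} {λ i → g i (suc n)} (f≈0 0) (G∼g (suc n)))
        (polynomial-*-∼ (N ∘ suc) {λ j → S.tail (f j)} {G} {g} (λ n → f≈0 (suc n)) G∼g n))
    where
    P₀ : X.Polynomial
    P₀ = polynomial (N 0) (λ i → f i 0)
    P′ : L.Series
    P′ n = polynomial (N (suc n)) (λ i → f i (suc n))

  -- At tⁿ the series p has degree at most n in x, so it can be listed as a polynomial. The equation
  -- contains only products by t and x and the square of p, each of which respects the relation.
  Catalytic-transfer : ∀ {p p₀} → (∀ n {i} → n ℕ.< i → p i n R.≈ R.0#) →
    KrewerasAlgebra.Catalytic T.commutativeRing (T.const S.var) T.var p (T.const p₀) →
    KrewerasAlgebra.Catalytic L.commutativeRing L.var x̂ (λ n → polynomial (suc n) (λ i → p i n)) (λ n → X.monomial 0ℤ (p₀ n))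
  Catalytic-transfer {p} {p₀} p≈0 eq =
    ∼⇒≈ {x̂ L.* P L.+ (tP₀ L.+ tP₀)} {x̂ L.+ t²x²P² L.+ (tP L.+ tP)}
      {T.var T.* p T.+ (tp₀ T.+ tp₀)} {T.var T.+ t²x²p² T.+ (tp T.+ tp)}
      (+-∼ {x̂ L.* P} {tP₀ L.+ tP₀} {T.var T.* p} {tp₀ T.+ tp₀} (x-*-∼ {P} {p} P∼p) (+-∼ {tP₀} {tP₀} {tp₀} {tp₀} tP₀∼ tP₀∼))
      (+-∼ {x̂ L.+ t²x²P²} {tP L.+ tP} {T.var T.+ t²x²p²} {tp T.+ tp}
        (+-∼ {x̂} {t²x²P²} {T.var} {t²x²p²} x-∼ t²x²P²∼) (+-∼ {tP} {tP} {tp} {tp} tP∼ tP∼))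
      eq
    where
    t̂ tp tp₀ t²x²p² : T.Series
    t̂      = T.const S.var
    tp     = t̂ T.* p
    tp₀    = t̂ T.* T.const p₀
    t²x²p² = t̂ T.* (t̂ T.* (T.var T.* (T.var T.* (p T.* p))))
    P P₀ tP tP₀ t²x²P² : L.Series
    P n    = polynomial (suc n) (λ i → p i n)
    P₀ n   = X.monomial 0ℤ (p₀ n)
    tP     = L.var L.* P
    tP₀    = L.var L.* P₀
    t²x²P² = L.var L.* (L.var L.* (x̂ L.* (x̂ L.* (P L.* P))))
    P∼p : P ∼ p
    P∼p n = polynomial-≃ (suc n) {λ i → p i n} (p≈0 n)
    tP∼ : tP ∼ tp
    tP∼ = t-*-∼ {P} {p} P∼p
    tP₀∼ : tP₀ ∼ tp₀
    tP₀∼ = t-*-∼ {P₀} {T.const p₀} (const-∼ p₀)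
    t²x²P²∼ : t²x²P² ∼ t²x²p²
    t²x²P²∼ = t-*-∼ {L.var L.* (x̂ L.* (x̂ L.* (P L.* P)))} {t̂ T.* (T.var T.* (T.var T.* (p T.* p)))}
      (t-*-∼ {x̂ L.* (x̂ L.* (P L.* P))} {T.var T.* (T.var T.* (p T.* p))}
        (x-*-∼ {x̂ L.* (P L.* P)} {T.var T.* (p T.* p)} (x-*-∼ {P L.* P} {p T.* p}
          (polynomial-*-∼ suc {p} {P} {p} p≈0 P∼p))))

  monomial-isHom : IsHom R X.commutativeRing (X.monomial 0ℤ)
  monomial-isHom = isHom R X.commutativeRing
    (λ {r} {s} r≈s k → R.trans (const-≃ r k) (R.trans (extend-cong R (⟦⟧-cong r≈s) k) (R.sym (const-≃ s k))))
    (λ r s k → R.trans (const-≃ (r R.+ s) k) (R.trans (extend-cong R (+-homo r s) k)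
      (R.sym (+-≃ {X.monomial 0ℤ r} {X.monomial 0ℤ s} {S.const r} {S.const s} (const-≃ r) (const-≃ s) k))))
    (λ r s k → R.refl)
    (λ r k → R.refl)
    (λ k → R.trans (const-≃ R.0# k) (R.sym (0-≃ {S.const R.0#} (λ _ → R.refl) k)))
    (λ k → R.refl)
    where open IsRingHomomorphism (const-isHom R)

-- The derivation t d/dt and the Catalan convolution

module Derivation (R : CommutativeRing c ℓ) where
  private module R = CommutativeRing R
  open PowerSeriesRing R
  open IntegerCoefficients R
  open RingLemmas R
  open SetoidReasoning R.setoid

  -- The derivation is t d/dt rather than d/dt, so that the index does not move.
  θ : Series → Series
  θ f n = fromℤ (+ n) R.* f n

  fromℤ-suc : ∀ n → fromℤ (+ suc n) R.≈ R.1# R.+ fromℤ (+ n)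
  fromℤ-suc n = fromℤ-+ 1ℤ (+ n)

  θ-* : ∀ f g → θ (f * g) ≈ θ f * g + f * θ g
  θ-* f g zero    = solve 2 (λ a b → con 0ℤ :* (a :* b :+ con 0ℤ) := (con 0ℤ :* a :* b :+ con 0ℤ) :+ (a :* (con 0ℤ :* b) :+ con 0ℤ))
    R.refl (f 0) (g 0)
  θ-* f g (suc n) = begin
    fromℤ (+ suc n) R.* (f 0 R.* g (suc n) R.+ (tail f * g) n)
      ≈⟨ solve 4 (λ s a b x → s :* (a :* b :+ x) := a :* (s :* b) :+ s :* x)
           R.refl (fromℤ (+ suc n)) (f 0) (g (suc n)) ((tail f * g) n) ⟩
    f 0 R.* θ g (suc n) R.+ fromℤ (+ suc n) R.* (tail f * g) n
      ≈⟨ R.+-congˡ (R.*-congʳ (fromℤ-suc n)) ⟩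
    f 0 R.* θ g (suc n) R.+ (R.1# R.+ fromℤ (+ n)) R.* (tail f * g) n
      ≈⟨ solve 3 (λ a s x → a :+ (con 1ℤ :+ s) :* x := a :+ x :+ s :* x)
           R.refl (f 0 R.* θ g (suc n)) (fromℤ (+ n)) ((tail f * g) n) ⟩
    f 0 R.* θ g (suc n) R.+ (tail f * g) n R.+ θ (tail f * g) n
      ≈⟨ R.+-congˡ (θ-* (tail f) g n) ⟩
    f 0 R.* θ g (suc n) R.+ (tail f * g) n R.+ ((θ (tail f) * g) n R.+ (tail f * θ g) n)
      ≈⟨ solve 6 (λ a b x y z w → a :+ x :+ (y :+ z) := (con 0ℤ :* b :* w :+ (x :+ y)) :+ (a :+ z))
           R.refl (f 0 R.* θ g (suc n)) (f 0) ((tail f * g) n) ((θ (tail f) * g) n) ((tail f * θ g) n) (g (suc n)) ⟩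
    (R.0# R.* f 0 R.* g (suc n) R.+ ((tail f * g) n R.+ (θ (tail f) * g) n)) R.+ (f * θ g) (suc n)
      ≈⟨ R.+-congʳ (R.+-congˡ (distribʳ g (tail f) (θ (tail f)) n)) ⟨
    (R.0# R.* f 0 R.* g (suc n) R.+ ((tail f + θ (tail f)) * g) n) R.+ (f * θ g) (suc n)
      ≈⟨ R.+-congʳ (R.+-congˡ (*-cong {g = g} tail-θ (λ _ → R.refl) n)) ⟨
    (θ f * g) (suc n) R.+ (f * θ g) (suc n) ∎
    where
    tail-θ : tail (θ f) ≈ tail f + θ (tail f)
    tail-θ k = R.trans (R.*-congʳ (fromℤ-suc k))
      (solve 2 (λ s a → (con 1ℤ :+ s) :* a := a :+ s :* a) R.refl (fromℤ (+ k)) (f (suc k)))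

  θ-square : ∀ f n → fromℤ (+ n) R.* (f * f) n R.≈ fromℤ (+ 2) R.* (θ f * f) n
  θ-square f n = begin
    fromℤ (+ n) R.* (f * f) n          ≈⟨ θ-* f f n ⟩
    (θ f * f) n R.+ (f * θ f) n        ≈⟨ R.+-congˡ (*-comm f (θ f) n) ⟩
    (θ f * f) n R.+ (θ f * f) n        ≈⟨ solve 1 (λ a → a :+ a := con (+ 2) :* a) R.refl ((θ f * f) n) ⟩
    fromℤ (+ 2) R.* (θ f * f) n        ∎

  -- With S = f², the hypothesis and θ S = 2 f θ f give (n + 3) Sₙ₊₁ = 2 fₙ₊₁ + 4 (n + 1) Sₙ.
  catalan-square : ∀ f → f 0 R.≈ R.1# → f 1 R.≈ R.1# →
    (∀ n → fromℤ (+ (2 ℕ.+ n)) R.* f (suc n) R.≈ (fromℤ (+ 4) R.* fromℤ (+ n) R.+ fromℤ (+ 2)) R.* f n) →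
    (∀ n → Regular R (fromℤ (+ suc n))) →
    ∀ n → (f * f) n R.≈ f (suc n)
  catalan-square f f₀ f₁ rec reg zero = begin
    f 0 R.* f 0 R.+ R.0#  ≈⟨ R.+-identityʳ _ ⟩
    f 0 R.* f 0           ≈⟨ R.*-cong f₀ f₀ ⟩
    R.1# R.* R.1#         ≈⟨ R.*-identityˡ _ ⟩
    R.1#                  ≈⟨ f₁ ⟨
    f 1                   ∎
  catalan-square f f₀ f₁ rec reg (suc n) = x-y≈0⇒x≈y (reg (2 ℕ.+ n) (begin
    fromℤ (+ (3 ℕ.+ n)) R.* (S′ R.- F″)
      ≈⟨ solve 6 (λ s₃ s S S′ F′ F″ → s₃ :* (S′ :- F″) :=
           con 0ℤ :+ con 1ℤ :* ((con (+ 3) :+ s) :* S′ :- (con (+ 4) :* ((con 1ℤ :+ s) :* S) :+ con (+ 2) :* F′))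
             :+ con (+ 4) :* (con 1ℤ :+ s) :* (S :- F′)
             :+ :- con 1ℤ :* (s₃ :* F″ :- (con (+ 4) :* (con 1ℤ :+ s) :+ con (+ 2)) :* F′)
             :+ S′ :* (s₃ :- (con (+ 3) :+ s)))
           R.refl (fromℤ (+ (3 ℕ.+ n))) (fromℤ (+ n)) S S′ F′ F″ ⟩
    R.0# R.+ _ R.* _ R.+ _ R.* _ R.+ _ R.* _ R.+ _ R.* _  ≈⟨ +-vanishing _ _ (fromℤ-+ (+ 3) (+ n)) ⟩
    R.0# R.+ _ R.* _ R.+ _ R.* _ R.+ _ R.* _
      ≈⟨ +-vanishing _ _ (R.trans (rec (suc n)) (R.*-congʳ (R.+-congʳ (R.*-congˡ (fromℤ-suc n))))) ⟩
    R.0# R.+ _ R.* _ R.+ _ R.* _                          ≈⟨ +-vanishing _ _ (catalan-square f f₀ f₁ rec reg n) ⟩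
    R.0# R.+ _ R.* _                                      ≈⟨ +-vanishing _ _ recurrence ⟩
    R.0#                                                  ∎))
    where
    S S′ F′ F″ T T′ : R.Carrier
    S  = (f * f) n
    S′ = (f * f) (suc n)
    F′ = f (suc n)
    F″ = f (2 ℕ.+ n)
    T  = (θ f * f) n
    T′ = (θ f * f) (suc n)
    -- The recurrence of `f` read as an identity of series; convolving it with `f` gives `T′+S′`.
    rec′ : ∀ k → tail (θ f) k R.+ tail f k R.≈ fromℤ (+ 4) R.* θ f k R.+ fromℤ (+ 2) R.* f k
    rec′ k = begin
      fromℤ (+ suc k) R.* f (suc k) R.+ f (suc k)
        ≈⟨ solve 2 (λ s a → s :* a :+ a := (con 1ℤ :+ s) :* a) R.refl (fromℤ (+ suc k)) (f (suc k)) ⟩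
      (R.1# R.+ fromℤ (+ suc k)) R.* f (suc k)  ≈⟨ R.*-congʳ (fromℤ-suc (suc k)) ⟨
      fromℤ (+ (2 ℕ.+ k)) R.* f (suc k)         ≈⟨ rec k ⟩
      (fromℤ (+ 4) R.* fromℤ (+ k) R.+ fromℤ (+ 2)) R.* f k
        ≈⟨ solve 2 (λ s a → (con (+ 4) :* s :+ con (+ 2)) :* a := con (+ 4) :* (s :* a) :+ con (+ 2) :* a) R.refl (fromℤ (+ k)) (f k) ⟩
      fromℤ (+ 4) R.* θ f k R.+ fromℤ (+ 2) R.* f k ∎
    T′+S′ : T′ R.+ S′ R.≈ fromℤ (+ 4) R.* T R.+ fromℤ (+ 2) R.* S R.+ F′
    T′+S′ = begin
      T′ R.+ S′
        ≈⟨ solve 4 (λ a b x y → (con 0ℤ :* a :* b :+ x) :+ (a :* b :+ y) := (x :+ y) :+ a :* b)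
             R.refl (f 0) (f (suc n)) ((tail (θ f) * f) n) ((tail f * f) n) ⟩
      (tail (θ f) * f) n R.+ (tail f * f) n R.+ f 0 R.* F′
        ≈⟨ R.+-cong (distribʳ f (tail (θ f)) (tail f) n) (R.trans (R.sym (R.*-identityˡ F′)) (R.*-congʳ (R.sym f₀))) ⟨
      ((tail (θ f) + tail f) * f) n R.+ F′
        ≈⟨ R.+-congʳ (*-cong {g = f} rec′ (λ _ → R.refl) n) ⟩
      (((λ k → fromℤ (+ 4) R.* θ f k) + (λ k → fromℤ (+ 2) R.* f k)) * f) n R.+ F′
        ≈⟨ R.+-congʳ (distribʳ f (λ k → fromℤ (+ 4) R.* θ f k) (λ k → fromℤ (+ 2) R.* f k) n) ⟩
      ((λ k → fromℤ (+ 4) R.* θ f k) * f) n R.+ ((λ k → fromℤ (+ 2) R.* f k) * f) n R.+ F′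
        ≈⟨ R.+-congʳ (R.+-cong (scale-* (fromℤ (+ 4)) (θ f) f n) (scale-* (fromℤ (+ 2)) f f n)) ⟩
      fromℤ (+ 4) R.* T R.+ fromℤ (+ 2) R.* S R.+ F′ ∎
    recurrence : (fromℤ (+ 3) R.+ fromℤ (+ n)) R.* S′ R.≈
      fromℤ (+ 4) R.* ((R.1# R.+ fromℤ (+ n)) R.* S) R.+ fromℤ (+ 2) R.* F′
    recurrence = x-y≈0⇒x≈y (begin
      (fromℤ (+ 3) R.+ fromℤ (+ n)) R.* S′ R.- (fromℤ (+ 4) R.* ((R.1# R.+ fromℤ (+ n)) R.* S) R.+ fromℤ (+ 2) R.* F′)
        ≈⟨ solve 6 (λ s S S′ F′ T T′ →
             (con (+ 3) :+ s) :* S′ :- (con (+ 4) :* ((con 1ℤ :+ s) :* S) :+ con (+ 2) :* F′)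
             := con 0ℤ :+ con (+ 2) :* ((T′ :+ S′) :- (con (+ 4) :* T :+ con (+ 2) :* S :+ F′))
               :+ :- con (+ 4) :* (s :* S :- con (+ 2) :* T)
               :+ con 1ℤ :* ((con 1ℤ :+ s) :* S′ :- con (+ 2) :* T′))
             R.refl (fromℤ (+ n)) S S′ F′ T T′ ⟩
      R.0# R.+ _ R.* _ R.+ _ R.* _ R.+ _ R.* _
        ≈⟨ +-vanishing _ _ (R.trans (R.*-congʳ (R.sym (fromℤ-suc n))) (θ-square f (suc n))) ⟩
      R.0# R.+ _ R.* _ R.+ _ R.* _  ≈⟨ +-vanishing _ _ (θ-square f n) ⟩
      R.0# R.+ _ R.* _              ≈⟨ +-vanishing _ _ T′+S′ ⟩
      R.0#                          ∎)

open ≡ using (refl; cong₂; sym; trans; subst; module ≡-Reasoning)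

-- Counting walks by their last step

module _ {a p q} {A : Set a} {P : Pred A p} {Q : Pred A q} (P? : Decidable P) (Q? : Decidable Q) where

  length-filter-cong : (∀ x → does (P? x) ≡ does (Q? x)) → ∀ xs → length (filter P? xs) ≡ length (filter Q? xs)
  length-filter-cong eq []       = refl
  length-filter-cong eq (x ∷ xs) with does (P? x) | does (Q? x) | eq x
  ... | false | false | refl = length-filter-cong eq xs
  ... | true  | true  | refl = cong suc (length-filter-cong eq xs)

length-filter-map : ∀ {a b p} {A : Set a} {B : Set b} {P : Pred B p} (P? : Decidable P) (f : A → B) xs →
  length (filter P? (map f xs)) ≡ length (filter (P? ∘ f) xs)
length-filter-map P? f []       = refl
length-filter-map P? f (x ∷ xs) with does (P? (f x))
... | false = length-filter-map P? f xs
... | true  = cong suc (length-filter-map P? f xs)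

length-filter-none : ∀ {a p} {A : Set a} {P : Pred A p} (P? : Decidable P) →
  (∀ x → does (P? x) ≡ false) → ∀ xs → length (filter P? xs) ≡ 0
length-filter-none P? none []       = refl
length-filter-none P? none (x ∷ xs) with does (P? x) | none x
... | false | refl = length-filter-none P? none xs

inQuadrant? : ∀ p → Dec (InQuadrant p)
inQuadrant? (i , j) = (0ℤ ℤ.≤? i) ×-dec (0ℤ ℤ.≤? j)

_≟ᴾ_ : (p q : Point) → Dec (p ≡ q)
_≟ᴾ_ = ≡-dec ℤ._≟_ ℤ._≟_

𝟙 : Bool → ℕ
𝟙 b = if b then 1 else 0

χ : Point → ℕ
χ p = 𝟙 (does (inQuadrant? p))

overSteps : (Step → ℕ) → ℕ
overSteps f = f south ℕ.+ (f west ℕ.+ f north-east)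

-- It follows `stepSequences` in splitting off the first step, which requires an arbitrary starting
-- point.
walksFrom : Point → ℕ → Point → ℕ
walksFrom p zero    q = χ p ℕ.* 𝟙 (does (p ≟ᴾ q))
walksFrom p (suc n) q = χ p ℕ.* overSteps (λ s → walksFrom (move p s) n q)

-- At `origin` this computes to `walkTo?`, whose fixed starting point does not allow recursion.
walkFrom? : ∀ p q w → Dec (All InQuadrant (scanl move p w) × foldl move p w ≡ q)
walkFrom? p q w = all? inQuadrant? (scanl move p w) ×-dec (foldl move p w ≟ᴾ q)

length-filter-walkFrom : ∀ p q n → length (filter (walkFrom? p q) (stepSequences n)) ≡ walksFrom p n q
length-filter-walkFrom p q zero with does (inQuadrant? p)
... | false = refl
... | true with does (p ≟ᴾ q)
...   | false = refl
...   | true  = refl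
length-filter-walkFrom p q (suc n) = begin
  length (filter W (σ ++ (ω ++ (ν ++ []))))
    ≡⟨ length-filter-++ σ (ω ++ (ν ++ [])) ⟩
  # σ ℕ.+ # (ω ++ (ν ++ []))
    ≡⟨ cong (# σ ℕ.+_) (trans (length-filter-++ ω (ν ++ [])) (cong (# ω ℕ.+_) (trans (length-filter-++ ν []) (ℕ.+-identityʳ _)))) ⟩
  # σ ℕ.+ (# ω ℕ.+ # ν)
    ≡⟨ cong₂ ℕ._+_ (first south) (cong₂ ℕ._+_ (first west) (first north-east)) ⟩
  χ p ℕ.* walks south ℕ.+ (χ p ℕ.* walks west ℕ.+ χ p ℕ.* walks north-east)
    ≡⟨ solve 4 (λ c a b d → c :* a :+ (c :* b :+ c :* d) := c :* (a :+ (b :+ d))) refl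
         (χ p) (walks south) (walks west) (walks north-east) ⟩
  χ p ℕ.* overSteps walks ∎
  where
  open ≡-Reasoning
  open +-*-Solver
  W = walkFrom? p q
  # : List (List Step) → ℕ
  # = length ∘ filter W
  σ = map (south ∷_) (stepSequences n)
  ω = map (west ∷_) (stepSequences n)
  ν = map (north-east ∷_) (stepSequences n)
  walks : Step → ℕ
  walks s = walksFrom (move p s) n q
  length-filter-++ : ∀ xs ys → # (xs ++ ys) ≡ # xs ℕ.+ # ys
  length-filter-++ xs ys = trans (cong length (filter-++ W xs ys)) (length-++ (filter W xs))
  first : ∀ s → # (map (s ∷_) (stepSequences n)) ≡ χ p ℕ.* walks s
  first s = trans (length-filter-map W (s ∷_) (stepSequences n)) (filtered (does (inQuadrant? p)) refl)
    where
    -- The value of `does (inQuadrant? p)` is made a variable with an equation, so that it can be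
    -- substituted inside the test of each extended walk.
    filtered : ∀ b → does (inQuadrant? p) ≡ b →
      length (filter (W ∘ (s ∷_)) (stepSequences n)) ≡ 𝟙 b ℕ.* walks s
    filtered false eq = length-filter-none (W ∘ (s ∷_)) (λ w → does-false w) (stepSequences n)
      where
      does-false : ∀ w → does (W (s ∷ w)) ≡ false
      does-false w = cong (λ b → (b ∧ does (all? inQuadrant? (scanl move (move p s) w))) ∧ does (foldl move (move p s) w ≟ᴾ q)) eq
    filtered true eq = trans
      (length-filter-cong (W ∘ (s ∷_)) (walkFrom? (move p s) q) does-eq (stepSequences n))
      (trans (length-filter-walkFrom (move p s) q n) (sym (ℕ.+-identityʳ _)))
      where
      does-eq : ∀ w → does (W (s ∷ w)) ≡ does (walkFrom? (move p s) q w)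
      does-eq w = cong (λ b → (b ∧ does (all? inQuadrant? (scanl move (move p s) w))) ∧ does (foldl move (move p s) w ≟ᴾ q)) eq

unmove : Point → Step → Point
unmove (i , j) south      = i , ℤ.suc j
unmove (i , j) west       = ℤ.suc i , j
unmove (i , j) north-east = ℤ.pred i , ℤ.pred j

unmove-move : ∀ p s → unmove (move p s) s ≡ p
unmove-move (i , j) south      = ×-≡,≡→≡ (ℤ.+-identityʳ i , trans (cong (λ k → 1ℤ ℤ.+ k) (ℤ.+-comm j -1ℤ)) (ℤ.suc-pred j))
unmove-move (i , j) west       = ×-≡,≡→≡ (trans (cong (λ k → 1ℤ ℤ.+ k) (ℤ.+-comm i -1ℤ)) (ℤ.suc-pred i) , ℤ.+-identityʳ j)
unmove-move (i , j) north-east = ×-≡,≡→≡ (pred-+1 i , pred-+1 j)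
  where
  pred-+1 : ∀ i → ℤ.pred (i ℤ.+ 1ℤ) ≡ i
  pred-+1 i = trans (cong (λ k → -1ℤ ℤ.+ k) (ℤ.+-comm i 1ℤ)) (ℤ.pred-suc i)

move-unmove : ∀ p s → move (unmove p s) s ≡ p
move-unmove (i , j) south      = ×-≡,≡→≡ (ℤ.+-identityʳ i , trans (ℤ.+-comm (ℤ.suc j) -1ℤ) (ℤ.pred-suc j))
move-unmove (i , j) west       = ×-≡,≡→≡ (trans (ℤ.+-comm (ℤ.suc i) -1ℤ) (ℤ.pred-suc i) , ℤ.+-identityʳ j)
move-unmove (i , j) north-east = ×-≡,≡→≡ (+1-pred i , +1-pred j)
  where
  +1-pred : ∀ i → ℤ.pred i ℤ.+ 1ℤ ≡ i
  +1-pred i = trans (ℤ.+-comm (ℤ.pred i) 1ℤ) (ℤ.suc-pred i)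

-- Both indicators test whether `s` leads from `p` to `q`, and when it does, `move p s` and `q` are
-- the same point for `χ`.
one-step : ∀ p q s → χ (move p s) ℕ.* 𝟙 (does (move p s ≟ᴾ q)) ≡ χ q ℕ.* 𝟙 (does (p ≟ᴾ unmove q s))
one-step p q s with move p s ≟ᴾ q | p ≟ᴾ unmove q s
... | yes refl | yes _    = refl
... | yes refl | no p≢    = contradiction (sym (unmove-move p s)) p≢
... | no ≢q    | yes refl = contradiction (move-unmove q s) ≢q
... | no _     | no _     = trans (ℕ.*-zeroʳ (χ (move p s))) (sym (ℕ.*-zeroʳ (χ q)))

-- Step sequences grow at the front, while the functional equation removes the last step. The
-- induction interchanges the sum over first steps with the sum over last steps.
walksFrom-last : ∀ p n q → walksFrom p (suc n) q ≡ χ q ℕ.* overSteps (λ s → walksFrom p n (unmove q s))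
walksFrom-last p zero q
  rewrite one-step p q south | one-step p q west | one-step p q north-east =
  solve 5 (λ a b c d e → a :* (b :* c :+ (b :* d :+ b :* e)) := b :* (a :* c :+ (a :* d :+ a :* e))) refl
    (χ p) (χ q) _ _ _
  where open +-*-Solver
walksFrom-last p (suc n) q
  rewrite walksFrom-last (move p south) n q | walksFrom-last (move p west) n q | walksFrom-last (move p north-east) n q =
  solve 11 (λ a b c₁ c₂ c₃ d₁ d₂ d₃ e₁ e₂ e₃ →
      a :* (b :* (c₁ :+ (c₂ :+ c₃)) :+ (b :* (d₁ :+ (d₂ :+ d₃)) :+ b :* (e₁ :+ (e₂ :+ e₃)))) :=
      b :* (a :* (c₁ :+ (d₁ :+ e₁)) :+ (a :* (c₂ :+ (d₂ :+ e₂)) :+ a :* (c₃ :+ (d₃ :+ e₃))))) refl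
    (χ p) (χ q) (w south south) (w south west) (w south north-east) (w west south) (w west west) (w west north-east)
    (w north-east south) (w north-east west) (w north-east north-east)
  where
  open +-*-Solver
  w : Step → Step → ℕ
  w s s′ = walksFrom (move p s) n (unmove q s′)

walksFrom-outside : ∀ p n q → χ q ≡ 0 → walksFrom p n q ≡ 0
walksFrom-outside p zero q χq≡0 with p ≟ᴾ q
... | yes refl rewrite χq≡0 = refl
... | no _     = ℕ.*-zeroʳ (χ p)
walksFrom-outside p (suc n) q χq≡0 =
  trans (walksFrom-last p n q) (cong (ℕ._* overSteps (λ s → walksFrom p n (unmove q s))) χq≡0)

a≡walksFrom : ∀ i j n → a[ i , j ] n ≡ walksFrom origin n (+ i , + j)
a≡walksFrom i j n = length-filter-walkFrom origin (+ i , + j) n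

diagonal : (ℕ → ℕ → ℕ) → ℕ → ℕ → ℕ
diagonal f (suc i) (suc j) = f i j
diagonal f _       _       = 0

a-suc : ∀ i j n → a[ i , j ] (suc n) ≡
  a[ i , suc j ] n ℕ.+ (a[ suc i , j ] n ℕ.+ diagonal (λ i j → a[ i , j ] n) i j)
a-suc i j n = begin
  a[ i , j ] (suc n)  ≡⟨ a≡walksFrom i j (suc n) ⟩
  walksFrom origin (suc n) (+ i , + j) ≡⟨ walksFrom-last origin n (+ i , + j) ⟩
  -- `χ` computes to 1 at a point with coordinates `+ i` and `+ j`.
  1 ℕ.* overSteps walks                ≡⟨ ℕ.*-identityˡ _ ⟩
  overSteps walks
    ≡⟨ cong₂ ℕ._+_ (a≡walksFrom i (suc j) n) (cong₂ ℕ._+_ (a≡walksFrom (suc i) j n) (sym (diag i j))) ⟨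
  a[ i , suc j ] n ℕ.+ (a[ suc i , j ] n ℕ.+ diagonal (λ i j → a[ i , j ] n) i j) ∎
  where
  open ≡-Reasoning
  walks : Step → ℕ
  walks s = walksFrom origin n (unmove (+ i , + j) s)
  diag : ∀ i j → walksFrom origin n (unmove (+ i , + j) north-east) ≡ diagonal (λ i j → a[ i , j ] n) i j
  diag zero    j       = walksFrom-outside origin n _ refl
  diag (suc i) zero    = walksFrom-outside origin n (+ i , -1ℤ) refl
  diag (suc i) (suc j) = sym (a≡walksFrom i j n)

-- Only the north-east step raises the abscissa, and by one. This is why the n + 1 terms of `Q[x,0]`
-- at tⁿ are all of them.
a-bounded : ∀ n {i} j → n ℕ.< i → a[ i , j ] n ≡ 0
a-bounded zero    {suc i} j 0<i       = refl
a-bounded (suc n) {suc i} j (s≤s n<i) = begin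
  a[ suc i , j ] (suc n)  ≡⟨ a-suc (suc i) j n ⟩
  a[ suc i , suc j ] n ℕ.+ (a[ suc (suc i) , j ] n ℕ.+ diagonal (λ i j → a[ i , j ] n) (suc i) j)
    ≡⟨ cong₂ ℕ._+_ (a-bounded n (suc j) (ℕ.m<n⇒m<1+n n<i))
         (cong₂ ℕ._+_ (a-bounded n j (ℕ.m<n⇒m<1+n (ℕ.m<n⇒m<1+n n<i))) (diag j)) ⟩
  0 ∎
  where
  open ≡-Reasoning
  diag : ∀ j → diagonal (λ i j → a[ i , j ] n) (suc i) j ≡ 0
  diag zero    = refl
  diag (suc j) = a-bounded n j n<i

-- Binomial coefficients and the coefficients of the powers of W

absorption : ∀ n k → suc k ℕ.* (suc n C suc k) ≡ suc n ℕ.* (n C k)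
absorption zero zero    = refl
absorption zero (suc k) = trans (cong (suc (suc k) ℕ.*_) (k>n⇒nCk≡0 {1} {2 ℕ.+ k} (s≤s (s≤s z≤n))))
  (trans (ℕ.*-zeroʳ (2 ℕ.+ k)) (sym (cong (1 ℕ.*_) (k>n⇒nCk≡0 {0} {suc k} (s≤s z≤n)))))
absorption (suc n) zero = trans (ℕ.*-identityˡ _) (trans (nC1≡n (2 ℕ.+ n)) (sym (ℕ.*-identityʳ _)))
absorption (suc n) (suc k) = begin
  suc (suc k) ℕ.* (suc (suc n) C suc (suc k))
    ≡⟨ cong (suc (suc k) ℕ.*_) (nCk+nC[k+1]≡[n+1]C[k+1] (suc n) (suc k)) ⟨
  suc (suc k) ℕ.* (x ℕ.+ (suc n C suc (suc k)))
    ≡⟨ ℕ.*-distribˡ-+ (suc (suc k)) x _ ⟩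
  (x ℕ.+ suc k ℕ.* x) ℕ.+ suc (suc k) ℕ.* (suc n C suc (suc k))
    ≡⟨ cong₂ (λ a b → (x ℕ.+ a) ℕ.+ b) (absorption n k) (absorption n (suc k)) ⟩
  (x ℕ.+ suc n ℕ.* (n C k)) ℕ.+ suc n ℕ.* (n C suc k)
    ≡⟨ ℕ.+-assoc x _ _ ⟩
  x ℕ.+ (suc n ℕ.* (n C k) ℕ.+ suc n ℕ.* (n C suc k))
    ≡⟨ cong (x ℕ.+_) (ℕ.*-distribˡ-+ (suc n) (n C k) (n C suc k)) ⟨
  x ℕ.+ suc n ℕ.* ((n C k) ℕ.+ (n C suc k))
    ≡⟨ cong (λ y → x ℕ.+ suc n ℕ.* y) (nCk+nC[k+1]≡[n+1]C[k+1] n k) ⟩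
  suc (suc n) ℕ.* x ∎
  where
  open ≡-Reasoning
  x = suc n C suc k

-- The ratio of neighbours in a row of Pascal's triangle, with the factor n - k split to avoid
-- subtraction.
suc-k*nC[k+1] : ∀ n k → suc k ℕ.* (n C suc k) ℕ.+ suc k ℕ.* (n C k) ≡ suc n ℕ.* (n C k)
suc-k*nC[k+1] n k = begin
  suc k ℕ.* (n C suc k) ℕ.+ suc k ℕ.* (n C k)  ≡⟨ ℕ.*-distribˡ-+ (suc k) (n C suc k) (n C k) ⟨
  suc k ℕ.* ((n C suc k) ℕ.+ (n C k))          ≡⟨ cong (suc k ℕ.*_) (ℕ.+-comm (n C suc k) (n C k)) ⟩
  suc k ℕ.* ((n C k) ℕ.+ (n C suc k))          ≡⟨ cong (suc k ℕ.*_) (nCk+nC[k+1]≡[n+1]C[k+1] n k) ⟩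
  suc k ℕ.* (suc n C suc k)                    ≡⟨ absorption n k ⟩
  suc n ℕ.* (n C k)                            ∎
  where open ≡-Reasoning

-- The ratio of neighbours in a column of Pascal's triangle, with the factor n + 1 - k split to
-- avoid subtraction.
k*[n+1]Ck : ∀ n k → k ℕ.* (suc n C k) ℕ.+ suc n ℕ.* (n C k) ≡ suc n ℕ.* (suc n C k)
k*[n+1]Ck n zero    = refl
k*[n+1]Ck n (suc k) = begin
  suc k ℕ.* (suc n C suc k) ℕ.+ suc n ℕ.* (n C suc k)  ≡⟨ cong (ℕ._+ suc n ℕ.* (n C suc k)) (absorption n k) ⟩
  suc n ℕ.* (n C k) ℕ.+ suc n ℕ.* (n C suc k)          ≡⟨ ℕ.*-distribˡ-+ (suc n) (n C k) (n C suc k) ⟨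
  suc n ℕ.* ((n C k) ℕ.+ (n C suc k))                  ≡⟨ cong (suc n ℕ.*_) (nCk+nC[k+1]≡[n+1]C[k+1] n k) ⟩
  suc n ℕ.* (suc n C suc k)                            ∎
  where open ≡-Reasoning

central-binomial-suc : ∀ i → suc i ℕ.* ((2 ℕ.* suc i) C suc i) ≡ 2 ℕ.* suc (2 ℕ.* i) ℕ.* ((2 ℕ.* i) C i)
central-binomial-suc i = ℕ.*-cancelˡ-≡ _ _ (suc i) (begin
  suc i ℕ.* (suc i ℕ.* ((2 ℕ.* suc i) C suc i))
    ≡⟨ cong (λ k → suc i ℕ.* (suc i ℕ.* (k C suc i))) (ℕ.*-suc 2 i) ⟩
  suc i ℕ.* (suc i ℕ.* ((2 ℕ.+ m) C suc i))
    ≡⟨ cong (suc i ℕ.*_) (absorption (suc m) i) ⟩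
  suc i ℕ.* ((2 ℕ.+ m) ℕ.* (suc m C i))
    ≡⟨ solve 3 (λ s k b → s :* (k :* b) := k :* (s :* b)) refl (suc i) (2 ℕ.+ m) (suc m C i) ⟩
  (2 ℕ.+ m) ℕ.* (suc i ℕ.* (suc m C i))
    ≡⟨ cong ((2 ℕ.+ m) ℕ.*_) middle ⟩
  (2 ℕ.+ m) ℕ.* (suc m ℕ.* (m C i))
    ≡⟨ solve 2 (λ i b → (con 2 :+ con 2 :* i) :* ((con 1 :+ con 2 :* i) :* b)
         := (con 1 :+ i) :* (con 2 :* (con 1 :+ con 2 :* i) :* b)) refl i (m C i) ⟩
  suc i ℕ.* (2 ℕ.* suc m ℕ.* (m C i)) ∎)
  where
  open ≡-Reasoning
  open +-*-Solver
  m = 2 ℕ.* i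
  -- The symmetry between i and i + 1 in row 2i + 1, here obtained by cancellation from the ratio of
  -- these neighbours, followed by absorption.
  middle : suc i ℕ.* (suc m C i) ≡ suc m ℕ.* (m C i)
  middle = trans (sym (ℕ.+-cancelʳ-≡ (suc i ℕ.* (suc m C i)) _ _ (trans (suc-k*nC[k+1] (suc m) i)
      (solve 2 (λ i b → (con 2 :+ con 2 :* i) :* b := (con 1 :+ i) :* b :+ (con 1 :+ i) :* b) refl i (suc m C i)))))
    (absorption m i)

-- The coefficient of tᵐ in Wᵏ, read off Wᵏ⁺¹ = t (2 Wᵏ + Wᵏ⁺³).
W^-coeff : ℕ → ℕ → ℕ
W^-coeff zero    zero    = 1
W^-coeff zero    (suc m) = 0
W^-coeff (suc k) zero    = 0
W^-coeff (suc k) (suc m) = 2 ℕ.* W^-coeff k m ℕ.+ W^-coeff (3 ℕ.+ k) m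

W^-coeff-below : ∀ {k m} → m ℕ.< k → W^-coeff k m ≡ 0
W^-coeff-below {suc k} {zero}  _         = refl
W^-coeff-below {suc k} {suc m} (s≤s m<k)
  rewrite W^-coeff-below m<k | W^-coeff-below {3 ℕ.+ k} {m} (ℕ.m<n⇒m<1+n (ℕ.m<n⇒m<1+n (ℕ.m<n⇒m<1+n m<k))) = refl

W^-coeff-diagonal : ∀ k → W^-coeff k k ≡ 2 ℕ.^ k
W^-coeff-diagonal zero    = refl
W^-coeff-diagonal (suc k) rewrite W^-coeff-diagonal k | W^-coeff-below {3 ℕ.+ k} {k} (ℕ.m<n⇒m<1+n (ℕ.m<n⇒m<1+n (ℕ.n<1+n k))) =
  ℕ.+-identityʳ _

-- Lagrange inversion for W = t (2 + W³): the coefficient of tᵐ in Wᵏ is k/m times that of wᵐ⁻ᵏ in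
-- (2 + w³)ᵐ, where m - k = 3j and the remaining m - j = k + 2j factors contribute 2. It is verified
-- by induction on m along the recurrence.
W^-coeff-formula : ∀ m k j → m ≡ k ℕ.+ 3 ℕ.* j → m ℕ.* W^-coeff k m ≡ k ℕ.* ((m C j) ℕ.* 2 ℕ.^ (k ℕ.+ 2 ℕ.* j))
W^-coeff-formula zero    zero    j       _    = refl
W^-coeff-formula (suc m) zero    j       _    = ℕ.*-zeroʳ m
W^-coeff-formula (suc m) (suc k) zero    eq with refl ← trans (ℕ.suc-injective eq) (ℕ.+-identityʳ k) =
  cong (suc k ℕ.*_) (trans (W^-coeff-diagonal (suc k)) (sym (trans (ℕ.+-identityʳ _) (cong (2 ℕ.^_) (ℕ.+-identityʳ (suc k))))))
W^-coeff-formula (suc zero) (suc k) (suc j) eq with () ← trans (ℕ.suc-injective eq) (trans (cong (k ℕ.+_) (ℕ.*-suc 3 j)) (ℕ.+-suc k (2 ℕ.+ 3 ℕ.* j)))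
-- The induction hypotheses carry the factor `m`, so both sides are multiplied by it; it is nonzero
-- because 1 was treated apart.
W^-coeff-formula (suc m@(suc _)) (suc k) (suc j) eq = ℕ.*-cancelˡ-≡ _ _ m (begin
  m ℕ.* (suc m ℕ.* (2 ℕ.* W^-coeff k m ℕ.+ W^-coeff (3 ℕ.+ k) m))
    ≡⟨ solve 3 (λ m a b → m :* ((con 1 :+ m) :* (con 2 :* a :+ b)) := (con 1 :+ m) :* (con 2 :* (m :* a) :+ m :* b))
         refl m (W^-coeff k m) (W^-coeff (3 ℕ.+ k) m) ⟩
  suc m ℕ.* (2 ℕ.* (m ℕ.* W^-coeff k m) ℕ.+ m ℕ.* W^-coeff (3 ℕ.+ k) m)
    ≡⟨ cong₂ (λ a b → suc m ℕ.* (2 ℕ.* a ℕ.+ b)) (W^-coeff-formula m k (suc j) m≡) (W^-coeff-formula m (3 ℕ.+ k) j m≡′) ⟩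
  suc m ℕ.* (2 ℕ.* (k ℕ.* (b ℕ.* 2 ℕ.^ (k ℕ.+ 2 ℕ.* suc j))) ℕ.+ (3 ℕ.+ k) ℕ.* (b′ ℕ.* 2 ℕ.^ (3 ℕ.+ k ℕ.+ 2 ℕ.* j)))
    ≡⟨ cong₂ (λ a c → suc m ℕ.* (2 ℕ.* (k ℕ.* (b ℕ.* a)) ℕ.+ (3 ℕ.+ k) ℕ.* (b′ ℕ.* c))) (cong (2 ℕ.^_) e₁) (cong (2 ℕ.^_) e₂) ⟩
  suc m ℕ.* (2 ℕ.* (k ℕ.* (b ℕ.* E)) ℕ.+ (3 ℕ.+ k) ℕ.* (b′ ℕ.* (2 ℕ.* E)))
    ≡⟨ solve 5 (λ m k b b′ E → (con 1 :+ m) :* (con 2 :* (k :* (b :* E)) :+ (con 3 :+ k) :* (b′ :* (con 2 :* E)))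
         := (con 2 :* E) :* ((con 1 :+ m) :* k :* (b′ :+ b) :+ con 3 :* ((con 1 :+ m) :* b′))) refl m k b b′ E ⟩
  2 ℕ.* E ℕ.* (suc m ℕ.* k ℕ.* (b′ ℕ.+ b) ℕ.+ 3 ℕ.* (suc m ℕ.* b′))
    ≡⟨ cong₂ (λ x y → 2 ℕ.* E ℕ.* (suc m ℕ.* k ℕ.* x ℕ.+ 3 ℕ.* y)) (nCk+nC[k+1]≡[n+1]C[k+1] m j) (sym (absorption m j)) ⟩
  2 ℕ.* E ℕ.* (suc m ℕ.* k ℕ.* B ℕ.+ 3 ℕ.* (suc j ℕ.* B))
    ≡⟨ cong (λ m → 2 ℕ.* E ℕ.* (suc m ℕ.* k ℕ.* B ℕ.+ 3 ℕ.* (suc j ℕ.* B))) m≡ ⟩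
  2 ℕ.* E ℕ.* (suc (k ℕ.+ 3 ℕ.* suc j) ℕ.* k ℕ.* B ℕ.+ 3 ℕ.* (suc j ℕ.* B))
    -- With m = k + 3 (j + 1), the sum (m + 1) k + 3 (j + 1) factors as m (k + 1).
    ≡⟨ solve 4 (λ k j B E → con 2 :* E :* ((con 1 :+ (k :+ con 3 :* j)) :* k :* B :+ con 3 :* (j :* B))
         := (k :+ con 3 :* j) :* ((con 1 :+ k) :* (B :* (con 2 :* E)))) refl k (suc j) B E ⟩
  (k ℕ.+ 3 ℕ.* suc j) ℕ.* (suc k ℕ.* (B ℕ.* (2 ℕ.* E)))
    ≡⟨ cong₂ (λ m x → m ℕ.* (suc k ℕ.* (B ℕ.* (2 ℕ.* x)))) (sym m≡) (cong (2 ℕ.^_) (sym e₁)) ⟩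
  m ℕ.* (suc k ℕ.* (B ℕ.* 2 ℕ.^ (suc k ℕ.+ 2 ℕ.* suc j))) ∎)
  where
  open ≡-Reasoning
  open +-*-Solver
  b = m C suc j
  b′ = m C j
  B = suc m C suc j
  E = 2 ℕ.^ (2 ℕ.+ k ℕ.+ 2 ℕ.* j)
  m≡ : m ≡ k ℕ.+ 3 ℕ.* suc j
  m≡ = ℕ.suc-injective eq
  m≡′ : m ≡ 3 ℕ.+ k ℕ.+ 3 ℕ.* j
  m≡′ = trans m≡ (solve 2 (λ k j → k :+ con 3 :* (con 1 :+ j) := con 3 :+ k :+ con 3 :* j) refl k j)
  e₁ : k ℕ.+ 2 ℕ.* suc j ≡ 2 ℕ.+ k ℕ.+ 2 ℕ.* j
  e₁ = solve 2 (λ k j → k :+ con 2 :* (con 1 :+ j) := con 2 :+ k :+ con 2 :* j) refl k j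
  e₂ : 3 ℕ.+ k ℕ.+ 2 ℕ.* j ≡ suc (2 ℕ.+ k ℕ.+ 2 ℕ.* j)
  e₂ = refl

-- Rational numbers and Catalan numbers

private
  ℚ-ring = ℚ.+-*-commutativeRing
  module Q where
    open CommutativeRing ℚ-ring public
    open IntegerCoefficients ℚ-ring public
    open RingLemmas ℚ-ring public
  module KQ = KrewerasAlgebra ℚ-ring
  module P  = PowerSeriesRing ℚ-ring
  module P′ = CommutativeRing P.commutativeRing
  module KP = KrewerasAlgebra P.commutativeRing
  module S  = PowerSeriesRing P.commutativeRing
  module T  = PowerSeriesRing S.commutativeRing
  module X  = LaurentPolynomialRing ℚ-ring
  module 𝓛  = PowerSeriesRing X.commutativeRing
  module 𝓛′ = CommutativeRing 𝓛.commutativeRing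
  module KL = KrewerasAlgebra 𝓛.commutativeRing
  module RL = RingLemmas 𝓛.commutativeRing

  ¼ : ℚ
  ¼ = + 1 ℚ./ 4

/-*-cancel : ∀ p d .{{_ : NonZero d}} → p ℚ./ d ℚ.* fromℕ d ≡ p ℚ./ 1
/-*-cancel p (suc d) = ℚ.toℚᵘ-injective (begin
  ℚ.toℚᵘ (p ℚ./ suc d ℚ.* fromℕ (suc d))
    ≈⟨ ℚ.toℚᵘ-homo-* (p ℚ./ suc d) (fromℕ (suc d)) ⟩
  ℚ.toℚᵘ (p ℚ./ suc d) ℚᵘ.* ℚ.toℚᵘ (fromℕ (suc d))
    ≈⟨ ℚᵘ.*-cong (ℚ.toℚᵘ-fromℚᵘ (mkℚᵘ p d)) (ℚ.toℚᵘ-fromℚᵘ (mkℚᵘ (+ suc d) 0)) ⟩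
  mkℚᵘ p d ℚᵘ.* mkℚᵘ (+ suc d) 0
    ≈⟨ *≡* (solve 2 (λ p d → p :* d :* con 1ℤ := p :* (d :* con 1ℤ)) refl p (+ suc d)) ⟩
  mkℚᵘ p 0
    ≈⟨ ℚ.toℚᵘ-fromℚᵘ (mkℚᵘ p 0) ⟨
  ℚ.toℚᵘ (p ℚ./ 1) ∎)
  where
  open SetoidReasoning ℚᵘ.≃-setoid
  open ℤ-Solver

fromℕ-+ : ∀ m n → fromℕ (m ℕ.+ n) ≡ fromℕ m ℚ.+ fromℕ n
fromℕ-+ m n = ℚ.toℚᵘ-injective (begin
  ℚ.toℚᵘ (fromℕ (m ℕ.+ n))                      ≈⟨ ℚ.toℚᵘ-fromℚᵘ (mkℚᵘ (+ (m ℕ.+ n)) 0) ⟩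
  mkℚᵘ (+ (m ℕ.+ n)) 0
    ≈⟨ *≡* (solve 2 (λ m n → (m :+ n) :* con 1ℤ := (m :* con 1ℤ :+ n :* con 1ℤ) :* con 1ℤ) refl (+ m) (+ n)) ⟩
  mkℚᵘ (+ m) 0 ℚᵘ.+ mkℚᵘ (+ n) 0
    ≈⟨ ℚᵘ.+-cong (ℚ.toℚᵘ-fromℚᵘ (mkℚᵘ (+ m) 0)) (ℚ.toℚᵘ-fromℚᵘ (mkℚᵘ (+ n) 0)) ⟨
  ℚ.toℚᵘ (fromℕ m) ℚᵘ.+ ℚ.toℚᵘ (fromℕ n)        ≈⟨ ℚ.toℚᵘ-homo-+ (fromℕ m) (fromℕ n) ⟨
  ℚ.toℚᵘ (fromℕ m ℚ.+ fromℕ n)                  ∎)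
  where
  open SetoidReasoning ℚᵘ.≃-setoid
  open ℤ-Solver

-- The embedding used in the statement agrees with the numerals of the solver.
fromℕ≡fromℤ : ∀ n → fromℕ n ≡ Q.fromℤ (+ n)
fromℕ≡fromℤ zero    = refl
fromℕ≡fromℤ (suc n) = trans (fromℕ-+ 1 n)
  (trans (cong (1ℚ ℚ.+_) (fromℕ≡fromℤ n)) (sym (Q.fromℤ-+ 1ℤ (+ n))))

fromℕ-* : ∀ m n → fromℕ (m ℕ.* n) ≡ fromℕ m ℚ.* fromℕ n
fromℕ-* m n = begin
  fromℕ (m ℕ.* n)                  ≡⟨ fromℕ≡fromℤ (m ℕ.* n) ⟩
  Q.fromℤ (+ (m ℕ.* n))            ≡⟨ cong Q.fromℤ (ℤ.pos-* m n) ⟩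
  Q.fromℤ (+ m ℤ.* + n)            ≡⟨ Q.fromℤ-* (+ m) (+ n) ⟩
  Q.fromℤ (+ m) ℚ.* Q.fromℤ (+ n)  ≡⟨ cong₂ ℚ._*_ (fromℕ≡fromℤ m) (fromℕ≡fromℤ n) ⟨
  fromℕ m ℚ.* fromℕ n              ∎
  where open ≡-Reasoning

fromℕ-regular : ∀ n .{{_ : NonZero n}} → Regular ℚ.+-*-commutativeRing (fromℕ n)
fromℕ-regular n {s} ns≡0 = begin
  s                                    ≡⟨ ℚ.*-identityˡ s ⟨
  1ℚ ℚ.* s                             ≡⟨ cong (ℚ._* s) (/-*-cancel (+ 1) n) ⟨
  (+ 1 ℚ./ n) ℚ.* fromℕ n ℚ.* s        ≡⟨ ℚ.*-assoc (+ 1 ℚ./ n) (fromℕ n) s ⟩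
  (+ 1 ℚ./ n) ℚ.* (fromℕ n ℚ.* s)      ≡⟨ cong ((+ 1 ℚ./ n) ℚ.*_) ns≡0 ⟩
  (+ 1 ℚ./ n) ℚ.* 0ℚ                   ≡⟨ ℚ.*-zeroʳ (+ 1 ℚ./ n) ⟩
  0ℚ                                   ∎
  where open ≡-Reasoning

fromℕ-cancel : ∀ n .{{_ : NonZero n}} {r s} → fromℕ n ℚ.* r ≡ fromℕ n ℚ.* s → r ≡ s
fromℕ-cancel n {r} {s} eq = Q.x-y≈0⇒x≈y (fromℕ-regular n (begin
  fromℕ n ℚ.* (r ℚ.- s)                ≡⟨ Q.solve 3 (λ n r s → n :* (r :- s) := n :* r :- n :* s) refl (fromℕ n) r s ⟩
  fromℕ n ℚ.* r ℚ.- fromℕ n ℚ.* s      ≡⟨ cong (ℚ._- fromℕ n ℚ.* s) eq ⟩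
  fromℕ n ℚ.* s ℚ.- fromℕ n ℚ.* s      ≡⟨ ℚ.+-inverseʳ (fromℕ n ℚ.* s) ⟩
  0ℚ                                   ∎))
  where
  open ≡-Reasoning
  open Q using (_:*_; _:-_; _:=_)

suc*catalan : ∀ i → fromℕ (suc i) ℚ.* catalan i ≡ fromℕ ((2 ℕ.* i) C i)
suc*catalan i = trans (ℚ.*-comm (fromℕ (suc i)) (catalan i)) (/-*-cancel (+ ((2 ℕ.* i) C i)) (suc i))

catalan-suc : ∀ i → fromℕ (2 ℕ.+ i) ℚ.* catalan (suc i) ≡ fromℕ (4 ℕ.* i ℕ.+ 2) ℚ.* catalan i
catalan-suc i = fromℕ-cancel (suc i) (begin
  fromℕ (suc i) ℚ.* (fromℕ (2 ℕ.+ i) ℚ.* catalan (suc i))  ≡⟨ cong (fromℕ (suc i) ℚ.*_) (suc*catalan (suc i)) ⟩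
  fromℕ (suc i) ℚ.* fromℕ ((2 ℕ.* suc i) C suc i)          ≡⟨ fromℕ-* (suc i) ((2 ℕ.* suc i) C suc i) ⟨
  fromℕ (suc i ℕ.* ((2 ℕ.* suc i) C suc i))                ≡⟨ cong fromℕ (central-binomial-suc i) ⟩
  fromℕ (2 ℕ.* suc (2 ℕ.* i) ℕ.* B)                        ≡⟨ cong (λ k → fromℕ (k ℕ.* B)) 2[1+2i] ⟩
  fromℕ ((4 ℕ.* i ℕ.+ 2) ℕ.* B)                            ≡⟨ fromℕ-* (4 ℕ.* i ℕ.+ 2) B ⟩
  fromℕ (4 ℕ.* i ℕ.+ 2) ℚ.* fromℕ B                        ≡⟨ cong (fromℕ (4 ℕ.* i ℕ.+ 2) ℚ.*_) (suc*catalan i) ⟨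
  fromℕ (4 ℕ.* i ℕ.+ 2) ℚ.* (fromℕ (suc i) ℚ.* catalan i)
    ≡⟨ Q.solve 3 (λ a b c → a :* (b :* c) := b :* (a :* c)) refl (fromℕ (4 ℕ.* i ℕ.+ 2)) (fromℕ (suc i)) (catalan i) ⟩
  fromℕ (suc i) ℚ.* (fromℕ (4 ℕ.* i ℕ.+ 2) ℚ.* catalan i)  ∎)
  where
  open ≡-Reasoning
  open Q using (_:*_; _:=_)
  B = (2 ℕ.* i) C i
  2[1+2i] : 2 ℕ.* suc (2 ℕ.* i) ≡ 4 ℕ.* i ℕ.+ 2
  2[1+2i] = trans (ℕ.*-suc 2 (2 ℕ.* i)) (trans (ℕ.+-comm 2 (2 ℕ.* (2 ℕ.* i))) (cong (ℕ._+ 2) (sym (ℕ.*-assoc 2 2 i))))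

-- Segner's recurrence. It is equivalent to the equation c = 1 + z c² of the Catalan series, from
-- which the equation of p is derived.
catalan-convolution : ∀ n → (catalan P.* catalan) n ≡ catalan (suc n)
catalan-convolution = Derivation.catalan-square ℚ.+-*-commutativeRing catalan refl refl recurrence regular
  where
  open ≡-Reasoning
  recurrence : ∀ n → Q.fromℤ (+ (2 ℕ.+ n)) ℚ.* catalan (suc n) ≡ (Q.fromℤ (+ 4) ℚ.* Q.fromℤ (+ n) ℚ.+ Q.fromℤ (+ 2)) ℚ.* catalan n
  recurrence n = begin
    Q.fromℤ (+ (2 ℕ.+ n)) ℚ.* catalan (suc n)  ≡⟨ cong (ℚ._* catalan (suc n)) (fromℕ≡fromℤ (2 ℕ.+ n)) ⟨
    fromℕ (2 ℕ.+ n) ℚ.* catalan (suc n)        ≡⟨ catalan-suc n ⟩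
    fromℕ (4 ℕ.* n ℕ.+ 2) ℚ.* catalan n
      ≡⟨ cong (ℚ._* catalan n) (trans (fromℕ-+ (4 ℕ.* n) 2) (cong (ℚ._+ fromℕ 2) (trans (fromℕ-* 4 n) (cong (fromℕ 4 ℚ.*_) (fromℕ≡fromℤ n))))) ⟩
    (Q.fromℤ (+ 4) ℚ.* Q.fromℤ (+ n) ℚ.+ Q.fromℤ (+ 2)) ℚ.* catalan n ∎
  regular : ∀ n → Regular ℚ.+-*-commutativeRing (Q.fromℤ (+ suc n))
  regular n = subst (Regular ℚ.+-*-commutativeRing) (fromℕ≡fromℤ (suc n)) (fromℕ-regular (suc n))

-- The generating function of the walks ending on the axis

module OnAxis (W : P.Series) (W-eq : IsW W) where

  g h e : P.Series
  g = KP.2# P.+ W P.* (W P.* W)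
  h = P.const ½
  e = P.const ¼ P.* (W P.* W)

  private
    module const-hom = Homomorphism ℚ-ring P.commutativeRing (const-isHom ℚ-ring)
    open IsRingHomomorphism (const-isHom ℚ-ring) using () renaming (*-homo to const-*; 1#-homo to const-1)

  2h≈1 : KP.2# P.* h P.≈ P.1#
  2h≈1 = const-hom.half-hom {½} refl

  W≈tg : W P.≈ P.var P.* g
  W≈tg = P′.trans W-eq (P.*-cong {P.var} {P.var} {P.const (fromℕ 2) P.+ W P.^ 3} {g} (λ _ → refl)
    (P′.+-cong {P.const (fromℕ 2)} {KP.2#} const-hom.2-homo (P′.*-congˡ {W} (P′.*-congˡ {W} (P′.*-identityʳ W)))))

  4e≈W² : KP.4# P.* e P.≈ W P.* W
  4e≈W² = P′.trans (P′.sym (P′.*-assoc KP.4# (P.const ¼) (W P.* W)))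
    (P′.trans (P′.*-congʳ {W P.* W} {KP.4# P.* P.const ¼} {P.1#} 4¼) (P′.*-identityˡ (W P.* W)))
    where
    4¼ : KP.4# P.* P.const ¼ P.≈ P.1#
    4¼ = P′.trans (P′.*-congʳ {P.const ¼} {KP.4#} (P′.sym const-hom.4-homo))
      (P′.trans (P′.sym (const-* (fromℕ 4) ¼)) const-1)

  γ : S.Series
  γ i = P.const (catalan i)

  γ² : ∀ i → (γ S.* γ) i P.≈ γ (suc i)
  γ² i = P′.trans (P′.sym (const-hom.map-* catalan catalan i)) (P′.reflexive (cong P.const (catalan-convolution i)))

  open Tower.Solution P.commutativeRing {P.var} {W} {g} {h} {e} {γ}
    2h≈1 W≈tg (λ _ → refl) 4e≈W² const-1 const-1 γ² public

  -- Both sides obey the same recurrence by the last step, in which the factor t lowers the length;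
  -- the induction on `n` has to treat all endpoints at once.
  walks≡quadrant : ∀ n i j → fromℕ (a[ i , j ] n) ≡ quadrant j i n
  walks≡quadrant zero i j = sym (trans (quadrant-recurrence j i 0)
    (trans (cong (T.1# j i 0 ℚ.+_) (P.var-*-zero (F j i))) (trans (ℚ.+-identityʳ (T.1# j i 0)) (initial i j))))
    where
    F : ℕ → ℕ → P.Series
    F j i = quadrant (suc j) i P.+ (quadrant j (suc i) P.+ diagonalShift quadrant j i)
    initial : ∀ i j → T.1# j i 0 ≡ fromℕ (a[ i , j ] 0)
    initial zero    zero    = refl
    initial (suc i) zero    = refl
    initial zero    (suc j) = refl
    initial (suc i) (suc j) = refl
  walks≡quadrant (suc n) i j = begin
    fromℕ (a[ i , j ] (suc n))
      ≡⟨ cong fromℕ (a-suc i j n) ⟩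
    fromℕ (a[ i , suc j ] n ℕ.+ (a[ suc i , j ] n ℕ.+ diagonal (λ i j → a[ i , j ] n) i j))
      ≡⟨ trans (fromℕ-+ (a[ i , suc j ] n) _) (cong (fromℕ (a[ i , suc j ] n) ℚ.+_) (fromℕ-+ (a[ suc i , j ] n) _)) ⟩
    fromℕ (a[ i , suc j ] n) ℚ.+ (fromℕ (a[ suc i , j ] n) ℚ.+ fromℕ (diagonal (λ i j → a[ i , j ] n) i j))
      ≡⟨ cong₂ ℚ._+_ (walks≡quadrant n i (suc j)) (cong₂ ℚ._+_ (walks≡quadrant n (suc i) j) (diag i j)) ⟩
    F n
      ≡⟨ P.var-*-suc F n ⟨
    (P.var P.* F) (suc n)
      ≡⟨ ℚ.+-identityˡ _ ⟨
    0ℚ ℚ.+ (P.var P.* F) (suc n)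
      ≡⟨ cong (ℚ._+ (P.var P.* F) (suc n)) (initial i j) ⟨
    T.1# j i (suc n) ℚ.+ (P.var P.* F) (suc n)
      ≡⟨ quadrant-recurrence j i (suc n) ⟨
    quadrant j i (suc n) ∎
    where
    open ≡-Reasoning
    F = quadrant (suc j) i P.+ (quadrant j (suc i) P.+ diagonalShift quadrant j i)
    initial : ∀ i j → T.1# j i (suc n) ≡ 0ℚ
    initial zero    zero    = refl
    initial (suc i) zero    = refl
    initial zero    (suc j) = refl
    initial (suc i) (suc j) = refl
    diag : ∀ i j → fromℕ (diagonal (λ i j → a[ i , j ] n) i j) ≡ diagonalShift quadrant j i n
    diag zero    zero    = sym (P.const-0 n)
    diag (suc i) zero    = sym (P.const-0 n)
    diag zero    (suc j) = sym (P.const-0 n)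
    diag (suc i) (suc j) = walks≡quadrant n i j

  p : S.Series
  p i n = fromℕ (a[ i , 0 ] n)

  -- At y = 0 the series H / (1 - t x y H) reduces, by computation, to H(x,0), which is `axis`. Here
  -- the guessed series becomes the generating function.
  p≈axis : p S.≈ axis
  p≈axis i n = walks≡quadrant n i 0

  p-bounded : ∀ n {i} → n ℕ.< i → p i n ≡ 0ℚ
  p-bounded n n<i = cong fromℕ (a-bounded n 0 n<i)

  t*p : ∀ i → P.var P.* p i P.≈
    W P.^ (2 ℕ.* i ℕ.+ 1) P.* (h P.* P.const ¼ P.^ i P.* P.1#) P.*
      (P.const (catalan i) P.- P.const (catalan (suc i)) P.* W P.^ 3 P.* P.const ¼)
  t*p i = P′.trans (P.*-cong {P.var} {P.var} {p i} {axis i} (λ _ → refl) (p≈axis i))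
    (KP.axis-form {P.var} {W} {g} {h} {P.const ¼} {e} i (P.const (catalan i)) (P.const (catalan (suc i))) W≈tg (λ _ → refl))

  private
    module K = ℚ⦅t⦆

    fromPowerSeries-^ : ∀ f k → K.fromPowerSeries f K.^ k ≡ K.fromPowerSeries (f P.^ k)
    fromPowerSeries-^ f zero    = refl
    fromPowerSeries-^ f (suc k) = cong (K.fromPowerSeries f K.*_) (fromPowerSeries-^ f k)

  axis-coefficients : ∀ i → let w = K.fromPowerSeries W in
    ℚ[x,x⁻¹]⦅t⦆.[x^ i ] (ℚ[x,x⁻¹]⦅t⦆.fromPowerSeries Q[x,0]) K.≈
      w K.^ (2 ℕ.* i ℕ.+ 1) K.* (K.const ½ K.* K.const ¼ K.^ i K.* K.t⁻¹) K.*
        (K.const (catalan i) K.- K.const (catalan (suc i)) K.* w K.^ 3 K.* K.const ¼)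
  axis-coefficients i = laurent (fromPowerSeries-^ W (2 ℕ.* i ℕ.+ 1)) (fromPowerSeries-^ (P.const ¼) i)
    where
    coefficients : P.Series
    coefficients n = X.coeff (+ i) (Q[x,0] n)
    w = K.fromPowerSeries W
    coefficients≈ : coefficients P.≈ p i
    coefficients≈ n = Bivariate.polynomial-≃ ℚ-ring (suc n) {λ i → p i n} (p-bounded n) (+ i)
    -- The pole of a power with variable exponent does not compute; once the two powers are replaced
    -- by power series, the poles are 0 on the left and 1 on the right.
    laurent : ∀ {A U} → A ≡ K.fromPowerSeries (W P.^ (2 ℕ.* i ℕ.+ 1)) → U ≡ K.fromPowerSeries (P.const ¼ P.^ i) →
      K.fromPowerSeries coefficients K.≈ A K.* (K.const ½ K.* U K.* K.t⁻¹) K.*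
        (K.const (catalan i) K.- K.const (catalan (suc i)) K.* w K.^ 3 K.* K.const ¼)
    laurent refl refl = shift≈⇒laurent≈ ℚ-ring {0} {1} {coefficients}
      (P′.trans (shift-1 ℚ-ring coefficients) (P′.trans (P.*-cong {P.var} {P.var} {coefficients} {p i} (λ _ → refl) coefficients≈) (t*p i)))

  W₀≡0 : W 0 ≡ 0ℚ
  W₀≡0 = trans (W≈tg 0) (P.var-*-zero g)

  private
    φ : P.Series → 𝓛.Series
    φ f n = X.monomial 0ℤ (f n)

    module monomial-hom = Homomorphism ℚ-ring X.commutativeRing (Bivariate.monomial-isHom ℚ-ring)
    φ-isHom : IsHom P.commutativeRing 𝓛.commutativeRing φ
    φ-isHom = monomial-hom.map-isHom
    module φ where
      open Homomorphism P.commutativeRing 𝓛.commutativeRing φ-isHom public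
      open IsRingHomomorphism φ-isHom public

    x̂ x̂⁻¹ : 𝓛.Series
    x̂   = 𝓛.const (X.monomial 1ℤ 1ℚ)
    x̂⁻¹ = 𝓛.const (X.monomial -1ℤ 1ℚ)

    φ-var : φ P.var 𝓛.≈ 𝓛.var
    φ-var zero          = IsRingHomomorphism.0#-homo (Bivariate.monomial-isHom ℚ-ring)
    φ-var (suc zero)    = λ k → refl
    φ-var (suc (suc n)) = IsRingHomomorphism.0#-homo (Bivariate.monomial-isHom ℚ-ring)

    φ-shift : ∀ v → φ (P.shift v P.1#) 𝓛.≈ 𝓛.shift v 𝓛.1#
    φ-shift zero    zero    = λ k → refl
    φ-shift zero    (suc n) = IsRingHomomorphism.0#-homo (Bivariate.monomial-isHom ℚ-ring)
    φ-shift (suc v) zero    = IsRingHomomorphism.0#-homo (Bivariate.monomial-isHom ℚ-ring)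
    φ-shift (suc v) (suc n) = φ-shift v n

    φW≈ : φ W 𝓛.≈ 𝓛.var 𝓛.* φ g
    φW≈ = RL.≈*-respˡ {φ W} {φ P.var} {𝓛.var} {φ g} (φ.product-hom {W} {P.var} {g} W≈tg) φ-var

    φg≈ : φ g 𝓛.≈ KL.2# 𝓛.+ φ W 𝓛.* (φ W 𝓛.* φ W)
    φg≈ = φ.2+W³-hom {g} {W} (λ _ → refl)

    2φh≈1 : KL.2# 𝓛.* φ h 𝓛.≈ 𝓛.1#
    2φh≈1 = φ.half-hom {h} 2h≈1

    ½̂ : 𝓛.Series
    ½̂ = 𝓛.const (X.monomial 0ℤ ½)

    2½≈1 : KL.2# 𝓛.* ½̂ 𝓛.≈ 𝓛.1#
    2½≈1 = Homomorphism.half-hom X.commutativeRing 𝓛.commutativeRing (const-isHom X.commutativeRing) {X.monomial 0ℤ ½}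
      (monomial-hom.half-hom {½} refl)

    -- The bound on the degree in x comes from the walks, so the transfer has to wait for the
    -- identification of `p` with `axis`.
    catalytic-L : KL.Catalytic 𝓛.var x̂ Q[x,0] (φ axis₀)
    catalytic-L = Bivariate.Catalytic-transfer ℚ-ring {p} {axis₀} p-bounded
      (Catalytic-cong S.commutativeRing {S.const P.var} {S.const P.var} {S.var} {S.var} {axis} {p} {S.const axis₀} {S.const axis₀}
        (λ _ _ → refl) (λ _ _ → refl) (λ i n → sym (p≈axis i n)) (λ _ _ → refl) axis-catalytic)

    axis₀-L : KL.8# 𝓛.* (𝓛.var 𝓛.* φ axis₀) 𝓛.≈ KL.4# 𝓛.* φ W 𝓛.- φ W 𝓛.* φ W 𝓛.* (φ W 𝓛.* φ W)
    axis₀-L = KL.axis₀-value {𝓛.var} {φ W} {φ g} {φ h} {φ e} {φ axis₀} 2φh≈1 φW≈ (φ.4e≈W²-hom {e} {W} 4e≈W²) (φ.axis₀-hom h g W e)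

    x⁻¹x≈1 : X.monomial -1ℤ 1ℚ X.* X.monomial 1ℤ 1ℚ X.≈ X.1#
    x⁻¹x≈1 k = refl

    x̂⁻¹x̂≈1 : x̂⁻¹ 𝓛.* x̂ 𝓛.≈ 𝓛.1#
    x̂⁻¹x̂≈1 = 𝓛′.sym {𝓛.1#} {x̂⁻¹ 𝓛.* x̂} (IsRingHomomorphism.*-homo (const-isHom X.commutativeRing) (X.monomial -1ℤ 1ℚ) (X.monomial 1ℤ 1ℚ))

  module _ (√1-xW² : 𝓛.Series) (isSqrt : IsSqrt (1-xW² W) √1-xW²) where

    private
      √²≈ : √1-xW² 𝓛.* √1-xW² 𝓛.≈ 𝓛.1# 𝓛.- x̂ 𝓛.* (φ W 𝓛.* φ W)
      √²≈ = KL.square-form {x̂} {φ W} {√1-xW²} (proj₂ isSqrt)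

    square-root-identity : KL.2# 𝓛.* (𝓛.var 𝓛.* ((x̂ 𝓛.- φ W) 𝓛.* √1-xW²)) 𝓛.≈
      x̂ 𝓛.* φ W 𝓛.- KL.2# 𝓛.* (𝓛.var 𝓛.* φ W) 𝓛.- KL.2# 𝓛.* (𝓛.var 𝓛.* (𝓛.var 𝓛.* (x̂ 𝓛.* (x̂ 𝓛.* (φ W 𝓛.* Q[x,0])))))
    square-root-identity = KL.square-root-equation {𝓛.var} {x̂} {φ W} {Q[x,0]} {φ axis₀} {√1-xW²}
      (RL.≈*-respʳ {φ W} {𝓛.var} {φ g} {KL.2# 𝓛.+ φ W 𝓛.* (φ W 𝓛.* φ W)} φW≈ φg≈)
      axis₀-L catalytic-L √²≈ (λ {f} → 𝓛.var-regular {f})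
      (square-root-regular X.commutativeRing {X.monomial 1ℤ 1ℚ} {X.monomial -1ℤ 1ℚ} {X.monomial 0ℤ ½} {φ W} {√1-xW²} {𝓛.1# 𝓛.+ 𝓛.var 𝓛.* (x̂ 𝓛.* (x̂ 𝓛.* Q[x,0]))}
        (monomial-hom.half-hom {½} refl) x⁻¹x≈1
        (λ k → trans (IsRingHomomorphism.⟦⟧-cong (Bivariate.monomial-isHom ℚ-ring) W₀≡0 k) (IsRingHomomorphism.0#-homo (Bivariate.monomial-isHom ℚ-ring) k))
        (proj₁ isSqrt))

    on-axis : (W⁻¹ : ℚ⦅t⦆.Carrier) → IsReciprocal (ℚ⦅t⦆.fromPowerSeries W) W⁻¹ →
      let module M = ℚ[x,x⁻¹]⦅t⦆ in
      M.fromPowerSeries Q[x,0] M.≈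
        M.t⁻¹ M.* M.x⁻¹ M.*
          ( M.fromℚ ½ M.* M.t⁻¹ M.- M.x⁻¹
            M.- (M.fromℚ⦅t⦆ W⁻¹ M.- M.x⁻¹) M.* M.fromPowerSeries √1-xW² )
    on-axis (t^- v ∙ f) reciprocal = shift≈⇒laurent≈ X.commutativeRing {0} {suc (suc (v ℕ.+ 0 ℕ.+ 0))} {Q[x,0]} {G (v ℕ.+ 0 ℕ.+ 0)} shifted
      where
      -- The numerator of the right side of the theorem. Its pole computes to 2 plus v + 0 + 0, so
      -- this number is made an argument, to be replaced by v at the end.
      G : ℕ → 𝓛.Series
      G u = 𝓛.1# 𝓛.* x̂⁻¹ 𝓛.*
        (𝓛.shift u (𝓛.shift 0 (½̂ 𝓛.* 𝓛.1#) 𝓛.+ 𝓛.shift 1 (𝓛.- x̂⁻¹)) 𝓛.+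
         𝓛.shift 1 (𝓛.- ((𝓛.shift 0 (φ f) 𝓛.+ 𝓛.shift v (𝓛.- x̂⁻¹)) 𝓛.* √1-xW²)))
      Wf : W P.* f P.≈ P.shift v P.1#
      Wf = laurent≈⇒shift≈ ℚ-ring {v} {W P.* f} {P.1#} reciprocal
      φfφW : φ f 𝓛.* φ W 𝓛.≈ 𝓛.shift v 𝓛.1#
      φfφW = 𝓛′.trans {φ f 𝓛.* φ W} {φ (f P.* W)} {𝓛.shift v 𝓛.1#} (𝓛′.sym {φ (f P.* W)} {φ f 𝓛.* φ W} (φ.*-homo f W))
        (𝓛′.trans {φ (f P.* W)} {φ (P.shift v P.1#)} {𝓛.shift v 𝓛.1#}
          (φ.⟦⟧-cong {f P.* W} {P.shift v P.1#} (P′.trans (P.*-comm f W) Wf)) (φ-shift v))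
      G-v : 𝓛.shift (suc (suc v)) Q[x,0] 𝓛.≈ G v
      G-v = laurent-normal-form X.commutativeRing v {x̂⁻¹} {½̂} {φ f} {Q[x,0]} {√1-xW²}
        (KL.clear-denominators {𝓛.var} {x̂} {x̂⁻¹} {φ W} {φ f} {𝓛.shift v 𝓛.1#} {½̂} {Q[x,0]} {√1-xW²}
          2½≈1 x̂⁻¹x̂≈1 φfφW square-root-identity)
      shifted : 𝓛.shift (suc (suc (v ℕ.+ 0 ℕ.+ 0))) Q[x,0] 𝓛.≈ 𝓛.shift 0 (G (v ℕ.+ 0 ℕ.+ 0))
      shifted = subst (λ u → 𝓛.shift (suc (suc u)) Q[x,0] 𝓛.≈ 𝓛.shift 0 (G u))
        (sym (trans (ℕ.+-identityʳ (v ℕ.+ 0)) (ℕ.+-identityʳ v))) G-v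

-- Existence of W

W^_series : ℕ → P.Series
(W^ k series) m = fromℕ (W^-coeff k m)

W-series : P.Series
W-series = W^ 1 series

-- The table of coefficients really consists of the powers of one series. The induction is on `m`,
-- since unfolding Wᵏ⁺¹ = t (2 Wᵏ + Wᵏ⁺³) lowers the exponent of t but can raise that of W.
W^-series-* : ∀ m k l → ((W^ k series) P.* (W^ l series)) m ≡ (W^ (k ℕ.+ l) series) m
W^-series-* m zero l = trans (P.*-cong {W^ 0 series} {P.1#} {W^ l series} (λ { zero → refl ; (suc n) → refl }) (λ _ → refl) m)
  (P′.*-identityˡ (W^ l series) m)
W^-series-* zero    (suc k) l = trans (ℚ.+-identityʳ _) (ℚ.*-zeroˡ (fromℕ (W^-coeff l 0)))
W^-series-* (suc m) (suc k) l = begin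
  0ℚ ℚ.* fromℕ (W^-coeff l (suc m)) ℚ.+ (P.tail (W^ suc k series) P.* (W^ l series)) m
    ≡⟨ trans (cong (ℚ._+ (P.tail (W^ suc k series) P.* (W^ l series)) m) (ℚ.*-zeroˡ (fromℕ (W^-coeff l (suc m))))) (ℚ.+-identityˡ _) ⟩
  (P.tail (W^ suc k series) P.* (W^ l series)) m
    ≡⟨ P.*-cong {P.tail (W^ suc k series)} {2W P.+ (W^ (3 ℕ.+ k) series)} {W^ l series}
         (λ n → trans (fromℕ-+ (2 ℕ.* W^-coeff k n) (W^-coeff (3 ℕ.+ k) n)) (cong (ℚ._+ fromℕ (W^-coeff (3 ℕ.+ k) n)) (fromℕ-* 2 (W^-coeff k n)))) (λ _ → refl) m ⟩
  ((2W P.+ (W^ (3 ℕ.+ k) series)) P.* (W^ l series)) m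
    ≡⟨ P.distribʳ (W^ l series) 2W (W^ (3 ℕ.+ k) series) m ⟩
  (2W P.* (W^ l series)) m ℚ.+ ((W^ (3 ℕ.+ k) series) P.* (W^ l series)) m
    ≡⟨ cong₂ ℚ._+_ (trans (P.scale-* (fromℕ 2) (W^ k series) (W^ l series) m) (cong (fromℕ 2 ℚ.*_) (W^-series-* m k l))) (W^-series-* m (3 ℕ.+ k) l) ⟩
  fromℕ 2 ℚ.* fromℕ (W^-coeff (k ℕ.+ l) m) ℚ.+ fromℕ (W^-coeff (3 ℕ.+ k ℕ.+ l) m)
    ≡⟨ trans (fromℕ-+ (2 ℕ.* W^-coeff (k ℕ.+ l) m) _) (cong (ℚ._+ fromℕ (W^-coeff (3 ℕ.+ k ℕ.+ l) m)) (fromℕ-* 2 (W^-coeff (k ℕ.+ l) m))) ⟨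
  fromℕ (W^-coeff (suc k ℕ.+ l) (suc m)) ∎
  where
  open ≡-Reasoning
  2W : P.Series
  2W n = fromℕ 2 ℚ.* fromℕ (W^-coeff k n)

W-series-^ : ∀ k → W-series P.^ k P.≈ (W^ k series)
W-series-^ zero    = λ { zero → refl ; (suc n) → refl }
W-series-^ (suc k) n = trans (P.*-cong {W-series} {W-series} {W-series P.^ k} (λ _ → refl) (W-series-^ k) n) (W^-series-* n 1 k)

-- The explicit count of walks does not mention W, so an actual solution of its equation must be
-- exhibited.
W-series-isW : IsW W-series
W-series-isW zero    = sym (P.var-*-zero (P.const (fromℕ 2) P.+ W-series P.^ 3))
W-series-isW (suc m) = begin
  fromℕ (2 ℕ.* W^-coeff 0 m ℕ.+ W^-coeff 3 m)                  ≡⟨ fromℕ-+ (2 ℕ.* W^-coeff 0 m) _ ⟩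
  fromℕ (2 ℕ.* W^-coeff 0 m) ℚ.+ fromℕ (W^-coeff 3 m)          ≡⟨ cong₂ ℚ._+_ (constant m) (sym (W-series-^ 3 m)) ⟩
  (P.const (fromℕ 2) P.+ W-series P.^ 3) m                     ≡⟨ P.var-*-suc (P.const (fromℕ 2) P.+ W-series P.^ 3) m ⟨
  (P.var P.* (P.const (fromℕ 2) P.+ W-series P.^ 3)) (suc m)   ∎
  where
  open ≡-Reasoning
  constant : ∀ m → fromℕ (2 ℕ.* W^-coeff 0 m) ≡ P.const (fromℕ 2) m
  constant zero    = refl
  constant (suc m) = refl

4^i≡2^2i : ∀ i → 4 ℕ.^ i ≡ 2 ℕ.^ (2 ℕ.* i)
4^i≡2^2i i = ℕ.^-*-assoc 2 2 i

-- The closed formula for the number of walks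

module _ (i n : ℕ) where
  private
    N m b : ℕ
    N = 3 ℕ.* n ℕ.+ 2 ℕ.* i
    m = suc N
    b = m C n
    F = 4 ℕ.^ i
    G = 4 ℕ.^ n
    open ≡-Reasoning
    open +-*-Solver

  2^[2i+2n] : 2 ℕ.^ (2 ℕ.* i ℕ.+ 2 ℕ.* n) ≡ F ℕ.* G
  2^[2i+2n] = trans (ℕ.^-distribˡ-+-* 2 (2 ℕ.* i) (2 ℕ.* n)) (sym (cong₂ ℕ._*_ (4^i≡2^2i i) (4^i≡2^2i n)))

  W^[2i+1]-coeff : m ℕ.* W^-coeff (2 ℕ.* i ℕ.+ 1) m ≡ (2 ℕ.* i ℕ.+ 1) ℕ.* (b ℕ.* (2 ℕ.* (F ℕ.* G)))
  W^[2i+1]-coeff = trans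
    (W^-coeff-formula m (2 ℕ.* i ℕ.+ 1) n (solve 2 (λ i n → con 1 :+ (con 3 :* n :+ con 2 :* i) := con 2 :* i :+ con 1 :+ con 3 :* n) refl i n))
    (cong (λ x → (2 ℕ.* i ℕ.+ 1) ℕ.* (b ℕ.* x)) (trans
      (cong (2 ℕ.^_) (solve 2 (λ i n → con 2 :* i :+ con 1 :+ con 2 :* n := con 1 :+ (con 2 :* i :+ con 2 :* n)) refl i n))
      (cong (2 ℕ.*_) 2^[2i+2n])))

  -- Lagrange's formula gives the binomial coefficient of m over n - 1; as m - n + 1 = 2 (n + i +
  -- 1), the factor n + i + 1 turns it into `b`. The factor n on the right also covers n = 0, where
  -- m lies below 2i + 4 and the coefficient vanishes.
  W^[2i+4]-coeff : (n ℕ.+ i ℕ.+ 1) ℕ.* (m ℕ.* W^-coeff (2 ℕ.* i ℕ.+ 1 ℕ.+ 3) m) ≡ (i ℕ.+ 2) ℕ.* (n ℕ.* (b ℕ.* (4 ℕ.* (F ℕ.* G))))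
  W^[2i+4]-coeff = by-cases n refl
    where
    by-cases : ∀ n′ → n ≡ n′ → (n ℕ.+ i ℕ.+ 1) ℕ.* (m ℕ.* W^-coeff (2 ℕ.* i ℕ.+ 1 ℕ.+ 3) m) ≡ (i ℕ.+ 2) ℕ.* (n ℕ.* (b ℕ.* (4 ℕ.* (F ℕ.* G))))
    by-cases zero refl = trans
      (cong (λ x → (i ℕ.+ 1) ℕ.* (m ℕ.* x)) (W^-coeff-below {2 ℕ.* i ℕ.+ 1 ℕ.+ 3} {m}
        (subst (m ℕ.<_) (solve 1 (λ i → con 4 :+ con 2 :* i := con 2 :* i :+ con 1 :+ con 3) refl i)
          (ℕ.m<n⇒m<1+n (ℕ.m<n⇒m<1+n (ℕ.n<1+n m))))))
      (trans (solve 2 (λ i m → (i :+ con 1) :* (m :* con 0) := con 0) refl i m) (sym (ℕ.*-zeroʳ (i ℕ.+ 2))))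
    by-cases (suc j) refl = begin
      (n ℕ.+ i ℕ.+ 1) ℕ.* (m ℕ.* W^-coeff (2 ℕ.* i ℕ.+ 1 ℕ.+ 3) m)
        ≡⟨ cong ((n ℕ.+ i ℕ.+ 1) ℕ.*_) (W^-coeff-formula m (2 ℕ.* i ℕ.+ 1 ℕ.+ 3) j
             (solve 2 (λ i j → con 1 :+ (con 3 :* (con 1 :+ j) :+ con 2 :* i) := con 2 :* i :+ con 1 :+ con 3 :+ con 3 :* j) refl i j)) ⟩
      (n ℕ.+ i ℕ.+ 1) ℕ.* ((2 ℕ.* i ℕ.+ 1 ℕ.+ 3) ℕ.* ((m C j) ℕ.* 2 ℕ.^ (2 ℕ.* i ℕ.+ 1 ℕ.+ 3 ℕ.+ 2 ℕ.* j)))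
        ≡⟨ cong (λ x → (n ℕ.+ i ℕ.+ 1) ℕ.* ((2 ℕ.* i ℕ.+ 1 ℕ.+ 3) ℕ.* ((m C j) ℕ.* x))) (trans
             (cong (2 ℕ.^_) (solve 2 (λ i j → con 2 :* i :+ con 1 :+ con 3 :+ con 2 :* j := con 2 :+ (con 2 :* i :+ con 2 :* (con 1 :+ j))) refl i j))
             (trans (sym (ℕ.*-assoc 2 2 (2 ℕ.^ (2 ℕ.* i ℕ.+ 2 ℕ.* n)))) (cong (4 ℕ.*_) 2^[2i+2n]))) ⟩
      (n ℕ.+ i ℕ.+ 1) ℕ.* ((2 ℕ.* i ℕ.+ 1 ℕ.+ 3) ℕ.* ((m C j) ℕ.* (4 ℕ.* (F ℕ.* G))))
        ≡⟨ solve 4 (λ i j c x → (con 1 :+ j :+ i :+ con 1) :* ((con 2 :* i :+ con 1 :+ con 3) :* (c :* x))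
             := (i :+ con 2) :* (con 2 :* (i :+ j :+ con 2) :* c) :* x) refl i j (m C j) (4 ℕ.* (F ℕ.* G)) ⟩
      (i ℕ.+ 2) ℕ.* (2 ℕ.* (i ℕ.+ j ℕ.+ 2) ℕ.* (m C j)) ℕ.* (4 ℕ.* (F ℕ.* G))
        ≡⟨ cong (λ x → (i ℕ.+ 2) ℕ.* x ℕ.* (4 ℕ.* (F ℕ.* G))) (ℕ.+-cancelʳ-≡ (n ℕ.* (m C j)) _ _ (sym (trans (suc-k*nC[k+1] m j)
             (solve 3 (λ i j c → (con 2 :+ (con 3 :* (con 1 :+ j) :+ con 2 :* i)) :* c := con 2 :* (i :+ j :+ con 2) :* c :+ (con 1 :+ j) :* c) refl i j (m C j))))) ⟩
      (i ℕ.+ 2) ℕ.* (n ℕ.* b) ℕ.* (4 ℕ.* (F ℕ.* G))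
        ≡⟨ solve 4 (λ i n b x → (i :+ con 2) :* (n :* b) :* x := (i :+ con 2) :* (n :* (b :* x))) refl i n b (4 ℕ.* (F ℕ.* G)) ⟩
      (i ℕ.+ 2) ℕ.* (n ℕ.* (b ℕ.* (4 ℕ.* (F ℕ.* G)))) ∎

  -- Here m - n = 2n + 2i + 1, which is the second factor in the denominator of the theorem.
  nCk-absorb : (2 ℕ.* n ℕ.+ 2 ℕ.* i ℕ.+ 1) ℕ.* b ≡ m ℕ.* (N C n)
  nCk-absorb = ℕ.+-cancelˡ-≡ (n ℕ.* b) _ _ (trans
    (solve 3 (λ i n b → n :* b :+ (con 2 :* n :+ con 2 :* i :+ con 1) :* b := (con 1 :+ (con 3 :* n :+ con 2 :* i)) :* b) refl i n b)
    (sym (k*[n+1]Ck N n)))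

  private
    -- A record, because unification cannot recover a from fromℕ a.
    record Cast (a : ℕ) (x : ℚ) : Set where
      constructor mkCast
      field
        cast : fromℕ a ≡ x
    open Cast

    _⊕_ : ∀ {a b x y} → Cast a x → Cast b y → Cast (a ℕ.+ b) (x ℚ.+ y)
    _⊕_ {a} {b} (mkCast a≡) (mkCast b≡) = mkCast (trans (fromℕ-+ a b) (cong₂ ℚ._+_ a≡ b≡))

    _⊗_ : ∀ {a b x y} → Cast a x → Cast b y → Cast (a ℕ.* b) (x ℚ.* y)
    _⊗_ {a} {b} (mkCast a≡) (mkCast b≡) = mkCast (trans (fromℕ-* a b) (cong₂ ℚ._*_ a≡ b≡))

    infixl 6 _⊕_
    infixl 7 _⊗_

    # : ∀ k → Cast k (fromℕ k)
    # k = mkCast refl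

    open RingOps ℚ.+-*-rawRing using () renaming (_^_ to _^ℚ_)
    module O = OnAxis W-series W-series-isW

    q w₁ w₂ : ℚ
    q  = ¼ ^ℚ i
    w₁ = fromℕ (W^-coeff (2 ℕ.* i ℕ.+ 1) m)
    w₂ = fromℕ (W^-coeff (2 ℕ.* i ℕ.+ 1 ℕ.+ 3) m)

    const-^ : ∀ k → P.const ¼ P.^ k P.≈ P.const (¼ ^ℚ k)
    const-^ zero    = λ _ → refl
    const-^ (suc k) = P′.trans (P.*-cong {P.const ¼} {P.const ¼} {P.const ¼ P.^ k} (λ _ → refl) (const-^ k))
      (P′.sym (IsRingHomomorphism.*-homo (const-isHom ℚ-ring) ¼ (¼ ^ℚ k)))

    scaled-coefficient : ∀ r f → (P.const ½ P.* P.const ¼ P.^ i P.* P.const r P.* f) m ≡ ½ ℚ.* q ℚ.* r ℚ.* f m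
    scaled-coefficient r f = trans (P.*-cong {P.const ½ P.* P.const ¼ P.^ i P.* P.const r} {P.const (½ ℚ.* q ℚ.* r)} {f} constants (λ _ → refl) m)
      (P.const-* (½ ℚ.* q ℚ.* r) f m)
      where
      open IsRingHomomorphism (const-isHom ℚ-ring) using (*-homo)
      constants : P.const ½ P.* P.const ¼ P.^ i P.* P.const r P.≈ P.const (½ ℚ.* q ℚ.* r)
      constants = P′.trans (P.*-cong {P.const ½ P.* P.const ¼ P.^ i} {P.const (½ ℚ.* q)} {P.const r}
          (P′.trans (P.*-cong {P.const ½} {P.const ½} {P.const ¼ P.^ i} (λ _ → refl) (const-^ i)) (P′.sym (*-homo ½ q))) (λ _ → refl))
        (P′.sym (*-homo (½ ℚ.* q) r))

  -- The expression in powers of W is one for t p, hence the coefficients at m = N + 1.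
  axis-walks : fromℕ (a[ i , 0 ] N) ≡ ½ ℚ.* q ℚ.* catalan i ℚ.* w₁ ℚ.- ½ ℚ.* q ℚ.* (catalan (suc i) ℚ.* ¼) ℚ.* w₂
  axis-walks = begin
    O.p i N                       ≡⟨ P.var-*-suc (O.p i) N ⟨
    (P.var P.* O.p i) m           ≡⟨ O.t*p i m ⟩
    _                             ≡⟨ KP.axis-expansion {W-series} {P.const ½} {P.const ¼} i (P.const (catalan i)) (P.const (catalan (suc i))) m ⟩
    (½¼ⁱ P.* P.const (catalan i) P.* W-series P.^ (2 ℕ.* i ℕ.+ 1)) m ℚ.- (½¼ⁱ P.* (P.const (catalan (suc i)) P.* P.const ¼) P.* W-series P.^ (2 ℕ.* i ℕ.+ 1 ℕ.+ 3)) m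
      ≡⟨ cong₂ ℚ._-_
           (trans (scaled-coefficient (catalan i) (W-series P.^ (2 ℕ.* i ℕ.+ 1))) (cong (½ ℚ.* q ℚ.* catalan i ℚ.*_) (W-series-^ (2 ℕ.* i ℕ.+ 1) m)))
           (trans (P.*-cong {½¼ⁱ P.* (P.const (catalan (suc i)) P.* P.const ¼)} {½¼ⁱ P.* P.const (catalan (suc i) ℚ.* ¼)} {V}
                (P.*-cong {½¼ⁱ} {½¼ⁱ} {P.const (catalan (suc i)) P.* P.const ¼} (λ _ → refl) (P′.sym (IsRingHomomorphism.*-homo (const-isHom ℚ-ring) (catalan (suc i)) ¼))) (λ _ → refl) m)
             (trans (scaled-coefficient (catalan (suc i) ℚ.* ¼) V) (cong (½ ℚ.* q ℚ.* (catalan (suc i) ℚ.* ¼) ℚ.*_) (W-series-^ (2 ℕ.* i ℕ.+ 1 ℕ.+ 3) m)))) ⟩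
    ½ ℚ.* q ℚ.* catalan i ℚ.* w₁ ℚ.- ½ ℚ.* q ℚ.* (catalan (suc i) ℚ.* ¼) ℚ.* w₂ ∎
    where
    ½¼ⁱ V : P.Series
    ½¼ⁱ = P.const ½ P.* P.const ¼ P.^ i
    V = W-series P.^ (2 ℕ.* i ℕ.+ 1 ℕ.+ 3)

  axis-walks-formula : fromℕ (a[ i , 0 ] N) ≡
    (+ (4 ℕ.^ n ℕ.* (2 ℕ.* i ℕ.+ 1))) / (suc (n ℕ.+ i) ℕ.* suc (2 ℕ.* n ℕ.+ 2 ℕ.* i))
      ℚ.* fromℕ ((2 ℕ.* i) C i) ℚ.* fromℕ (N C n)
  -- `D` is the denominator of the claim and `m` the one in Lagrange's formula; after multiplying by
  -- both, everything but the powers of 1/2 and 1/4 and the Catalan numbers is integral.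
  axis-walks-formula = fromℕ-cancel D (fromℕ-cancel m (begin
    fromℕ m ℚ.* (fromℕ D ℚ.* fromℕ (a[ i , 0 ] N))
      ≡⟨ cong₂ (λ x y → fromℕ m ℚ.* (x ℚ.* y)) D≡ axis-walks ⟩
    fromℕ m ℚ.* ((fromℕ n ℚ.+ fromℕ i ℚ.+ 1ℚ) ℚ.* (KQ.2# ℚ.* fromℕ n ℚ.+ KQ.2# ℚ.* fromℕ i ℚ.+ 1ℚ) ℚ.*
      (½ ℚ.* q ℚ.* catalan i ℚ.* w₁ ℚ.- ½ ℚ.* q ℚ.* (catalan (suc i) ℚ.* ¼) ℚ.* w₂))
      ≡⟨ KQ.axis-count {½} {¼} {q} {fromℕ F} {fromℕ G} {fromℕ i} {fromℕ n} {fromℕ m} {catalan i} {catalan (suc i)} {fromℕ B} {w₁} {w₂} {fromℕ b} {fromℕ (N C n)}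
           refl refl (q*4^i i) γ≡ γ′≡ w₁≡ w₂≡ b≡ ⟩
    fromℕ m ℚ.* (fromℕ G ℚ.* (KQ.2# ℚ.* fromℕ i ℚ.+ 1ℚ) ℚ.* fromℕ B ℚ.* fromℕ (N C n))
      ≡⟨ cong (λ x → fromℕ m ℚ.* (x ℚ.* fromℕ B ℚ.* fromℕ (N C n))) (cast (# G ⊗ (# 2 ⊗ # i ⊕ # 1))) ⟨
    fromℕ m ℚ.* (fromℕ A ℚ.* fromℕ B ℚ.* fromℕ (N C n))
      ≡⟨ cong (λ x → fromℕ m ℚ.* (x ℚ.* fromℕ B ℚ.* fromℕ (N C n))) (/-*-cancel (+ A) D) ⟨
    fromℕ m ℚ.* (+ A / D ℚ.* fromℕ D ℚ.* fromℕ B ℚ.* fromℕ (N C n))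
      ≡⟨ Q.solve 5 (λ m x d b c → m Q.:* (x Q.:* d Q.:* b Q.:* c) Q.:= m Q.:* (d Q.:* (x Q.:* b Q.:* c))) refl
           (fromℕ m) (+ A / D) (fromℕ D) (fromℕ B) (fromℕ (N C n)) ⟩
    fromℕ m ℚ.* (fromℕ D ℚ.* (+ A / D ℚ.* fromℕ B ℚ.* fromℕ (N C n))) ∎))
    where
    A B D : ℕ
    A = 4 ℕ.^ n ℕ.* (2 ℕ.* i ℕ.+ 1)
    B = (2 ℕ.* i) C i
    D = suc (n ℕ.+ i) ℕ.* suc (2 ℕ.* n ℕ.+ 2 ℕ.* i)
    D≡ : fromℕ D ≡ (fromℕ n ℚ.+ fromℕ i ℚ.+ 1ℚ) ℚ.* (KQ.2# ℚ.* fromℕ n ℚ.+ KQ.2# ℚ.* fromℕ i ℚ.+ 1ℚ)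
    D≡ = trans (cong fromℕ (cong₂ ℕ._*_ (ℕ.+-comm 1 (n ℕ.+ i)) (ℕ.+-comm 1 (2 ℕ.* n ℕ.+ 2 ℕ.* i))))
      (cast ((# n ⊕ # i ⊕ # 1) ⊗ (# 2 ⊗ # n ⊕ # 2 ⊗ # i ⊕ # 1)))
    q*4^i : ∀ k → ¼ ^ℚ k ℚ.* fromℕ (4 ℕ.^ k) ≡ 1ℚ
    q*4^i zero    = refl
    q*4^i (suc k) = begin
      ¼ ℚ.* (¼ ^ℚ k) ℚ.* fromℕ (4 ℕ.* 4 ℕ.^ k)            ≡⟨ cong (¼ ℚ.* (¼ ^ℚ k) ℚ.*_) (fromℕ-* 4 (4 ℕ.^ k)) ⟩
      ¼ ℚ.* (¼ ^ℚ k) ℚ.* (fromℕ 4 ℚ.* fromℕ (4 ℕ.^ k))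
        ≡⟨ Q.solve 4 (λ u x f y → u Q.:* x Q.:* (f Q.:* y) Q.:= (u Q.:* f) Q.:* (x Q.:* y)) refl ¼ (¼ ^ℚ k) (fromℕ 4) (fromℕ (4 ℕ.^ k)) ⟩
      1ℚ ℚ.* ((¼ ^ℚ k) ℚ.* fromℕ (4 ℕ.^ k))               ≡⟨ trans (ℚ.*-identityˡ _) (q*4^i k) ⟩
      1ℚ                                                  ∎
    γ≡ : (fromℕ i ℚ.+ 1ℚ) ℚ.* catalan i ≡ fromℕ B
    γ≡ = trans (cong (ℚ._* catalan i) (trans (sym (fromℕ-+ i 1)) (cong fromℕ (ℕ.+-comm i 1)))) (suc*catalan i)
    γ′≡ : (fromℕ i ℚ.+ KQ.2#) ℚ.* catalan (suc i) ≡ (KQ.4# ℚ.* fromℕ i ℚ.+ KQ.2#) ℚ.* catalan i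
    γ′≡ = trans (cong (ℚ._* catalan (suc i)) (trans (sym (fromℕ-+ i 2)) (cong fromℕ (ℕ.+-comm i 2))))
      (trans (catalan-suc i) (cong (ℚ._* catalan i) (cast (# 4 ⊗ # i ⊕ # 2))))
    w₁≡ : fromℕ m ℚ.* w₁ ≡ (KQ.2# ℚ.* fromℕ i ℚ.+ 1ℚ) ℚ.* (fromℕ b ℚ.* (KQ.2# ℚ.* (fromℕ F ℚ.* fromℕ G)))
    w₁≡ = trans (sym (fromℕ-* m (W^-coeff (2 ℕ.* i ℕ.+ 1) m))) (trans (cong fromℕ W^[2i+1]-coeff) (cast ((# 2 ⊗ # i ⊕ # 1) ⊗ (# b ⊗ (# 2 ⊗ (# F ⊗ # G))))))
    w₂≡ : (fromℕ n ℚ.+ fromℕ i ℚ.+ 1ℚ) ℚ.* (fromℕ m ℚ.* w₂) ≡ (fromℕ i ℚ.+ KQ.2#) ℚ.* (fromℕ n ℚ.* (fromℕ b ℚ.* (KQ.4# ℚ.* (fromℕ F ℚ.* fromℕ G))))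
    w₂≡ = trans (sym (cast ((# n ⊕ # i ⊕ # 1) ⊗ (# m ⊗ # (W^-coeff (2 ℕ.* i ℕ.+ 1 ℕ.+ 3) m))))) (trans (cong fromℕ W^[2i+4]-coeff) (cast ((# i ⊕ # 2) ⊗ (# n ⊗ (# b ⊗ (# 4 ⊗ (# F ⊗ # G)))))))
    b≡ : (KQ.2# ℚ.* fromℕ n ℚ.+ KQ.2# ℚ.* fromℕ i ℚ.+ 1ℚ) ℚ.* fromℕ b ≡ fromℕ m ℚ.* fromℕ (N C n)
    b≡ = trans (sym (cast ((# 2 ⊗ # n ⊕ # 2 ⊗ # i ⊕ # 1) ⊗ # b))) (trans (cong fromℕ nCk-absorb) (fromℕ-* m (N C n)))

open import Data.Nat.Base using (_+_; _*_; _^_)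

theorem1 :
  ( (W : ℚ⟦t⟧.Carrier) → IsW W →
    ( (W⁻¹ : ℚ⦅t⦆.Carrier) → IsReciprocal (ℚ⦅t⦆.fromPowerSeries W) W⁻¹ →
      (√1-xW² : ℚ[x,x⁻¹]⟦t⟧.Carrier) → IsSqrt (1-xW² W) √1-xW² →
      let module L = ℚ[x,x⁻¹]⦅t⦆ in
      L.fromPowerSeries Q[x,0] L.≈
        L.t⁻¹ L.* L.x⁻¹ L.*
          ( L.fromℚ ½ L.* L.t⁻¹ L.- L.x⁻¹
            L.- (L.fromℚ⦅t⦆ W⁻¹ L.- L.x⁻¹) L.* L.fromPowerSeries √1-xW² ) )
    ×
    ( (i : ℕ) →
      let module K = ℚ⦅t⦆
          w = K.fromPowerSeries W
      in
      ℚ[x,x⁻¹]⦅t⦆.[x^ i ] (ℚ[x,x⁻¹]⦅t⦆.fromPowerSeries Q[x,0]) K.≈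
        w K.^ (2 * i + 1) K.* (K.const ½ K.* K.const (+ 1 / 4) K.^ i K.* K.t⁻¹) K.*
          (K.const (catalan i) K.- K.const (catalan (suc i)) K.* w K.^ 3 K.* K.const (+ 1 / 4)) ) )
  ×
  ( (i n : ℕ) →
    fromℕ (a[ i , 0 ] (3 * n + 2 * i)) ≡
      (+ (4 ^ n * (2 * i + 1))) / (suc (n + i) * suc (2 * n + 2 * i))
        ℚ.* fromℕ ((2 * i) C i)
        ℚ.* fromℕ ((3 * n + 2 * i) C n) )
theorem1 =
  ( λ W W-eq →
      (λ W⁻¹ reciprocal √1-xW² isSqrt → OnAxis.on-axis W W-eq √1-xW² isSqrt W⁻¹ reciprocal) ,
      OnAxis.axis-coefficients W W-eq ) ,
  axis-walks-formula
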